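{- There exist an absolute constant $C>0$ and a sequence $(\delta_n)_{n\ge 1}$ of real numbers with $\delta_n\to 0$ as $n\to\infty$ (not depending on $k$) such that for all integers $2\le k<n$, all but at most a $\delta_n$ fraction of the $(n-k)$-symmetric functions $f:\mathbb{Z}_2^n\to\mathbb{Z}_2$ are $q$-locally correctable for $\varepsilon=0.001$ by an algorithm using $q\le C\,k\log^2 k$ non-adaptive queries.
   Context: For $f:\mathbb{Z}_2^n\to\mathbb{Z}_2$ and a permutation $\sigma\in\mathcal{S}_n$, let $f_\sigma(x_1,\dots,x_n)=f(x_{\sigma(1)},\dots,x_{\sigma(n)})$; such an $f_\sigma$ is called an isomorphism of $f$. Two functions $f,g:\mathbb{Z}_2^n\to\mathbb{Z}_2$ are $\varepsilon$-close if $\Pr_x[f(x)\ne g(x)]\le\varepsilon$ for uniformly random $x\in\mathbb{Z}_2^n$. Local correction: $f$ (known to the algorithm) is $q$-locally correctable for $\varepsilon>0$ if there is a randomized algorithm which, for every $\sigma\in\mathcal{S}_n$, every $g$ that is $\varepsilon$-close to $f_\sigma$, and every $x\in\mathbb{Z}_2^n$, given $x$ and black-box (query) access to $g$ (but not $\sigma$), outputs $f_\sigma(x)$ with probability at least $2/3$ using at most $q$ queries to $g$. The algorithm is non-adaptive if its query points do not depend on answers to earlier queries (they may depend on $f$, on $x$ and on the algorithm's randomness). No restriction is put on computation time. A function $f:\mathbb{Z}_2^n\to\mathbb{Z}_2$ is $t$-symmetric if there is a set of $t$ variables such that any reordering of these variables does not change $f$. Equivalently, $f$ is $(n-k)$-symmetric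 if there is a set $J$ of $k$ variables (the asymmetric variables) such that $f(x)$ is determined by $x_J$ and the Hamming weight of the remaining $n-k$ coordinates; the core of $f$ is the corresponding function $f_{\mathrm{core}}:\mathbb{Z}_2^k\times\{0,1,\dots,n-k\}\to\mathbb{Z}_2$. Local correctability is invariant under isomorphism of $f$, and the fraction of $(n-k)$-symmetric functions having a property is measured by choosing the core uniformly at random among all functions $\mathbb{Z}_2^k\times\{0,\dots,n-k\}\to\mathbb{Z}_2$ (with a fixed set $J$ of $k$ asymmetric variables). -}

module Defs where

open import Data.Bool using (Bool; true; false; T?; if_then_else_)
open import Data.Bool.Properties using (_≟_)
open import Data.Fin using (Fin; zero; suc; combine; fromℕ<)
open import Data.Fin.Permutation using (Permutation′; _⟨$⟩ʳ_)
open import Data.Fin.Subset using (Subset; inside; outside; ∣_∣; ∁)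
open import Data.Fin.Subset.Properties using (∣p∣≤n)
open import Data.Integer using (+_)
import Data.List as List
open import Data.List.NonEmpty using (List⁺; [_]; toList; length; _⁺++⁺_) renaming (map to map⁺)
open import Data.Nat using (ℕ; zero; suc; NonZero; s≤s) renaming (_*_ to _*ℕ_; _^_ to _^ℕ_; _≤_ to _≤ℕ_)
open import Data.Product using (Σ-syntax; ∃-syntax; _×_)
open import Data.Rational.Unnormalised using (ℚᵘ; 0ℚᵘ; _/_; _*_; _≤_; _<_) renaming (∣_∣ to ∣_∣ℚ)
open import Data.Vec using (Vec; []; _∷_; lookup; tabulate; map)
open import Relation.Binary.PropositionalEquality using (_≡_)
open import Relation.Nullary.Decidable using (¬?)
open import Relation.Unary using (Decidable)

-- Probability of an event under the uniform distribution on the positions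
-- of a nonempty list.
Pr : {A : Set} {P : A → Set} → List⁺ A → Decidable P → ℚᵘ
Pr xs P? = + List.length (List.filter P? (toList xs)) / length xs

Point : ℕ → Set
Point n = Vec Bool n

BoolFun : ℕ → Set
BoolFun n = Point n → Bool

-- Every element of ℤ₂ⁿ, exactly once.
allPoints : ∀ n → List⁺ (Point n)
allPoints zero    = [ [] ]
allPoints (suc n) = map⁺ (false ∷_) (allPoints n) ⁺++⁺ map⁺ (true ∷_) (allPoints n)

-- f_σ (x₁,…,xₙ) = f (x_σ(1),…,x_σ(n))
isomorph : ∀ {n} → Permutation′ n → BoolFun n → BoolFun n
isomorph σ f x = f (tabulate λ i → lookup x (σ ⟨$⟩ʳ i))

Close : ∀ {n} → ℚᵘ → BoolFun n → BoolFun n → Set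
Close {n} ε f g = Pr (allPoints n) (λ x → ¬? (f x ≟ g x)) ≤ ε

-- All query points are fixed by the input x before any answer is seen.
record NonAdaptiveAlgorithm (n q : ℕ) : Set where
  field
    numQueries   : Point n → ℕ
    numQueries≤q : ∀ x → numQueries x ≤ℕ q
    queries      : ∀ x → Vec (Point n) (numQueries x)
    output       : ∀ x → Vec Bool (numQueries x) → Bool

  run : BoolFun n → Point n → Bool
  run g x = output x (map g (queries x))

-- A randomized algorithm is a uniformly random entry of a finite list of
-- deterministic ones.  Repeated entries give every rational distribution, and
-- these suffice: for fixed f and q, attaining success probability 2/3 on all
-- inputs is a linear system with rational coefficients in the distribution.
RandomizedNonAdaptiveAlgorithm : ℕ → ℕ → Set
RandomizedNonAdaptiveAlgorithm n q = List⁺ (NonAdaptiveAlgorithm n q)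

-- The algorithm is chosen after f but before σ, g and x.
NonAdaptivelyLocallyCorrectable : ∀ {n} → ℕ → ℚᵘ → BoolFun n → Set
NonAdaptivelyLocallyCorrectable {n} q ε f =
  Σ[ A ∈ RandomizedNonAdaptiveAlgorithm n q ]
    (∀ (σ : Permutation′ n) (g : BoolFun n) → Close ε g (isomorph σ f) →
     ∀ (x : Point n) →
     + 2 / 3 ≤ Pr A (λ a → NonAdaptiveAlgorithm.run a g x ≟ isomorph σ f x))

restrict : ∀ {n} (J : Subset n) → Point n → Point ∣ J ∣
restrict []            []      = []
restrict (inside  ∷ J) (b ∷ x) = b ∷ restrict J x
restrict (outside ∷ J) (_ ∷ x) = restrict J x

-- ∣ x ∣ is the number of true entries of x.
hammingWeight : ∀ {m} → Point m → Fin (suc m)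
hammingWeight x = fromℕ< (s≤s (∣p∣≤n x))

-- The number with binary expansion y: a bijection ℤ₂ᵏ → Fin (2ᵏ).
index : ∀ {k} → Point k → Fin (2 ^ℕ k)
index []              = zero
index {suc k} (b ∷ y) = combine {2} {2 ^ℕ k} (if b then suc zero else zero) (index y)

-- Functions ℤ₂ᵏ × {0,…,m} → ℤ₂, represented by their value tables so that each
-- function is counted exactly once (functions in Agda lack extensionality).
Core : ℕ → ℕ → Set
Core k m = Point (2 ^ℕ k *ℕ suc m)

applyCore : ∀ {k m} → Core k m → Point k → Fin (suc m) → Bool
applyCore c y w = lookup c (combine (index y) w)

allCores : ∀ k m → List⁺ (Core k m)
allCores k m = allPoints (2 ^ℕ k *ℕ suc m)

-- The (n-k)-symmetric function with set J of k = ∣ J ∣ asymmetric variables and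
-- core c; note that ∣ ∁ J ∣ = n - k.
symmetricFun : ∀ {n} (J : Subset n) → Core ∣ J ∣ ∣ ∁ J ∣ → BoolFun n
symmetricFun J c x = applyCore c (restrict J x) (hammingWeight (restrict (∁ J) x))

-- All but at most a δ fraction of the cores satisfy P.  The exceptional set is
-- given by its indicator, because P itself need not be decidable.
AllButFraction : ∀ k m → ℚᵘ → (Core k m → Set) → Set
AllButFraction k m δ P =
  Σ[ exceptional ∈ (Core k m → Bool) ]
    (Pr (allCores k m) (λ c → T? (exceptional c)) ≤ δ ×
     (∀ c → exceptional c ≡ false → P c))

-- q ≤ C · k · (log₂ k)², for k ≥ 1.  The real number log₂ k is the infimum of
-- the rationals a / b above it, i.e. those with kᵇ ≤ 2ᵃ, so the real inequality
-- holds exactly when it holds with a / b for log₂ k, for all such a / b.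
-- Another base of the logarithm only rescales C.
AtMostCklog²k : (C : ℚᵘ) (k q : ℕ) → Set
AtMostCklog²k C k q =
  ∀ (a b : ℕ) .{{_ : NonZero b}} → k ^ℕ b ≤ℕ 2 ^ℕ a →
  + q / 1 ≤ C * (+ k / 1) * ((+ a / b) * (+ a / b))

TendsToZero : (ℕ → ℚᵘ) → Set
TendsToZero δ = ∀ (η : ℚᵘ) → 0ℚᵘ < η → ∃[ N ] (∀ n → N ≤ℕ n → ∣ δ n ∣ℚ < η)

{-# OPTIONS --safe #-}

-- The asymmetric variables sit at unknown places a₁,…,a_k.  Hash the coordinates to O(k²)
-- values; together with the input x this labels coordinate j by (h j, x j).  All queries of
-- one run share a uniform point z and have the form z ⊕ mask: the mask is a fresh random
-- function t of the label, except on a small random block R of about n/k coordinates, where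
-- it consists of fresh random bits.  As z is uniform, so is each query, so by Markov few
-- queries are corrupted.  If R misses the aᵢ and h separates them, the answers are determined
-- by the k literals z(aᵢ) ⊕ t(label(aᵢ)) and the weight of the query, so only k^O(k) candidates
-- have to be told apart, and the labels in the correct one contain the bits x(aᵢ).  Nearest-candidate
-- decoding works with O(k log k) queries once any two candidates disagree on a constant
-- fraction of all queries.
--
-- The disagreement of two candidates is the size of a cut, induced by the random core, in a
-- graph whose vertices are the cells of the core.  The literals and the bits on R spread the
-- edges so thinly that all degrees are small, and an exponential moment computed by revealing
-- one cell at a time shows that the cut is small only with probability exp(-Ω(2^k (n/k)^(1/4))).
-- This survives the union bound over pairs of candidates and over the ways in which the
-- weight outside R can depend on t, of which there are n^O(k²).

module Submission where

open import Defs
open import Data.Bool using (Bool; true; false; not; _xor_; if_then_else_; T; T?)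
import Data.Bool.Properties as Bool
open import Data.Bool.Properties using (xor-comm)
open import Data.Fin using (Fin; zero; suc; toℕ; combine; remQuot; splitAt)
import Data.Fin.Properties as Fin
open import Data.Fin.Permutation using (Permutation′; _⟨$⟩ʳ_; _⟨$⟩ˡ_; inverseˡ)
open import Data.Fin.Subset using (Subset; inside; outside; ∣_∣; ∁)
open import Data.Fin.Subset.Properties using (∣p∣≤n; ∣⊤∣≡n; ∣⊥∣≡0; ∣∁p∣≡n∸∣p∣)
import Data.Integer as ℤ
import Data.Integer.Properties as ℤ
open import Data.List using (List; []; _∷_; _++_; map; length; filter; cartesianProduct; cartesianProductWith; allFin; upTo)
open import Data.List.Membership.Propositional using (_∈_; lose)
open import Data.List.Membership.Propositional.Properties using (∈-cartesianProductWith⁺; ∈-cartesianProduct⁺; ∈-allFin; ∈-upTo⁺; ∈-map⁻; ∈-filter⁻)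
open import Data.List.NonEmpty using (List⁺; _∷_; toList)
import Data.List.NonEmpty as List⁺
open import Data.List.Properties using (length-++; length-map; map-tabulate; length-tabulate; length-upTo)
open import Data.List.Relation.Unary.Any using (Any; here; there; any?)
import Data.List.Relation.Unary.Any as Any
open import Data.Nat using (ℕ; zero; suc; _+_; _*_; _∸_; _^_; _⊔_; z≤n; s≤s; NonZero; _≤?_; _<?_; >-nonZero; ≢-nonZero; ≢-nonZero⁻¹) renaming (_≤_ to _≤ℕ_; _<_ to _<ℕ_; _≟_ to _≟ℕ_; _/_ to _/ℕ_; _%_ to _%ℕ_)
open import Data.Nat.Combinatorics using (nCk≡nC[n∸k]; nCk+nC[k+1]≡[n+1]C[k+1]; nCn≡1; k>n⇒nCk≡0) renaming (_C_ to _ℂ_)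
open import Data.Nat.DivMod using (_mod_; m%n<n; m≡m%n+[m/n]*n; [m+kn]%n≡m%n; %-distribˡ-+; m%n%n≡m%n; m≤n⇒m%n≡m)
import Data.Nat.Properties as ℕ
open import Algebra.Properties.CommutativeMonoid.Sum ℕ.+-0-commutativeMonoid using (sum; sum-permute)
open import Data.Nat.Solver using (module +-*-Solver)
open import Data.Product using (Σ-syntax; ∃-syntax; _×_; _,_; proj₁; proj₂)
open import Data.Product.Properties using (≡-dec)
open import Data.Rational.Unnormalised using (ℚᵘ; 0ℚᵘ; mkℚᵘ; *≤*; *<*) renaming (∣_∣ to ∣_∣ℚ; _/_ to _/ℚ_; _≤_ to _≤ℚ_; _<_ to _<ℚ_)
open import Data.Sum using (inj₁; inj₂)
import Data.Sum
open import Data.Vec using (Vec; []; _∷_; lookup; tabulate; zipWith; updateAt; replicate)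
import Data.Vec as Vec
import Data.Vec.Properties as Vec
open import Data.Vec.Relation.Unary.Unique.Propositional using (Unique; []; _∷_)
open import Data.Vec.Relation.Unary.Unique.Propositional.Properties using (tabulate⁺)
open import Data.Vec.Relation.Unary.All using (All; []; _∷_)
open import Data.Vec.Relation.Unary.AllPairs using (allPairs?)
open import Function using (_∘_; id; _∋_)
open import Relation.Binary.PropositionalEquality using (_≡_; _≢_; refl; sym; trans; cong; cong₂; subst; subst₂; module ≡-Reasoning)
open import Relation.Nullary using (Dec; yes; no; ¬_; does; contradiction)
open import Relation.Nullary.Decidable using (¬?; _×-dec_; dec-true; dec-false; decidable-stable)

-- Finite sums

-- Naming the places of the asymmetric variables directly would leave about n^k candidates and cost
-- k log n queries; hashing makes their number a function of k alone. When 2^k is small against k²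
-- log n, the literals alone reach too few cells to pay for the union bound, and for this the block
-- `R` makes the weight random as well. The union bound has to cover every hash, input and shift,
-- yet they act on a disagreement only through the two candidates and the table `κ` of weight
-- contributions per label, so few cases remain. Error budget: `Hit`, `Collision`, `Noisy` and
-- `Confused` have probability at most 1/12 each, which leaves 2/3. Two candidates disagree on an
-- expected `6 * Q` or more of the `120 * Q` queries, and on more than `3 * Q` except with
-- probability 2^(-Q). Accepting candidates with at most `3 * Q / 2` mismatches is then unambiguous.
-- The queries share `z`, so their corruptions are dependent and no Chernoff bound applies to the
-- noise; but its mean is at most 0.12 `Q`, and Markov's inequality gives 0.12 / 1.5 = 0.08 < 1/12.

infixl 6 _⊕_

∑ : {A : Set} → List A → (A → ℕ) → ℕ
∑ []       f = 0
∑ (x ∷ xs) f = f x + ∑ xs f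

∑-cong : {A : Set} {f g : A → ℕ} (xs : List A) → (∀ x → f x ≡ g x) → ∑ xs f ≡ ∑ xs g
∑-cong []       f≡g = refl
∑-cong (x ∷ xs) f≡g = cong₂ _+_ (f≡g x) (∑-cong xs f≡g)

∑-mono : {A : Set} {f g : A → ℕ} (xs : List A) → (∀ x → f x ≤ℕ g x) → ∑ xs f ≤ℕ ∑ xs g
∑-mono []       f≤g = z≤n
∑-mono (x ∷ xs) f≤g = ℕ.+-mono-≤ (f≤g x) (∑-mono xs f≤g)

∑-const : {A : Set} (xs : List A) (c : ℕ) → ∑ xs (λ _ → c) ≡ length xs * c
∑-const []       c = refl
∑-const (x ∷ xs) c = cong (c +_) (∑-const xs c)

∑-zero : {A : Set} (xs : List A) {f : A → ℕ} → (∀ x → f x ≡ 0) → ∑ xs f ≡ 0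
∑-zero xs f≡0 = trans (∑-cong xs f≡0) (trans (∑-const xs 0) (ℕ.*-zeroʳ (length xs)))

∑-+ : {A : Set} (f g : A → ℕ) (xs : List A) → ∑ xs (λ x → f x + g x) ≡ ∑ xs f + ∑ xs g
∑-+ f g []       = refl
∑-+ f g (x ∷ xs) = begin
  f x + g x + ∑ xs (λ y → f y + g y)  ≡⟨ cong (λ w → f x + g x + w) (∑-+ f g xs) ⟩
  f x + g x + (∑ xs f + ∑ xs g)       ≡⟨ solve 4 (λ a b c d → a :+ b :+ (c :+ d) := a :+ c :+ (b :+ d)) refl (f x) (g x) (∑ xs f) (∑ xs g) ⟩
  f x + ∑ xs f + (g x + ∑ xs g)       ∎
  where open ≡-Reasoning
        open +-*-Solver

∑-*ˡ : {A : Set} (c : ℕ) (f : A → ℕ) (xs : List A) → ∑ xs (λ x → c * f x) ≡ c * ∑ xs f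
∑-*ˡ c f []       = sym (ℕ.*-zeroʳ c)
∑-*ˡ c f (x ∷ xs) = trans (cong (c * f x +_) (∑-*ˡ c f xs)) (sym (ℕ.*-distribˡ-+ c (f x) (∑ xs f)))

∑-*ʳ : {A : Set} (f : A → ℕ) (c : ℕ) (xs : List A) → ∑ xs (λ x → f x * c) ≡ ∑ xs f * c
∑-*ʳ f c []       = refl
∑-*ʳ f c (x ∷ xs) = trans (cong (f x * c +_) (∑-*ʳ f c xs)) (sym (ℕ.*-distribʳ-+ c (f x) (∑ xs f)))

∑-swap : {A B : Set} (f : A → B → ℕ) (xs : List A) (ys : List B) →
         ∑ xs (λ x → ∑ ys (λ y → f x y)) ≡ ∑ ys (λ y → ∑ xs (λ x → f x y))
∑-swap f []       ys = sym (∑-zero ys (λ _ → refl))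
∑-swap f (x ∷ xs) ys = trans (cong (∑ ys (f x) +_) (∑-swap f xs ys))
                             (sym (∑-+ (f x) (λ y → ∑ xs (λ z → f z y)) ys))

∑-++ : {A : Set} (f : A → ℕ) (xs ys : List A) → ∑ (xs ++ ys) f ≡ ∑ xs f + ∑ ys f
∑-++ f []       ys = refl
∑-++ f (x ∷ xs) ys = trans (cong (f x +_) (∑-++ f xs ys)) (sym (ℕ.+-assoc (f x) (∑ xs f) (∑ ys f)))

∑-map : {A B : Set} (f : B → ℕ) (h : A → B) (xs : List A) → ∑ (map h xs) f ≡ ∑ xs (f ∘ h)
∑-map f h []       = refl
∑-map f h (x ∷ xs) = cong (f (h x) +_) (∑-map f h xs)

length≡∑1 : {A : Set} (xs : List A) → length xs ≡ ∑ xs (λ _ → 1)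
length≡∑1 xs = sym (trans (∑-const xs 1) (ℕ.*-identityʳ (length xs)))

∑-product : {A B C : Set} (g : A → B → C) (f : C → ℕ) (xs : List A) (ys : List B) →
            ∑ (cartesianProductWith g xs ys) f ≡ ∑ xs (λ x → ∑ ys (λ y → f (g x y)))
∑-product g f []       ys = refl
∑-product g f (x ∷ xs) ys = trans (∑-++ f (map (g x) ys) _) (cong₂ _+_ (∑-map f (g x) ys) (∑-product g f xs ys))

length-product : {A B C : Set} (g : A → B → C) (xs : List A) (ys : List B) →
                 length (cartesianProductWith g xs ys) ≡ length xs * length ys
length-product g []       ys = refl
length-product g (x ∷ xs) ys =
  trans (length-++ (map (g x) ys)) (cong₂ _+_ (length-map (g x) ys) (length-product g xs ys))

words : {A : Set} → List A → ∀ n → List (Vec A n)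
words xs zero    = [] ∷ []
words xs (suc n) = cartesianProductWith _∷_ xs (words xs n)

length-words : {A : Set} (xs : List A) → ∀ n → length (words xs n) ≡ length xs ^ n
length-words xs zero    = refl
length-words xs (suc n) = trans (length-product _∷_ xs (words xs n)) (cong (length xs *_) (length-words xs n))

∈-words : {A : Set} {xs : List A} {n : ℕ} (v : Vec A n) → (∀ i → lookup v i ∈ xs) → v ∈ words xs n
∈-words []      v∈ = here refl
∈-words (x ∷ v) v∈ = ∈-cartesianProductWith⁺ _∷_ (v∈ zero) (∈-words v (v∈ ∘ suc))

points : ∀ n → List (Point n)
points zero    = [] ∷ []
points (suc n) = map (false ∷_) (points n) ++ map (true ∷_) (points n)

toList-allPoints : ∀ n → toList (allPoints n) ≡ points n
toList-allPoints zero    = refl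
toList-allPoints (suc n) = cong₂ _++_ (cong (map (false ∷_)) (toList-allPoints n)) (cong (map (true ∷_)) (toList-allPoints n))

∑-points : ∀ n (f : Point (suc n) → ℕ) →
           ∑ (points (suc n)) f ≡ ∑ (points n) (f ∘ (false ∷_)) + ∑ (points n) (f ∘ (true ∷_))
∑-points n f = trans (∑-++ f (map (false ∷_) (points n)) (map (true ∷_) (points n)))
                     (cong₂ _+_ (∑-map f (false ∷_) (points n)) (∑-map f (true ∷_) (points n)))

length-points : ∀ n → length (points n) ≡ 2 ^ n
length-points zero    = refl
length-points (suc n) = begin
  length (map (false ∷_) (points n) ++ map (true ∷_) (points n))
    ≡⟨ length-++ (map (false ∷_) (points n)) ⟩
  length (map (false ∷_) (points n)) + length (map (true ∷_) (points n))
    ≡⟨ cong₂ _+_ (length-map (false ∷_) (points n)) (length-map (true ∷_) (points n)) ⟩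
  length (points n) + length (points n)
    ≡⟨ cong₂ _+_ (length-points n) (trans (length-points n) (sym (ℕ.+-identityʳ (2 ^ n)))) ⟩
  2 ^ suc n ∎
  where open ≡-Reasoning

_⊕_ : ∀ {n} → Point n → Point n → Point n
_⊕_ = zipWith _xor_

∑-⊕ : ∀ {n} (f : Point n → ℕ) (m : Point n) → ∑ (points n) (λ z → f (z ⊕ m)) ≡ ∑ (points n) f
∑-⊕ {zero}  f []          = refl
∑-⊕ {suc n} f (false ∷ m) = trans (∑-points n _) (trans
  (cong₂ _+_ (∑-⊕ (f ∘ (false ∷_)) m) (∑-⊕ (f ∘ (true ∷_)) m)) (sym (∑-points n f)))
∑-⊕ {suc n} f (true ∷ m)  = trans (∑-points n _) (trans
  (cong₂ _+_ (∑-⊕ (f ∘ (true ∷_)) m) (∑-⊕ (f ∘ (false ∷_)) m))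
  (trans (ℕ.+-comm _ (∑ (points n) (f ∘ (false ∷_)))) (sym (∑-points n f))))

flip : ∀ {n} → Fin n → Point n → Point n
flip j t = updateAt t j not

∑-flip : ∀ {n} (f : Point n → ℕ) (j : Fin n) → ∑ (points n) (f ∘ flip j) ≡ ∑ (points n) f
∑-flip {suc n} f zero    = trans (∑-points n _) (trans (ℕ.+-comm (∑ (points n) (f ∘ (true ∷_))) _) (sym (∑-points n f)))
∑-flip {suc n} f (suc j) = trans (∑-points n _) (trans
  (cong₂ _+_ (∑-flip (f ∘ (false ∷_)) j) (∑-flip (f ∘ (true ∷_)) j)) (sym (∑-points n f)))

2*∑-flip : ∀ {n} (f : Point n → ℕ) (j : Fin n) → 2 * ∑ (points n) f ≡ ∑ (points n) (λ t → f t + f (flip j t))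
2*∑-flip {n} f j = begin
  ∑ (points n) f + (∑ (points n) f + 0)         ≡⟨ cong (∑ (points n) f +_) (trans (ℕ.+-identityʳ _) (sym (∑-flip f j))) ⟩
  ∑ (points n) f + ∑ (points n) (f ∘ flip j)    ≡⟨ ∑-+ f (f ∘ flip j) (points n) ⟨
  ∑ (points n) (λ t → f t + f (flip j t))       ∎
  where open ≡-Reasoning

𝟙 : {P : Set} → Dec P → ℕ
𝟙 P? = if does P? then 1 else 0

𝟙-yes : {P : Set} (P? : Dec P) → P → 𝟙 P? ≡ 1
𝟙-yes P? p rewrite dec-true P? p = refl

𝟙-no : {P : Set} (P? : Dec P) → ¬ P → 𝟙 P? ≡ 0
𝟙-no P? ¬p rewrite dec-false P? ¬p = refl

𝟙≤ : {P : Set} (P? : Dec P) {c : ℕ} → (P → 1 ≤ℕ c) → 𝟙 P? ≤ℕ c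
𝟙≤ (yes p) 1≤c = 1≤c p
𝟙≤ (no ¬p) 1≤c = z≤n

𝟙-mono : {P Q : Set} (P? : Dec P) (Q? : Dec Q) → (P → Q) → 𝟙 P? ≤ℕ 𝟙 Q?
𝟙-mono P? Q? P⇒Q = 𝟙≤ P? (λ p → ℕ.≤-reflexive (sym (𝟙-yes Q? (P⇒Q p))))

𝟙≤1 : {P : Set} (P? : Dec P) → 𝟙 P? ≤ℕ 1
𝟙≤1 P? = 𝟙≤ P? (λ _ → ℕ.≤-refl)

length-filter : {A : Set} {P : A → Set} (P? : ∀ x → Dec (P x)) (xs : List A) →
                length (filter P? xs) ≡ ∑ xs (λ x → 𝟙 (P? x))
length-filter P? []       = refl
length-filter P? (x ∷ xs) with does (P? x)
... | true  = cong suc (length-filter P? xs)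
... | false = length-filter P? xs

-- The average of `f` is at most 1/`d`, cleared of denominators. For indicators this is a
-- probability bound; sums of indicators serve for union bounds.
Rare : {A : Set} → ℕ → List A → (A → ℕ) → Set
Rare d xs f = d * ∑ xs f ≤ℕ length xs

rare-mono : {A : Set} {d : ℕ} {f g : A → ℕ} (xs : List A) → (∀ x → f x ≤ℕ g x) → Rare d xs g → Rare d xs f
rare-mono {d = d} xs f≤g = ℕ.≤-trans (ℕ.*-monoʳ-≤ d (∑-mono xs f≤g))

rare-×ʳ : {A B : Set} {d : ℕ} {f : A × B → ℕ} (xs : List A) (ys : List B) →
          (∀ x → Rare d ys (λ y → f (x , y))) → Rare d (cartesianProduct xs ys) f
rare-×ʳ {d = d} {f} xs ys rare = begin
  d * ∑ (cartesianProduct xs ys) f              ≡⟨ cong (d *_) (∑-product _,_ f xs ys) ⟩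
  d * ∑ xs (λ x → ∑ ys (λ y → f (x , y)))       ≡⟨ ∑-*ˡ d _ xs ⟨
  ∑ xs (λ x → d * ∑ ys (λ y → f (x , y)))       ≤⟨ ∑-mono xs rare ⟩
  ∑ xs (λ _ → length ys)                        ≡⟨ ∑-const xs (length ys) ⟩
  length xs * length ys                         ≡⟨ length-product _,_ xs ys ⟨
  length (cartesianProduct xs ys)               ∎
  where open ℕ.≤-Reasoning

rare-×ˡ : {A B : Set} {d : ℕ} {f : A × B → ℕ} (xs : List A) (ys : List B) →
          (∀ y → Rare d xs (λ x → f (x , y))) → Rare d (cartesianProduct xs ys) f
rare-×ˡ {d = d} {f} xs ys rare = begin
  d * ∑ (cartesianProduct xs ys) f              ≡⟨ cong (d *_) (trans (∑-product _,_ f xs ys) (∑-swap _ xs ys)) ⟩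
  d * ∑ ys (λ y → ∑ xs (λ x → f (x , y)))       ≡⟨ ∑-*ˡ d _ ys ⟨
  ∑ ys (λ y → d * ∑ xs (λ x → f (x , y)))       ≤⟨ ∑-mono ys rare ⟩
  ∑ ys (λ _ → length xs)                        ≡⟨ ∑-const ys (length xs) ⟩
  length ys * length xs                         ≡⟨ ℕ.*-comm (length ys) (length xs) ⟩
  length xs * length ys                         ≡⟨ length-product _,_ xs ys ⟨
  length (cartesianProduct xs ys)               ∎
  where open ℕ.≤-Reasoning

union-bound : {A B : Set} {d e : ℕ} {f : B → A → ℕ} (bs : List B) (xs : List A) →
              d * length bs ≤ℕ e → (∀ b → Rare e xs (f b)) → Rare d xs (λ x → ∑ bs (λ b → f b x))
union-bound {d = d} [] xs _ _ = ℕ.≤-trans (ℕ.≤-reflexive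
  (trans (cong (d *_) (∑-zero xs (λ _ → refl))) (ℕ.*-zeroʳ d))) z≤n
union-bound {d = d} {e} {f} bs@(_ ∷ _) xs d*bs≤e rare = ℕ.*-cancelʳ-≤ _ _ (length bs) (begin
  d * ∑ xs (λ x → ∑ bs (λ b → f b x)) * length bs  ≡⟨ cong (λ w → d * w * length bs) (∑-swap _ xs bs) ⟩
  d * S * length bs                                ≡⟨ solve 3 (λ a b c → a :* b :* c := a :* c :* b) refl d S (length bs) ⟩
  d * length bs * S                                ≤⟨ ℕ.*-monoˡ-≤ S d*bs≤e ⟩
  e * S                                            ≡⟨ ∑-*ˡ e _ bs ⟨
  ∑ bs (λ b → e * ∑ xs (f b))                      ≤⟨ ∑-mono bs rare ⟩
  ∑ bs (λ _ → length xs)                           ≡⟨ ∑-const bs (length xs) ⟩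
  length bs * length xs                            ≡⟨ ℕ.*-comm (length bs) (length xs) ⟩
  length xs * length bs                            ∎)
  where open ℕ.≤-Reasoning
        open +-*-Solver
        S = ∑ bs (λ b → ∑ xs (f b))

^-distribʳ-* : ∀ m n o → (m * n) ^ o ≡ m ^ o * n ^ o
^-distribʳ-* m n zero    = refl
^-distribʳ-* m n (suc o) = trans (cong (m * n *_) (^-distribʳ-* m n o))
  (solve 4 (λ a b x y → a :* b :* (x :* y) := a :* x :* (b :* y)) refl m n (m ^ o) (n ^ o))
  where open +-*-Solver

-- Anticoncentration of the binomial distribution

nC0≡1 : ∀ n → n ℂ 0 ≡ 1
nC0≡1 n = trans (nCk≡nC[n∸k] {0} {n} z≤n) (nCn≡1 n)

∑-weight : ∀ n j → ∑ (points n) (λ r → 𝟙 (∣ r ∣ ≟ℕ j)) ≡ n ℂ j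
∑-weight zero    zero    = refl
∑-weight zero    (suc j) = sym (k>n⇒nCk≡0 {0} {suc j} (s≤s z≤n))
∑-weight (suc n) zero    = begin
  ∑ (points (suc n)) (λ r → 𝟙 (∣ r ∣ ≟ℕ 0))                          ≡⟨ ∑-points n _ ⟩
  ∑ (points n) (λ r → 𝟙 (∣ r ∣ ≟ℕ 0)) + ∑ (points n) (λ _ → 0)       ≡⟨ cong₂ _+_ (∑-weight n 0) (∑-zero (points n) (λ _ → refl)) ⟩
  n ℂ 0 + 0                                                          ≡⟨ trans (ℕ.+-identityʳ _) (trans (nC0≡1 n) (sym (nC0≡1 (suc n)))) ⟩
  suc n ℂ 0                                                          ∎
  where open ≡-Reasoning
∑-weight (suc n) (suc j) = begin
  ∑ (points (suc n)) (λ r → 𝟙 (∣ r ∣ ≟ℕ suc j))  ≡⟨ ∑-points n _ ⟩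
  ∑ (points n) (λ r → 𝟙 (∣ r ∣ ≟ℕ suc j)) + ∑ (points n) (λ r → 𝟙 (∣ r ∣ ≟ℕ j))
                                                 ≡⟨ cong₂ _+_ (∑-weight n (suc j)) (∑-weight n j) ⟩
  n ℂ suc j + n ℂ j                              ≡⟨ ℕ.+-comm (n ℂ suc j) (n ℂ j) ⟩
  n ℂ j + n ℂ suc j                              ≡⟨ nCk+nC[k+1]≡[n+1]C[k+1] n j ⟩
  suc n ℂ suc j                                  ∎
  where open ≡-Reasoning

C-monoˡ : ∀ n k → n ℂ k ≤ℕ suc n ℂ k
C-monoˡ n zero    = ℕ.≤-reflexive (trans (nC0≡1 n) (sym (nC0≡1 (suc n))))
C-monoˡ n (suc k) = subst (n ℂ suc k ≤ℕ_) (nCk+nC[k+1]≡[n+1]C[k+1] n k) (ℕ.m≤n+m _ _)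

-- One term of Vandermonde's convolution; induction on `a` by Pascal's rule avoids forming the whole
-- sum.
C*C≤C : ∀ a b i j → (a ℂ i) * (b ℂ j) ≤ℕ (a + b) ℂ (i + j)
C*C≤C zero    b zero    j = ℕ.≤-reflexive (ℕ.+-identityʳ (b ℂ j))
C*C≤C zero    b (suc i) j rewrite k>n⇒nCk≡0 {0} {suc i} (s≤s z≤n) = z≤n
C*C≤C (suc a) b zero    j = begin
  (suc a ℂ 0) * (b ℂ j)  ≡⟨ cong (_* (b ℂ j)) (trans (nC0≡1 (suc a)) (sym (nC0≡1 a))) ⟩
  (a ℂ 0) * (b ℂ j)      ≤⟨ C*C≤C a b 0 j ⟩
  (a + b) ℂ j            ≤⟨ C-monoˡ (a + b) j ⟩
  (suc a + b) ℂ j        ∎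
  where open ℕ.≤-Reasoning
C*C≤C (suc a) b (suc i) j = begin
  (suc a ℂ suc i) * (b ℂ j)                        ≡⟨ cong (_* (b ℂ j)) (nCk+nC[k+1]≡[n+1]C[k+1] a i) ⟨
  (a ℂ i + a ℂ suc i) * (b ℂ j)                    ≡⟨ ℕ.*-distribʳ-+ (b ℂ j) (a ℂ i) (a ℂ suc i) ⟩
  (a ℂ i) * (b ℂ j) + (a ℂ suc i) * (b ℂ j)        ≤⟨ ℕ.+-mono-≤ (C*C≤C a b i j) (C*C≤C a b (suc i) j) ⟩
  (a + b) ℂ (i + j) + (a + b) ℂ (suc (i + j))      ≡⟨ nCk+nC[k+1]≡[n+1]C[k+1] (a + b) (i + j) ⟩
  (suc a + b) ℂ (suc i + j)                        ∎
  where open ℕ.≤-Reasoning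

C-absorption : ∀ n k → suc k * (suc n ℂ suc k) ≡ suc n * (n ℂ k)
C-absorption zero    zero    = refl
C-absorption zero    (suc k) rewrite k>n⇒nCk≡0 {1} {suc (suc k)} (s≤s (s≤s z≤n)) | k>n⇒nCk≡0 {0} {suc k} (s≤s z≤n) = ℕ.*-zeroʳ (suc (suc k))
C-absorption (suc n) zero    = begin
  1 * (suc (suc n) ℂ 1)                 ≡⟨ ℕ.*-identityˡ _ ⟩
  suc (suc n) ℂ 1                       ≡⟨ nCk+nC[k+1]≡[n+1]C[k+1] (suc n) 0 ⟨
  suc n ℂ 0 + suc n ℂ 1                 ≡⟨ cong₂ _+_ (nC0≡1 (suc n)) (trans (sym (ℕ.*-identityˡ _)) (C-absorption n 0)) ⟩
  1 + suc n * (n ℂ 0)                   ≡⟨ cong (λ w → 1 + suc n * w) (nC0≡1 n) ⟩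
  suc (suc n) * 1                       ≡⟨ cong (suc (suc n) *_) (nC0≡1 (suc n)) ⟨
  suc (suc n) * (suc n ℂ 0)             ∎
  where open ≡-Reasoning
C-absorption (suc n) (suc k) = begin
  suc (suc k) * (suc (suc n) ℂ suc (suc k))     ≡⟨ cong (suc (suc k) *_) (nCk+nC[k+1]≡[n+1]C[k+1] (suc n) (suc k)) ⟨
  suc (suc k) * (X + Y)                         ≡⟨ solve 3 (λ κ x y → (con 1 :+ κ) :* (x :+ y) := x :+ κ :* x :+ (con 1 :+ κ) :* y) refl (suc k) X Y ⟩
  X + suc k * X + suc (suc k) * Y               ≡⟨ cong₂ (λ v w → X + v + w) (C-absorption n k) (C-absorption n (suc k)) ⟩
  X + suc n * (n ℂ k) + suc n * (n ℂ suc k)     ≡⟨ solve 4 (λ x ν a b → x :+ ν :* a :+ ν :* b := x :+ ν :* (a :+ b)) refl X (suc n) (n ℂ k) (n ℂ suc k) ⟩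
  X + suc n * (n ℂ k + n ℂ suc k)               ≡⟨ cong (λ w → X + suc n * w) (nCk+nC[k+1]≡[n+1]C[k+1] n k) ⟩
  suc (suc n) * X                               ∎
  where open ≡-Reasoning
        open +-*-Solver
        X = suc n ℂ suc k
        Y = suc n ℂ suc (suc k)

central : ℕ → ℕ
central m = (m + m) ℂ m

central-suc : ∀ m → suc m * central (suc m) ≡ 2 * (suc (m + m) * central m)
central-suc m = begin
  suc m * ((suc m + suc m) ℂ suc m)     ≡⟨ cong (λ w → suc m * (suc w ℂ suc m)) (ℕ.+-suc m m) ⟩
  suc m * (suc (suc (m + m)) ℂ suc m)   ≡⟨ cong (suc m *_) (nCk+nC[k+1]≡[n+1]C[k+1] (suc (m + m)) m) ⟨
  suc m * (X + suc (m + m) ℂ suc m)     ≡⟨ cong (λ w → suc m * (w + suc (m + m) ℂ suc m)) X≡ ⟩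
  suc m * (suc (m + m) ℂ suc m + suc (m + m) ℂ suc m)
                                        ≡⟨ solve 2 (λ μ y → μ :* (y :+ y) := con 2 :* (μ :* y)) refl (suc m) (suc (m + m) ℂ suc m) ⟩
  2 * (suc m * (suc (m + m) ℂ suc m))   ≡⟨ cong (2 *_) (C-absorption (m + m) m) ⟩
  2 * (suc (m + m) * central m)         ∎
  where
  open ≡-Reasoning
  open +-*-Solver
  X = suc (m + m) ℂ m
  X≡ : X ≡ suc (m + m) ℂ suc m
  X≡ = trans (nCk≡nC[n∸k] {m} {suc (m + m)} (ℕ.m≤n⇒m≤1+n (ℕ.m≤m+n m m)))
             (cong (suc (m + m) ℂ_) (trans (ℕ.+-∸-assoc 1 (ℕ.m≤m+n m m)) (cong suc (ℕ.m+n∸m≡n m m))))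

-- The Wallis-type estimate C(2m,m) ≤ 4^m / √(2m+1), squared to stay in ℕ. By `central-suc` the
-- induction step reduces to (2m+1)(2m+3) ≤ (2m+2)².
central-bound : ∀ m → suc (m + m) * (central m * central m) ≤ℕ 16 ^ m
central-bound zero    = ℕ.≤-refl
central-bound (suc m) = ℕ.*-cancelˡ-≤ (suc m * suc m) (begin
  suc m * suc m * (suc (suc m + suc m) * (c′ * c′))
    ≡⟨ solve 2 (λ μ x → (con 1 :+ μ) :* (con 1 :+ μ) :* ((con 1 :+ ((con 1 :+ μ) :+ (con 1 :+ μ))) :* (x :* x))
                      := (con 3 :+ (μ :+ μ)) :* (((con 1 :+ μ) :* x) :* ((con 1 :+ μ) :* x))) refl m c′ ⟩
  (3 + (m + m)) * ((suc m * c′) * (suc m * c′))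
    ≡⟨ cong (λ w → (3 + (m + m)) * (w * w)) (central-suc m) ⟩
  (3 + (m + m)) * ((2 * (suc (m + m) * c)) * (2 * (suc (m + m) * c)))
    ≡⟨ solve 2 (λ μ x → (con 3 :+ (μ :+ μ)) :* ((con 2 :* ((con 1 :+ (μ :+ μ)) :* x)) :* (con 2 :* ((con 1 :+ (μ :+ μ)) :* x)))
                      := con 4 :* ((con 3 :+ (μ :+ μ)) :* (con 1 :+ (μ :+ μ))) :* ((con 1 :+ (μ :+ μ)) :* (x :* x))) refl m c ⟩
  4 * ((3 + (m + m)) * suc (m + m)) * (suc (m + m) * (c * c))
    ≤⟨ ℕ.*-mono-≤ (ℕ.*-monoʳ-≤ 4 odd*odd≤) (central-bound m) ⟩
  4 * (4 * (suc m * suc m)) * 16 ^ m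
    ≡⟨ solve 2 (λ x y → con 4 :* (con 4 :* x) :* y := x :* (con 16 :* y)) refl (suc m * suc m) (16 ^ m) ⟩
  suc m * suc m * 16 ^ suc m ∎)
  where
  open ℕ.≤-Reasoning
  open +-*-Solver
  c′ = central (suc m)
  c = central m
  odd*odd≤ : (3 + (m + m)) * suc (m + m) ≤ℕ 4 * (suc m * suc m)
  odd*odd≤ = ℕ.≤-trans (ℕ.m≤n+m _ 1) (ℕ.≤-reflexive
    (solve 1 (λ μ → con 1 :+ (con 3 :+ (μ :+ μ)) :* (con 1 :+ (μ :+ μ)) := con 4 :* ((con 1 :+ μ) :* (con 1 :+ μ))) refl m))

-- By symmetry the square is C(n,j) C(n,n-j), a single Vandermonde term of C(2n,n). This treats all
-- `j` at once, without locating the largest coefficient or distinguishing the parity of `n`.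
C²≤central : ∀ n j → (n ℂ j) * (n ℂ j) ≤ℕ central n
C²≤central n j with j ≤? n
... | yes j≤n = begin
  (n ℂ j) * (n ℂ j)          ≡⟨ cong ((n ℂ j) *_) (nCk≡nC[n∸k] j≤n) ⟩
  (n ℂ j) * (n ℂ (n ∸ j))    ≤⟨ C*C≤C n n j (n ∸ j) ⟩
  (n + n) ℂ (j + (n ∸ j))    ≡⟨ cong ((n + n) ℂ_) (ℕ.m+[n∸m]≡n j≤n) ⟩
  central n                  ∎
  where open ℕ.≤-Reasoning
... | no j≰n rewrite k>n⇒nCk≡0 {n} {j} (ℕ.≰⇒> j≰n) = z≤n

-- Fourth powers combine the last two bounds: C(n,j)⁴ ≤ C(2n,n)² ≤ 16^n / (2n+1). The decay is
-- n^(-1/4) instead of the true n^(-1/2); this is the origin of the exponent 1/4 in the probability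
-- of an exceptional core.
binomial-anticoncentration : ∀ n ζ j → (2 ^ ζ) ^ 4 ≤ℕ suc (n + n) → 2 ^ ζ * (n ℂ j) ≤ℕ 2 ^ n
binomial-anticoncentration n ζ j 16^ζ≤ with 2 ^ ζ * (n ℂ j) ≤? 2 ^ n
... | yes p = p
... | no ¬p = contradiction (ℕ.^-monoˡ-< 4 (ℕ.≰⇒> ¬p)) (ℕ.≤⇒≯ (begin
  (2 ^ ζ * (n ℂ j)) ^ 4
    ≡⟨ solve 2 (λ z c → (z :* c) :^ 4 := z :^ 4 :* ((c :* c) :* (c :* c))) refl (2 ^ ζ) (n ℂ j) ⟩
  (2 ^ ζ) ^ 4 * (((n ℂ j) * (n ℂ j)) * ((n ℂ j) * (n ℂ j)))
    ≤⟨ ℕ.*-mono-≤ 16^ζ≤ (ℕ.*-mono-≤ (C²≤central n j) (C²≤central n j)) ⟩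
  suc (n + n) * (central n * central n)
    ≤⟨ central-bound n ⟩
  16 ^ n
    ≡⟨ ℕ.^-*-assoc 2 4 n ⟩
  2 ^ (4 * n)
    ≡⟨ cong (2 ^_) (ℕ.*-comm 4 n) ⟩
  2 ^ (n * 4)
    ≡⟨ ℕ.^-*-assoc 2 n 4 ⟨
  (2 ^ n) ^ 4 ∎))
  where open ℕ.≤-Reasoning
        open +-*-Solver

-- Concentration of random cuts

-- With y = 4 + a this is (1 - 4/y)^w ≤ 1/(1 + 4w/y).
bernoulli-upper : ∀ a w → a ^ w * (4 + a + 4 * w) ≤ℕ (4 + a) ^ suc w
bernoulli-upper a zero    = ℕ.≤-reflexive (solve 1 (λ x → con 1 :* (con 4 :+ x :+ con 0) := (con 4 :+ x) :* con 1) refl a)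
  where open +-*-Solver
bernoulli-upper a (suc w) = begin
  a * a ^ w * (4 + a + 4 * suc w)           ≤⟨ ℕ.m≤m+n _ (16 * (a ^ w * (1 + w))) ⟩
  a * a ^ w * (4 + a + 4 * suc w) + 16 * (a ^ w * (1 + w))
                                            ≡⟨ solve 3 (λ x p v → x :* p :* (con 4 :+ x :+ con 4 :* (con 1 :+ v)) :+ con 16 :* (p :* (con 1 :+ v)) := (con 4 :+ x) :* (p :* (con 4 :+ x :+ con 4 :* v))) refl a (a ^ w) w ⟩
  (4 + a) * (a ^ w * (4 + a + 4 * w))       ≤⟨ ℕ.*-monoʳ-≤ (4 + a) (bernoulli-upper a w) ⟩
  (4 + a) * (4 + a) ^ suc w                 ∎
  where open ℕ.≤-Reasoning
        open +-*-Solver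

-- With y = 1 + b this is 1 - w/y ≤ (1 - 1/y)^w.
bernoulli-lower : ∀ b w → suc b ^ suc w ≤ℕ suc b * b ^ w + w * suc b ^ w
bernoulli-lower b zero    = ℕ.m≤m+n _ 0
bernoulli-lower b (suc w) = begin
  suc b * suc b ^ suc w                                       ≡⟨ solve 2 (λ y p → (con 1 :+ y) :* p := y :* p :+ p) refl b (suc b ^ suc w) ⟩
  b * suc b ^ suc w + suc b ^ suc w                           ≤⟨ ℕ.+-monoˡ-≤ _ (ℕ.*-monoʳ-≤ b (bernoulli-lower b w)) ⟩
  b * (suc b * b ^ w + w * suc b ^ w) + suc b ^ suc w         ≤⟨ ℕ.m≤m+n _ (w * suc b ^ w) ⟩
  b * (suc b * b ^ w + w * suc b ^ w) + suc b ^ suc w + w * suc b ^ w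
                                                              ≡⟨ solve 4 (λ y p q v → y :* ((con 1 :+ y) :* p :+ v :* q) :+ (con 1 :+ y) :* q :+ v :* q := (con 1 :+ y) :* (y :* p) :+ (con 1 :+ v) :* ((con 1 :+ y) :* q)) refl b (b ^ w) (suc b ^ w) w ⟩
  suc b * b ^ suc w + suc w * suc b ^ suc w                   ∎
  where open ℕ.≤-Reasoning
        open +-*-Solver

bernoulli : ∀ b w → b ^ suc w + suc w * b ^ w ≤ℕ suc b ^ suc w
bernoulli b zero    = ℕ.≤-reflexive (solve 1 (λ y → y :* con 1 :+ con 1 := (con 1 :+ y) :* con 1) refl b)
  where open +-*-Solver
bernoulli b (suc w) = begin
  b ^ suc (suc w) + suc (suc w) * b ^ suc w                    ≤⟨ ℕ.m≤m+n _ (suc w * b ^ w) ⟩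
  b ^ suc (suc w) + suc (suc w) * b ^ suc w + suc w * b ^ w    ≡⟨ solve 3 (λ y p v → y :* (y :* p) :+ (con 2 :+ v) :* (y :* p) :+ (con 1 :+ v) :* p := (con 1 :+ y) :* (y :* p :+ (con 1 :+ v) :* p)) refl b (b ^ w) w ⟩
  suc b * (b ^ suc w + suc w * b ^ w)                          ≤⟨ ℕ.*-monoʳ-≤ (suc b) (bernoulli b w) ⟩
  suc b ^ suc (suc w)                                          ∎
  where open ℕ.≤-Reasoning
        open +-*-Solver

-- With y = 1 + b this is (1 - 1/y)^y ≤ 1/2. It converts every `y` edges to spare into a factor 2 of
-- probability in `cut-concentration`.
half-power : ∀ b → 2 * b ^ suc b ≤ℕ suc b ^ suc b
half-power b = begin
  b ^ suc b + (b ^ suc b + 0)       ≡⟨ cong (b ^ suc b +_) (ℕ.+-identityʳ _) ⟩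
  b ^ suc b + b * b ^ b             ≤⟨ ℕ.+-monoʳ-≤ (b ^ suc b) (ℕ.*-monoˡ-≤ (b ^ b) (ℕ.n≤1+n b)) ⟩
  b ^ suc b + suc b * b ^ b         ≤⟨ bernoulli b b ⟩
  suc b ^ suc b                     ∎
  where open ℕ.≤-Reasoning

-- Divided by 2 y^w with y = 4 + a, this compares the mean of 1 and (1 - 4/y)^w, the potentials of a
-- star with none or all of its `w` edges cut, with (1 - 1/y)^w.
two-point : ∀ a w → 4 * w ≤ℕ 4 + a → (4 + a) ^ w + a ^ w ≤ℕ 2 * (3 + a) ^ w
two-point a w 4w≤y = ℕ.*-cancelˡ-≤ y (ℕ.+-cancelʳ-≤ (2 * w * P) _ _ (begin
  y * (P + A) + 2 * w * P            ≡⟨ solve 4 (λ η p x v → η :* (p :+ x) :+ con 2 :* v :* p := η :* p :+ (x :* η :+ con 2 :* v :* p)) refl y P A w ⟩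
  y * P + (A * y + 2 * w * P)        ≤⟨ ℕ.+-monoʳ-≤ (y * P) step ⟩
  y * P + y * P                      ≡⟨ solve 1 (λ x → x :+ x := con 2 :* x) refl (y * P) ⟩
  2 * (y * P)                        ≤⟨ ℕ.*-monoʳ-≤ 2 (bernoulli-lower (3 + a) w) ⟩
  2 * (y * B + w * P)                ≡⟨ solve 4 (λ η x v p → con 2 :* (η :* x :+ v :* p) := η :* (con 2 :* x) :+ con 2 :* v :* p) refl y B w P ⟩
  y * (2 * B) + 2 * w * P            ∎))
  where
  open ℕ.≤-Reasoning
  open +-*-Solver
  y = 4 + a
  P = y ^ w
  A = a ^ w
  B = (3 + a) ^ w
  -- After division by `P`, `bernoulli-upper` leaves y/(y+4w) ≤ 1 - 2w/y, that is y² ≤ (y-2w)(y+4w),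
  -- and this is 4w ≤ y multiplied by 2w.
  step : A * y + 2 * w * P ≤ℕ y * P
  step = ℕ.*-cancelʳ-≤ _ _ (y + 4 * w) (begin
    (A * y + 2 * w * P) * (y + 4 * w)
      ≡⟨ solve 4 (λ x η v p → (x :* η :+ con 2 :* v :* p) :* (η :+ con 4 :* v) := η :* (x :* (η :+ con 4 :* v)) :+ con 2 :* v :* p :* η :+ con 2 :* v :* p :* (con 4 :* v)) refl A y w P ⟩
    y * (A * (y + 4 * w)) + 2 * w * P * y + 2 * w * P * (4 * w)
      ≤⟨ ℕ.+-mono-≤ (ℕ.+-monoˡ-≤ (2 * w * P * y) (ℕ.*-monoʳ-≤ y (bernoulli-upper a w))) (ℕ.*-monoʳ-≤ (2 * w * P) 4w≤y) ⟩
    y * (y * P) + 2 * w * P * y + 2 * w * P * y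
      ≡⟨ solve 3 (λ η p v → η :* (η :* p) :+ con 2 :* v :* p :* η :+ con 2 :* v :* p :* η := η :* p :* (η :+ con 4 :* v)) refl y P w ⟩
    y * P * (y + 4 * w) ∎)

-- (y^i - a^i)(y^j - a^j) ≥ 0
rearrangement : ∀ a y i j → a ≤ℕ y → a ^ i * y ^ j + a ^ j * y ^ i ≤ℕ y ^ (i + j) + a ^ (i + j)
rearrangement a y i j a≤y
  with p , y^i≡ ← ℕ.m≤n⇒∃[o]m+o≡n (ℕ.^-monoˡ-≤ i a≤y)
     | q , y^j≡ ← ℕ.m≤n⇒∃[o]m+o≡n (ℕ.^-monoˡ-≤ j a≤y)
  rewrite ℕ.^-distribˡ-+-* y i j | ℕ.^-distribˡ-+-* a i j | sym y^i≡ | sym y^j≡ = begin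
  a ^ i * (a ^ j + q) + a ^ j * (a ^ i + p)          ≤⟨ ℕ.m≤m+n _ (p * q) ⟩
  a ^ i * (a ^ j + q) + a ^ j * (a ^ i + p) + p * q  ≡⟨ solve 4 (λ x z p q → x :* (z :+ q) :+ z :* (x :+ p) :+ p :* q := (x :+ p) :* (z :+ q) :+ x :* z) refl (a ^ i) (a ^ j) p q ⟩
  (a ^ i + p) * (a ^ j + q) + a ^ i * a ^ j          ∎
  where open ℕ.≤-Reasoning
        open +-*-Solver

Edge : ℕ → Set
Edge N = Fin N × Fin N

cut? : ∀ {N} (c : Point N) (e : Edge N) → Dec (lookup c (proj₁ e) ≢ lookup c (proj₂ e))
cut? c (u , v) = ¬? (lookup c u Bool.≟ lookup c v)

cutSize : ∀ {N} → List (Edge N) → Point N → ℕ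
cutSize es c = ∑ es (λ e → 𝟙 (cut? c e))

degree : ∀ {N} → List (Edge N) → Fin N → ℕ
degree es i = ∑ es (λ e → 𝟙 (proj₁ e Fin.≟ i) + 𝟙 (proj₂ e Fin.≟ i))

Loopless : ∀ {N} → List (Edge N) → Set
Loopless es = ∀ {e} → e ∈ es → proj₁ e ≢ proj₂ e

-- A rescaled exponential moment (1 - 4/y)^(cutSize es c), y = 4 + a.
potential : ∀ {N} → ℕ → List (Edge N) → Point N → ℕ
potential a []             c = 1
potential a ((u , v) ∷ es) c = (if does (lookup c u Bool.≟ lookup c v) then 4 + a else a) * potential a es c

starPotential : ∀ {N} → ℕ → Bool → List (Fin N) → Point N → ℕ
starPotential a b []       c = 1
starPotential a b (j ∷ js) c = (if does (b Bool.≟ lookup c j) then 4 + a else a) * starPotential a b js c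

-- Repeated entries stand for parallel edges, which do occur: many choices of query randomness can
-- lead to the same two cells.
neighbours₀ : ∀ {N} → List (Edge (suc N)) → List (Fin N)
neighbours₀ []                       = []
neighbours₀ ((zero  , zero)  ∷ es)   = neighbours₀ es
neighbours₀ ((zero  , suc j) ∷ es)   = j ∷ neighbours₀ es
neighbours₀ ((suc i , zero)  ∷ es)   = i ∷ neighbours₀ es
neighbours₀ ((suc i , suc j) ∷ es)   = neighbours₀ es

delete₀ : ∀ {N} → List (Edge (suc N)) → List (Edge N)
delete₀ []                      = []
delete₀ ((suc i , suc j) ∷ es)  = (i , j) ∷ delete₀ es
delete₀ ((zero  , _)     ∷ es)  = delete₀ es
delete₀ ((suc i , zero)  ∷ es)  = delete₀ es

delete₀-∈ : ∀ {N} (es : List (Edge (suc N))) {i j} → (i , j) ∈ delete₀ es → (suc i , suc j) ∈ es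
delete₀-∈ ((suc i , suc j) ∷ es) (here refl) = here refl
delete₀-∈ ((suc i , suc j) ∷ es) (there e∈)  = there (delete₀-∈ es e∈)
delete₀-∈ ((zero  , _)     ∷ es) e∈          = there (delete₀-∈ es e∈)
delete₀-∈ ((suc i , zero)  ∷ es) e∈          = there (delete₀-∈ es e∈)

length-delete₀ : ∀ {N} (es : List (Edge (suc N))) → Loopless es →
                 length es ≡ length (neighbours₀ es) + length (delete₀ es)
length-delete₀ []                     ll = refl
length-delete₀ ((zero  , zero)  ∷ es) ll = contradiction refl (ll (here refl))
length-delete₀ ((zero  , suc j) ∷ es) ll = cong suc (length-delete₀ es (ll ∘ there))
length-delete₀ ((suc i , zero)  ∷ es) ll = cong suc (length-delete₀ es (ll ∘ there))
length-delete₀ ((suc i , suc j) ∷ es) ll = trans (cong suc (length-delete₀ es (ll ∘ there))) (sym (ℕ.+-suc _ _))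

neighbours₀≤degree : ∀ {N} (es : List (Edge (suc N))) → length (neighbours₀ es) ≤ℕ degree es zero
neighbours₀≤degree []                     = z≤n
neighbours₀≤degree ((zero  , zero)  ∷ es) = ℕ.≤-trans (neighbours₀≤degree es) (ℕ.m≤n+m _ 2)
neighbours₀≤degree ((zero  , suc j) ∷ es) = s≤s (neighbours₀≤degree es)
neighbours₀≤degree ((suc i , zero)  ∷ es) = s≤s (neighbours₀≤degree es)
neighbours₀≤degree ((suc i , suc j) ∷ es) = neighbours₀≤degree es

degree-delete₀ : ∀ {N} (es : List (Edge (suc N))) i → degree (delete₀ es) i ≤ℕ degree es (suc i)
degree-delete₀ []                     i = z≤n
degree-delete₀ ((suc u , suc v) ∷ es) i = ℕ.+-monoʳ-≤ (𝟙 (u Fin.≟ i) + 𝟙 (v Fin.≟ i)) (degree-delete₀ es i)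
degree-delete₀ ((zero  , v)     ∷ es) i = ℕ.≤-trans (degree-delete₀ es i) (ℕ.m≤n+m _ _)
degree-delete₀ ((suc u , zero)  ∷ es) i = ℕ.≤-trans (degree-delete₀ es i) (ℕ.m≤n+m _ _)

potential-∷ : ∀ {N} a (es : List (Edge (suc N))) → Loopless es → ∀ b c →
              potential a es (b ∷ c) ≡ starPotential a b (neighbours₀ es) c * potential a (delete₀ es) c
potential-∷ a []                     ll b c = refl
potential-∷ a ((zero  , zero)  ∷ es) ll b c = contradiction refl (ll (here refl))
potential-∷ a ((zero  , suc j) ∷ es) ll b c = trans (cong ((if does (b Bool.≟ lookup c j) then 4 + a else a) *_) (potential-∷ a es (ll ∘ there) b c))
  (sym (ℕ.*-assoc (if does (b Bool.≟ lookup c j) then 4 + a else a) (starPotential a b (neighbours₀ es) c) _))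
potential-∷ a ((suc i , zero)  ∷ es) ll b c = trans (cong₂ _*_ (≟-comm (lookup c i) b) (potential-∷ a es (ll ∘ there) b c))
  (sym (ℕ.*-assoc (if does (b Bool.≟ lookup c i) then 4 + a else a) (starPotential a b (neighbours₀ es) c) _))
  where
  ≟-comm : ∀ x y → (if does (x Bool.≟ y) then 4 + a else a) ≡ (if does (y Bool.≟ x) then 4 + a else a)
  ≟-comm false false = refl
  ≟-comm false true  = refl
  ≟-comm true  false = refl
  ≟-comm true  true  = refl
potential-∷ a ((suc i , suc j) ∷ es) ll b c = trans (cong (w *_) (potential-∷ a es (ll ∘ there) b c))
  (solve 3 (λ x y z → x :* (y :* z) := y :* (x :* z)) refl w (starPotential a b (neighbours₀ es) c) (potential a (delete₀ es) c))
  where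
  open +-*-Solver
  w = if does (lookup c i Bool.≟ lookup c j) then 4 + a else a

-- The exponent `i` counts the leaves with bit `true` and `j` those with bit `false`. Changing the
-- bit of the centre exchanges cut and uncut edges, hence the two exponents.
starPotential-powers : ∀ {N} a (js : List (Fin N)) c → ∃[ i ] ∃[ j ] (i + j ≡ length js ×
  starPotential a false js c ≡ a ^ i * (4 + a) ^ j × starPotential a true js c ≡ a ^ j * (4 + a) ^ i)
starPotential-powers a []       c = 0 , 0 , refl , refl , refl
starPotential-powers a (l ∷ js) c with lookup c l | starPotential-powers a js c
... | false | i , j , i+j≡ , f≡ , t≡ = i , suc j , trans (ℕ.+-suc i j) (cong suc i+j≡)
    , trans (cong ((4 + a) *_) f≡) (solve 3 (λ x y z → x :* (y :* z) := y :* (x :* z)) refl (4 + a) (a ^ i) ((4 + a) ^ j))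
    , trans (cong (a *_) t≡) (sym (ℕ.*-assoc a (a ^ j) _))
  where open +-*-Solver
... | true  | i , j , i+j≡ , f≡ , t≡ = suc i , j , cong suc i+j≡
    , trans (cong (a *_) f≡) (sym (ℕ.*-assoc a (a ^ i) _))
    , trans (cong ((4 + a) *_) t≡) (solve 3 (λ x y z → x :* (y :* z) := y :* (x :* z)) refl (4 + a) (a ^ j) ((4 + a) ^ i))
  where open +-*-Solver

-- By `rearrangement` the worst case is the one where all leaves agree, and `two-point` handles that
-- case.
∑-starPotential : ∀ {N} a (js : List (Fin N)) c → 4 * length js ≤ℕ 4 + a →
                  starPotential a false js c + starPotential a true js c ≤ℕ 2 * (3 + a) ^ length js
∑-starPotential a js c small with i , j , i+j≡ , f≡ , t≡ ← starPotential-powers a js c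
  rewrite f≡ | t≡ | sym i+j≡ =
  ℕ.≤-trans (rearrangement a (4 + a) i j (ℕ.m≤n+m a 4)) (two-point a (i + j) small)

-- Reveal the bit of vertex 0 last: its edges are cut in one of two complementary patterns.
∑-potential : ∀ {N} a (es : List (Edge N)) → Loopless es → (∀ i → 4 * degree es i ≤ℕ 4 + a) →
              ∑ (points N) (potential a es) ≤ℕ 2 ^ N * (3 + a) ^ length es
∑-potential {zero}  a []             ll deg = ℕ.≤-refl
∑-potential {zero}  a ((() , _) ∷ _) ll deg
∑-potential {suc N} a es             ll deg = begin
  ∑ (points (suc N)) (potential a es)
    ≡⟨ ∑-points N _ ⟩
  ∑ (points N) (λ c → potential a es (false ∷ c)) + ∑ (points N) (λ c → potential a es (true ∷ c))
    ≡⟨ ∑-+ (λ c → potential a es (false ∷ c)) (λ c → potential a es (true ∷ c)) (points N) ⟨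
  ∑ (points N) (λ c → potential a es (false ∷ c) + potential a es (true ∷ c))
    ≤⟨ ∑-mono (points N) step ⟩
  ∑ (points N) (λ c → 2 * (3 + a) ^ length js * potential a es′ c)
    ≡⟨ ∑-*ˡ (2 * (3 + a) ^ length js) _ (points N) ⟩
  2 * (3 + a) ^ length js * ∑ (points N) (potential a es′)
    ≤⟨ ℕ.*-monoʳ-≤ (2 * (3 + a) ^ length js) (∑-potential a es′ (λ e∈ e≡ → ll (delete₀-∈ es e∈) (cong suc e≡))
         (λ i → ℕ.≤-trans (ℕ.*-monoʳ-≤ 4 (degree-delete₀ es i)) (deg (suc i)))) ⟩
  2 * (3 + a) ^ length js * (2 ^ N * (3 + a) ^ length es′)
    ≡⟨ solve 3 (λ x y z → con 2 :* x :* (y :* z) := con 2 :* y :* (x :* z)) refl ((3 + a) ^ length js) (2 ^ N) ((3 + a) ^ length es′) ⟩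
  2 ^ suc N * ((3 + a) ^ length js * (3 + a) ^ length es′)
    ≡⟨ cong (2 ^ suc N *_) (trans (cong ((3 + a) ^_) (length-delete₀ es ll)) (ℕ.^-distribˡ-+-* (3 + a) (length js) (length es′))) ⟨
  2 ^ suc N * (3 + a) ^ length es ∎
  where
  open ℕ.≤-Reasoning
  open +-*-Solver
  js = neighbours₀ es
  es′ = delete₀ es
  step : ∀ c → potential a es (false ∷ c) + potential a es (true ∷ c) ≤ℕ 2 * (3 + a) ^ length js * potential a es′ c
  step c rewrite potential-∷ a es ll false c | potential-∷ a es ll true c
    | sym (ℕ.*-distribʳ-+ (potential a es′ c) (starPotential a false js c) (starPotential a true js c)) =
    ℕ.*-monoˡ-≤ (potential a es′ c) (∑-starPotential a js c
      (ℕ.≤-trans (ℕ.*-monoʳ-≤ 4 (neighbours₀≤degree es)) (deg zero)))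

-- With y = 4 + a this is (1 - 1/y)^5 ≤ 1 - 4/y. The mean potential is controlled by powers of 1 -
-- 1/y, whereas a cut edge costs a factor 1 - 4/y. A fourth power would not do, since (1 - 1/y)^4 >
-- 1 - 4/y; hence the 5 in front of `cutSize`.
fifth-power : ∀ a → 12 ≤ℕ a → (3 + a) ^ 5 ≤ℕ a * (4 + a) ^ 4
fifth-power a 12≤a = ℕ.+-cancelʳ-≤ (14 * a ^ 2 + 149 * a + 243) _ _ (begin
  (3 + a) ^ 5 + (14 * a ^ 2 + 149 * a + 243)  ≤⟨ ℕ.+-monoʳ-≤ ((3 + a) ^ 5) low≤high ⟩
  (3 + a) ^ 5 + (a ^ 4 + 6 * a ^ 3)           ≡⟨ solve 1 (λ x → (con 3 :+ x) :^ 5 :+ (x :^ 4 :+ con 6 :* x :^ 3)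
                                                := x :* (con 4 :+ x) :^ 4 :+ (con 14 :* x :^ 2 :+ con 149 :* x :+ con 243)) refl a ⟩
  a * (4 + a) ^ 4 + (14 * a ^ 2 + 149 * a + 243) ∎)
  where
  open ℕ.≤-Reasoning
  open +-*-Solver
  low≤high : 14 * a ^ 2 + 149 * a + 243 ≤ℕ a ^ 4 + 6 * a ^ 3
  low≤high = begin
    14 * a ^ 2 + 149 * a + 243             ≤⟨ ℕ.+-monoʳ-≤ (14 * a ^ 2 + 149 * a) (ℕ.≤-trans (ℕ.m≤m+n 243 9) (ℕ.*-monoʳ-≤ 21 12≤a)) ⟩
    14 * a ^ 2 + 149 * a + 21 * a          ≡⟨ solve 1 (λ x → con 14 :* x :^ 2 :+ con 149 :* x :+ con 21 :* x := con 14 :* x :^ 2 :+ con 170 :* x) refl a ⟩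
    14 * a ^ 2 + 170 * a                   ≤⟨ ℕ.+-monoʳ-≤ (14 * a ^ 2) (ℕ.*-monoˡ-≤ a (ℕ.≤-trans (ℕ.m≤m+n 170 10) (ℕ.*-monoʳ-≤ 15 12≤a))) ⟩
    14 * a ^ 2 + 15 * a * a                ≡⟨ solve 1 (λ x → con 14 :* x :^ 2 :+ con 15 :* x :* x := con 29 :* x :^ 2) refl a ⟩
    29 * a ^ 2                             ≤⟨ ℕ.*-monoˡ-≤ (a ^ 2) (ℕ.≤-trans (ℕ.m≤m+n 29 43) (ℕ.*-monoʳ-≤ 6 12≤a)) ⟩
    6 * a * a ^ 2                          ≡⟨ solve 1 (λ x → con 6 :* x :* x :^ 2 := con 6 :* x :^ 3) refl a ⟩
    6 * a ^ 3                              ≤⟨ ℕ.m≤n+m _ (a ^ 4) ⟩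
    a ^ 4 + 6 * a ^ 3                      ∎

potential-lower : ∀ {N} a → 12 ≤ℕ a → (es : List (Edge N)) (c : Point N) →
                  (3 + a) ^ (5 * cutSize es c) * (4 + a) ^ length es ≤ℕ potential a es c * (4 + a) ^ (5 * cutSize es c)
potential-lower a 12≤a []             c = ℕ.≤-refl
potential-lower a 12≤a ((u , v) ∷ es) c with does (lookup c u Bool.≟ lookup c v)
... | true = begin
  (3 + a) ^ (5 * X) * (y * y ^ W)            ≡⟨ solve 3 (λ p η q → p :* (η :* q) := η :* (p :* q)) refl ((3 + a) ^ (5 * X)) y (y ^ W) ⟩
  y * ((3 + a) ^ (5 * X) * y ^ W)            ≤⟨ ℕ.*-monoʳ-≤ y (potential-lower a 12≤a es c) ⟩
  y * (potential a es c * y ^ (5 * X))       ≡⟨ ℕ.*-assoc y (potential a es c) _ ⟨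
  y * potential a es c * y ^ (5 * X)         ∎
  where
  open ℕ.≤-Reasoning
  open +-*-Solver
  y = 4 + a
  X = cutSize es c
  W = length es
... | false = begin
  (3 + a) ^ (5 * suc X) * (y * y ^ W)                      ≡⟨ cong (_* (y * y ^ W)) (split (3 + a)) ⟩
  (3 + a) ^ 5 * (3 + a) ^ (5 * X) * (y * y ^ W)            ≤⟨ ℕ.*-monoˡ-≤ (y * y ^ W) (ℕ.*-monoˡ-≤ ((3 + a) ^ (5 * X)) (fifth-power a 12≤a)) ⟩
  a * y ^ 4 * (3 + a) ^ (5 * X) * (y * y ^ W)              ≡⟨ solve 4 (λ x η p q → x :* η :^ 4 :* p :* (η :* q) := x :* η :^ 5 :* (p :* q)) refl a y ((3 + a) ^ (5 * X)) (y ^ W) ⟩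
  a * y ^ 5 * ((3 + a) ^ (5 * X) * y ^ W)                  ≤⟨ ℕ.*-monoʳ-≤ (a * y ^ 5) (potential-lower a 12≤a es c) ⟩
  a * y ^ 5 * (potential a es c * y ^ (5 * X))             ≡⟨ solve 4 (λ x η p q → x :* η :* (p :* q) := x :* p :* (η :* q)) refl a (y ^ 5) (potential a es c) (y ^ (5 * X)) ⟩
  a * potential a es c * (y ^ 5 * y ^ (5 * X))             ≡⟨ cong (a * potential a es c *_) (split y) ⟨
  a * potential a es c * y ^ (5 * suc X)                   ∎
  where
  open ℕ.≤-Reasoning
  open +-*-Solver
  y = 4 + a
  X = cutSize es c
  W = length es
  split : ∀ z → z ^ (5 * suc X) ≡ z ^ 5 * z ^ (5 * X)
  split z = trans (cong (z ^_) (ℕ.*-suc 5 X)) (ℕ.^-distribˡ-+-* z 5 (5 * X))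

-- Markov's inequality for the potential divided by y^W, where y = 4 + a and W = `length es`. The
-- mean is at most (1 - 1/y)^W by `∑-potential`; on the event in question the value is at least (1 -
-- 1/y)^H by `potential-lower`. The ratio (1 - 1/y)^(W - H) is at most 2^(-e) because W - H ≥ e y.
cut-concentration : ∀ {N} (es : List (Edge N)) a e H → Loopless es → (∀ i → 4 * degree es i ≤ℕ 4 + a) →
                    12 ≤ℕ a → H + e * (4 + a) ≤ℕ length es →
                    Rare (2 ^ e) (points N) (λ c → 𝟙 (5 * cutSize es c ≤? H))
cut-concentration {N} es a e H ll deg 12≤a H+ey≤W = subst (2 ^ e * bad ≤ℕ_) (sym (length-points N))
  (ℕ.*-cancelʳ-≤ _ _ (z ^ V) {{ℕ.m^n≢0 z V}} (begin
    2 ^ e * bad * z ^ V          ≡⟨ solve 3 (λ x b p → x :* b :* p := x :* p :* b) refl (2 ^ e) bad (z ^ V) ⟩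
    2 ^ e * z ^ V * bad          ≤⟨ ℕ.*-monoˡ-≤ bad gain ⟩
    y ^ V * bad                  ≤⟨ markov ⟩
    2 ^ N * z ^ V                ∎))
  where
  open ℕ.≤-Reasoning
  open +-*-Solver
  y = 4 + a
  z = 3 + a
  W = length es
  V = W ∸ H
  bad = ∑ (points N) (λ c → 𝟙 (5 * cutSize es c ≤? H))
  H+V≡W : H + V ≡ W
  H+V≡W = ℕ.m+[n∸m]≡n (ℕ.m+n≤o⇒m≤o H H+ey≤W)
  ey≤V : e * y ≤ℕ V
  ey≤V = subst (_≤ℕ V) (ℕ.m+n∸m≡n H (e * y)) (ℕ.∸-monoˡ-≤ H H+ey≤W)
  gain : 2 ^ e * z ^ V ≤ℕ y ^ V
  gain with r , ey+r≡V ← ℕ.m≤n⇒∃[o]m+o≡n ey≤V = begin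
    2 ^ e * z ^ V                     ≡⟨ cong (λ w → 2 ^ e * z ^ w) (sym ey+r≡V) ⟩
    2 ^ e * z ^ (e * y + r)           ≡⟨ cong (2 ^ e *_) (ℕ.^-distribˡ-+-* z (e * y) r) ⟩
    2 ^ e * (z ^ (e * y) * z ^ r)     ≡⟨ ℕ.*-assoc (2 ^ e) _ _ ⟨
    2 ^ e * z ^ (e * y) * z ^ r       ≡⟨ cong (λ w → 2 ^ e * z ^ w * z ^ r) (ℕ.*-comm e y) ⟩
    2 ^ e * z ^ (y * e) * z ^ r       ≡⟨ cong (λ w → 2 ^ e * w * z ^ r) (ℕ.^-*-assoc z y e) ⟨
    2 ^ e * (z ^ y) ^ e * z ^ r       ≡⟨ cong (_* z ^ r) (^-distribʳ-* 2 (z ^ y) e) ⟨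
    (2 * z ^ y) ^ e * z ^ r           ≤⟨ ℕ.*-mono-≤ (ℕ.^-monoˡ-≤ e (half-power z)) (ℕ.^-monoˡ-≤ r (ℕ.n≤1+n z)) ⟩
    (y ^ y) ^ e * y ^ r               ≡⟨ cong (_* y ^ r) (trans (ℕ.^-*-assoc y y e) (cong (y ^_) (ℕ.*-comm y e))) ⟩
    y ^ (e * y) * y ^ r               ≡⟨ ℕ.^-distribˡ-+-* y (e * y) r ⟨
    y ^ (e * y + r)                   ≡⟨ cong (y ^_) ey+r≡V ⟩
    y ^ V                             ∎
  floor : ∀ c → 5 * cutSize es c ≤ℕ H → z ^ H * y ^ V ≤ℕ potential a es c
  floor c 5X≤H with r , 5X+r≡H ← ℕ.m≤n⇒∃[o]m+o≡n 5X≤H = ℕ.*-cancelʳ-≤ _ _ (y ^ X5) {{ℕ.m^n≢0 y X5}} (begin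
    z ^ H * y ^ V * y ^ X5                      ≡⟨ cong (λ w → z ^ w * y ^ V * y ^ X5) (sym 5X+r≡H) ⟩
    z ^ (X5 + r) * y ^ V * y ^ X5               ≡⟨ cong (λ w → w * y ^ V * y ^ X5) (ℕ.^-distribˡ-+-* z X5 r) ⟩
    z ^ X5 * z ^ r * y ^ V * y ^ X5             ≤⟨ ℕ.*-monoˡ-≤ (y ^ X5) (ℕ.*-monoˡ-≤ (y ^ V) (ℕ.*-monoʳ-≤ (z ^ X5) (ℕ.^-monoˡ-≤ r (ℕ.n≤1+n z)))) ⟩
    z ^ X5 * y ^ r * y ^ V * y ^ X5             ≡⟨ solve 4 (λ p q v x → p :* q :* v :* x := p :* (x :* q :* v)) refl (z ^ X5) (y ^ r) (y ^ V) (y ^ X5) ⟩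
    z ^ X5 * (y ^ X5 * y ^ r * y ^ V)           ≡⟨ cong (λ w → z ^ X5 * (w * y ^ V)) (trans (sym (ℕ.^-distribˡ-+-* y X5 r)) (cong (y ^_) 5X+r≡H)) ⟩
    z ^ X5 * (y ^ H * y ^ V)                    ≡⟨ cong (z ^ X5 *_) (trans (sym (ℕ.^-distribˡ-+-* y H V)) (cong (y ^_) H+V≡W)) ⟩
    z ^ X5 * y ^ W                              ≤⟨ potential-lower a 12≤a es c ⟩
    potential a es c * y ^ X5                   ∎)
    where X5 = 5 * cutSize es c
  markov : y ^ V * bad ≤ℕ 2 ^ N * z ^ V
  markov = ℕ.*-cancelˡ-≤ (z ^ H) {{ℕ.m^n≢0 z H}} (begin
    z ^ H * (y ^ V * bad)                                             ≡⟨ ℕ.*-assoc (z ^ H) (y ^ V) bad ⟨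
    z ^ H * y ^ V * bad                                               ≡⟨ ∑-*ˡ (z ^ H * y ^ V) _ (points N) ⟨
    ∑ (points N) (λ c → z ^ H * y ^ V * 𝟙 (5 * cutSize es c ≤? H))    ≤⟨ ∑-mono (points N) (λ c → pointwise c (5 * cutSize es c ≤? H)) ⟩
    ∑ (points N) (potential a es)                                     ≤⟨ ∑-potential a es ll deg ⟩
    2 ^ N * z ^ W                                                     ≡⟨ cong (λ w → 2 ^ N * z ^ w) (sym H+V≡W) ⟩
    2 ^ N * z ^ (H + V)                                               ≡⟨ cong (2 ^ N *_) (ℕ.^-distribˡ-+-* z H V) ⟩
    2 ^ N * (z ^ H * z ^ V)                                           ≡⟨ solve 3 (λ x p q → x :* (p :* q) := p :* (x :* q)) refl (2 ^ N) (z ^ H) (z ^ V) ⟩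
    z ^ H * (2 ^ N * z ^ V)                                           ∎)
    where
    pointwise : ∀ c → (d : Dec (5 * cutSize es c ≤ℕ H)) → z ^ H * y ^ V * 𝟙 d ≤ℕ potential a es c
    pointwise c (yes p) = ℕ.≤-trans (ℕ.≤-reflexive (ℕ.*-identityʳ _)) (floor c p)
    pointwise c (no _)  = ℕ.≤-trans (ℕ.≤-reflexive (ℕ.*-zeroʳ (z ^ H * y ^ V))) z≤n

-- Literals and cells of the core

-- A guess for one asymmetric variable: the label of its place, and the bit of `z` at that place.
Literal : ℕ → Set
Literal d = Fin d × Bool

lits : ∀ {d k} → Vec (Literal d) k → Point d → Point k
lits T t = Vec.map (λ ℓ → proj₂ ℓ xor lookup t (proj₁ ℓ)) T

variables : ∀ {d k} → Vec (Literal d) k → Vec (Fin d) k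
variables = Vec.map proj₁

infix 4 _≟ᵖ_
_≟ᵖ_ : ∀ {k} (y z : Point k) → Dec (y ≡ z)
_≟ᵖ_ = Vec.≡-dec Bool._≟_

lits-flip : ∀ {d k} (T : Vec (Literal d) k) {j} → All (j ≢_) (variables T) → ∀ t → lits T (flip j t) ≡ lits T t
lits-flip []            []          t = refl
lits-flip ((l , s) ∷ T) (j≢l ∷ j∉T) t =
  cong₂ (λ b y → (s xor b) ∷ y) (Vec.lookup∘updateAt′ l _ (j≢l ∘ sym) t) (lits-flip T j∉T t)

-- Flipping the variable of the first literal changes this literal and, by distinctness, no other,
-- so exactly one point of each pair matches the first bit. Thus `lits T t` is uniform when `t` is.
∑-lits : ∀ {d k} (T : Vec (Literal d) k) → Unique (variables T) → ∀ y →
         2 ^ k * ∑ (points d) (λ t → 𝟙 (lits T t ≟ᵖ y)) ≡ 2 ^ d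
∑-lits {d} [] [] [] = begin
  1 * ∑ (points d) (λ _ → 1)   ≡⟨ ℕ.*-identityˡ _ ⟩
  ∑ (points d) (λ _ → 1)       ≡⟨ length≡∑1 (points d) ⟨
  length (points d)            ≡⟨ length-points d ⟩
  2 ^ d                        ∎
  where open ≡-Reasoning
∑-lits {d} {suc k} ((l , s) ∷ T) (l∉T ∷ T!) (b ∷ y) = begin
  2 ^ suc k * ∑ (points d) f                             ≡⟨ solve 2 (λ p x → con 2 :* p :* x := p :* (con 2 :* x)) refl (2 ^ k) (∑ (points d) f) ⟩
  2 ^ k * (2 * ∑ (points d) f)                           ≡⟨ cong (2 ^ k *_) (2*∑-flip f l) ⟩
  2 ^ k * ∑ (points d) (λ t → f t + f (flip l t))        ≡⟨ cong (2 ^ k *_) (∑-cong (points d) pair) ⟩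
  2 ^ k * ∑ (points d) (λ t → 𝟙 (lits T t ≟ᵖ y))         ≡⟨ ∑-lits T T! y ⟩
  2 ^ d                                                  ∎
  where
  open ≡-Reasoning
  open +-*-Solver
  f : Point d → ℕ
  f t = 𝟙 (lits ((l , s) ∷ T) t ≟ᵖ b ∷ y)
  pair : ∀ t → f t + f (flip l t) ≡ 𝟙 (lits T t ≟ᵖ y)
  pair t rewrite lits-flip T l∉T t | Vec.lookup∘updateAt l {not} t = head-cases b s (lookup t l)
    where
    head-cases : ∀ b s u → 𝟙 ((s xor u) ∷ lits T t ≟ᵖ b ∷ y) + 𝟙 ((s xor not u) ∷ lits T t ≟ᵖ b ∷ y) ≡ 𝟙 (lits T t ≟ᵖ y)
    head-cases false false false = ℕ.+-identityʳ _
    head-cases false false true  = refl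
    head-cases false true  false = refl
    head-cases false true  true  = ℕ.+-identityʳ _
    head-cases true  false false = refl
    head-cases true  false true  = ℕ.+-identityʳ _
    head-cases true  true  false = ℕ.+-identityʳ _
    head-cases true  true  true  = refl

-- Look at the first position where the candidates differ. The same variable with opposite signs
-- gives different values for every `t`; two different variables give different values for at least
-- one of `t` and `flip l t`, as the flip changes only one of the two literals.
∑-lits-differ : ∀ {d k} (T T′ : Vec (Literal d) k) → T ≢ T′ →
                2 ^ d ≤ℕ 2 * ∑ (points d) (λ t → 𝟙 (¬? (lits T t ≟ᵖ lits T′ t)))
∑-lits-differ []       []        T≢T′ = contradiction refl T≢T′
∑-lits-differ {d} (p@(l , s) ∷ T) (p′@(l′ , s′) ∷ T′) T≢T′ with ≡-dec Fin._≟_ Bool._≟_ p p′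
... | yes refl = ℕ.≤-trans (∑-lits-differ T T′ (T≢T′ ∘ cong (p ∷_)))
  (ℕ.*-monoʳ-≤ 2 (∑-mono (points d) λ t → 𝟙-mono (¬? (lits T t ≟ᵖ lits T′ t)) (¬? (lits (p ∷ T) t ≟ᵖ lits (p ∷ T′) t)) (λ ne → ne ∘ Vec.∷-injectiveʳ)))
... | no p≢p′ = begin
  2 ^ d                                            ≡⟨ trans (sym (length-points d)) (length≡∑1 (points d)) ⟩
  ∑ (points d) (λ _ → 1)                           ≤⟨ ∑-mono (points d) pair ⟩
  ∑ (points d) (λ t → f t + f (flip l t))          ≡⟨ 2*∑-flip f l ⟨
  2 * ∑ (points d) f                               ∎
  where
  open ℕ.≤-Reasoning
  head head′ : Point d → Bool
  head t = s xor lookup t l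
  head′ t = s′ xor lookup t l′
  f : Point d → ℕ
  f t = 𝟙 (¬? (lits (p ∷ T) t ≟ᵖ lits (p′ ∷ T′) t))
  f≡1 : ∀ t → head t ≢ head′ t → f t ≡ 1
  f≡1 t ne = 𝟙-yes (¬? (lits (p ∷ T) t ≟ᵖ lits (p′ ∷ T′) t)) (ne ∘ Vec.∷-injectiveˡ)
  xor-not : ∀ a u v → a xor u ≡ v → a xor not u ≢ v
  xor-not false false _ refl ()
  xor-not false true  _ refl ()
  xor-not true  false _ refl ()
  xor-not true  true  _ refl ()
  xor-cancelʳ : ∀ u a b → a xor u ≡ b xor u → a ≡ b
  xor-cancelʳ false false false _ = refl
  xor-cancelʳ true  false false _ = refl
  xor-cancelʳ false true  true  _ = refl
  xor-cancelʳ true  true  true  _ = refl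
  xor-cancelʳ false false true  ()
  xor-cancelʳ true  false true  ()
  xor-cancelʳ false true  false ()
  xor-cancelʳ true  true  false ()
  flipped : ∀ t → head t ≡ head′ t → l ≢ l′ → head (flip l t) ≢ head′ (flip l t)
  flipped t eq l≢l′ rewrite Vec.lookup∘updateAt l {not} t | Vec.lookup∘updateAt′ l′ l {not} (l≢l′ ∘ sym) t = xor-not s (lookup t l) _ eq
  cases : ∀ t → Dec (head t ≡ head′ t) → Dec (l ≡ l′) → 1 ≤ℕ f t + f (flip l t)
  cases t (no ne)  _          = ℕ.≤-trans (ℕ.≤-reflexive (sym (f≡1 t ne))) (ℕ.m≤m+n (f t) _)
  cases t (yes eq) (yes refl) = contradiction (cong (l ,_) (xor-cancelʳ (lookup t l) s s′ eq)) p≢p′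
  cases t (yes eq) (no l≢l′)  = ℕ.≤-trans (ℕ.≤-reflexive (sym (f≡1 (flip l t) (flipped t eq l≢l′)))) (ℕ.m≤n+m _ (f t))
  pair : ∀ t → 1 ≤ℕ f t + f (flip l t)
  pair t = cases t (head t Bool.≟ head′ t) (l Fin.≟ l′)

index-injective : ∀ {k} (y z : Point k) → index y ≡ index z → y ≡ z
index-injective []      []      _  = refl
index-injective {suc k} (b ∷ y) (b′ ∷ z) eq
  with eqₕ , eqₜ ← Fin.combine-injective {2} {2 ^ k} (if b then suc zero else zero) (index y) (if b′ then suc zero else zero) (index z) eq =
  cong₂ _∷_ (bit-injective b b′ eqₕ) (index-injective y z eqₜ)
  where
  bit-injective : ∀ b b′ → (Fin 2 ∋ (if b then suc zero else zero)) ≡ (if b′ then suc zero else zero) → b ≡ b′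
  bit-injective false false _ = refl
  bit-injective true  true  _ = refl

index-surjective : ∀ {k} (i : Fin (2 ^ k)) → ∃[ y ] index {k} y ≡ i
index-surjective {zero}  zero = [] , refl
index-surjective {suc k} i with Fin.combine-surjective {2} {2 ^ k} i
... | zero , j , refl with y , refl ← index-surjective {k} j = (false ∷ y) , refl
... | suc zero , j , refl with y , refl ← index-surjective {k} j = (true ∷ y) , refl

-- Here w is the weight of the whole point, and multiplication by m acts as negation
-- modulo m + 1: the second entry is w - ∣ y ∣ whenever that lies in {0,…,m}.
cell : ∀ {k} m → Point k → ℕ → Fin (2 ^ k * suc m)
cell m y w = combine (index y) ((w + m * ∣ y ∣) mod suc m)

predict : ∀ {k m} → Core k m → Point k → ℕ → Bool
predict {m = m} c y w = lookup c (cell m y w)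

%-+ˡ : ∀ a b N .{{_ : NonZero N}} → (a %ℕ N + b) %ℕ N ≡ (a + b) %ℕ N
%-+ˡ a b N = trans (%-distribˡ-+ (a %ℕ N) b N) (trans (cong (λ w → (w + b %ℕ N) %ℕ N) (m%n%n≡m%n a N)) (sym (%-distribˡ-+ a b N)))

residue-solution : ∀ m s i → i ≤ℕ m → i ≡ (((s + i) %ℕ suc m) + m * s) %ℕ suc m
residue-solution m s i i≤m = sym (begin
  ((s + i) %ℕ suc m + m * s) %ℕ suc m   ≡⟨ %-+ˡ (s + i) (m * s) (suc m) ⟩
  (s + i + m * s) %ℕ suc m              ≡⟨ cong (_%ℕ suc m) (solve 3 (λ σ ι μ → σ :+ ι :+ μ :* σ := ι :+ σ :* (con 1 :+ μ)) refl s i m) ⟩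
  (i + s * suc m) %ℕ suc m              ≡⟨ [m+kn]%n≡m%n i s (suc m) ⟩
  i %ℕ suc m                            ≡⟨ m≤n⇒m%n≡m i≤m ⟩
  i                                     ∎)
  where open ≡-Reasoning
        open +-*-Solver

Anticoncentrated : ℕ → ℕ → Set
Anticoncentrated L ζ = ∀ j → 2 ^ ζ * (L ℂ j) ≤ℕ 2 ^ L

-- As `L ≤ m`, the possible weights of `r` are pairwise incongruent modulo m + 1, so the target
-- residue admits at most one weight; `residue-solution` computes it.
∑-residue : ∀ m L ζ → L ≤ℕ m → Anticoncentrated L ζ → ∀ s (w : Fin (suc m)) →
            2 ^ ζ * ∑ (points L) (λ r → 𝟙 ((s + ∣ r ∣) mod suc m Fin.≟ w)) ≤ℕ 2 ^ L
∑-residue m L ζ L≤m anti s w = begin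
  2 ^ ζ * ∑ (points L) (λ r → 𝟙 ((s + ∣ r ∣) mod suc m Fin.≟ w))   ≤⟨ ℕ.*-monoʳ-≤ (2 ^ ζ) (∑-mono (points L) hit) ⟩
  2 ^ ζ * ∑ (points L) (λ r → 𝟙 (∣ r ∣ ≟ℕ j))                      ≡⟨ cong (2 ^ ζ *_) (∑-weight L j) ⟩
  2 ^ ζ * (L ℂ j)                                                  ≤⟨ anti j ⟩
  2 ^ L                                                            ∎
  where
  open ℕ.≤-Reasoning
  j = (toℕ w + m * s) %ℕ suc m
  hit : ∀ r → 𝟙 ((s + ∣ r ∣) mod suc m Fin.≟ w) ≤ℕ 𝟙 (∣ r ∣ ≟ℕ j)
  hit r = 𝟙-mono (_ Fin.≟ w) (∣ r ∣ ≟ℕ j) λ eq → trans (residue-solution m s ∣ r ∣ (ℕ.≤-trans (∣p∣≤n r) L≤m))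
    (cong (λ v → (v + m * s) %ℕ suc m) (trans (sym (Fin.toℕ-fromℕ< (m%n<n (s + ∣ r ∣) (suc m)))) (cong toℕ eq)))

-- The probabilities multiply: 2^(-k) for the literals and then, for each such `t`, at most 2^(-ζ)
-- for the second entry of the cell, from the bits `r` alone. The shift `v t` may depend on `t` in
-- any way, because the second bound is uniform in the shift.
∑-cell : ∀ {d k} m L ζ → L ≤ℕ m → Anticoncentrated L ζ → (T : Vec (Literal d) k) → Unique (variables T) →
         ∀ (v : Point d → ℕ) i →
         2 ^ (k + ζ) * ∑ (points d) (λ t → ∑ (points L) (λ r → 𝟙 (cell m (lits T t) (v t + ∣ r ∣) Fin.≟ i))) ≤ℕ 2 ^ (d + L)
∑-cell {d} {k} m L ζ L≤m anti T T! v i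
  with q , w , refl ← Fin.combine-surjective {2 ^ k} {suc m} i
  with y , refl ← index-surjective {k} q = begin
  2 ^ (k + ζ) * ∑ (points d) (λ t → ∑ (points L) (λ r → hit t r))
    ≡⟨ cong (_* S) (ℕ.^-distribˡ-+-* 2 k ζ) ⟩
  2 ^ k * 2 ^ ζ * S
    ≡⟨ trans (ℕ.*-assoc (2 ^ k) (2 ^ ζ) S) (cong (2 ^ k *_) (sym (∑-*ˡ (2 ^ ζ) _ (points d)))) ⟩
  2 ^ k * ∑ (points d) (λ t → 2 ^ ζ * ∑ (points L) (λ r → hit t r))
    ≤⟨ ℕ.*-monoʳ-≤ (2 ^ k) (∑-mono (points d) row) ⟩
  2 ^ k * ∑ (points d) (λ t → 𝟙 (lits T t ≟ᵖ y) * 2 ^ L)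
    ≡⟨ cong (2 ^ k *_) (∑-*ʳ _ (2 ^ L) (points d)) ⟩
  2 ^ k * (∑ (points d) (λ t → 𝟙 (lits T t ≟ᵖ y)) * 2 ^ L)
    ≡⟨ ℕ.*-assoc (2 ^ k) _ (2 ^ L) ⟨
  2 ^ k * ∑ (points d) (λ t → 𝟙 (lits T t ≟ᵖ y)) * 2 ^ L
    ≡⟨ cong (_* 2 ^ L) (∑-lits T T! y) ⟩
  2 ^ d * 2 ^ L
    ≡⟨ ℕ.^-distribˡ-+-* 2 d L ⟨
  2 ^ (d + L) ∎
  where
  open ℕ.≤-Reasoning
  hit : Point d → Point L → ℕ
  hit t r = 𝟙 (cell m (lits T t) (v t + ∣ r ∣) Fin.≟ combine (index y) w)
  S = ∑ (points d) (λ t → ∑ (points L) (λ r → hit t r))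
  split : ∀ t r → cell m (lits T t) (v t + ∣ r ∣) ≡ combine (index y) w →
          lits T t ≡ y × (v t + m * ∣ lits T t ∣ + ∣ r ∣) mod suc m ≡ w
  split t r eq with eqʸ , eqʷ ← Fin.combine-injective {2 ^ k} {suc m} (index (lits T t)) _ (index y) w eq =
    index-injective _ y eqʸ , trans (cong (_mod suc m)
      (solve 3 (λ a b e → a :+ b :+ e := a :+ e :+ b) refl (v t) (m * ∣ lits T t ∣) ∣ r ∣)) eqʷ
    where open +-*-Solver
  row : ∀ t → 2 ^ ζ * ∑ (points L) (λ r → hit t r) ≤ℕ 𝟙 (lits T t ≟ᵖ y) * 2 ^ L
  row t with lits T t ≟ᵖ y
  ... | yes _ = begin
    2 ^ ζ * ∑ (points L) (λ r → hit t r)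
      ≤⟨ ℕ.*-monoʳ-≤ (2 ^ ζ) (∑-mono (points L) λ r → 𝟙-mono (_ Fin.≟ _) (_ Fin.≟ w) (λ eq → proj₂ (split t r eq))) ⟩
    2 ^ ζ * ∑ (points L) (λ r → 𝟙 ((v t + m * ∣ lits T t ∣ + ∣ r ∣) mod suc m Fin.≟ w))
      ≤⟨ ∑-residue m L ζ L≤m anti (v t + m * ∣ lits T t ∣) w ⟩
    2 ^ L
      ≡⟨ ℕ.*-identityˡ (2 ^ L) ⟨
    1 * 2 ^ L ∎
  ... | no y≢ = ℕ.≤-reflexive (trans (cong (2 ^ ζ *_) 
    (∑-zero (points L) (λ r → 𝟙-no (_ Fin.≟ _) (λ eq → y≢ (proj₁ (split t r eq)))))) (ℕ.*-zeroʳ (2 ^ ζ)))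

-- Exceptional cores

∑-filter≤ : {A : Set} {P : A → Set} (P? : ∀ x → Dec (P x)) (f : A → ℕ) (xs : List A) → ∑ (filter P? xs) f ≤ℕ ∑ xs f
∑-filter≤ P? f []       = z≤n
∑-filter≤ P? f (x ∷ xs) with does (P? x)
... | true  = ℕ.+-monoʳ-≤ (f x) (∑-filter≤ P? f xs)
... | false = ℕ.≤-trans (∑-filter≤ P? f xs) (ℕ.m≤n+m _ (f x))

disagree? : ∀ {d k m} (c : Core k m) (T T′ : Vec (Literal d) k) (t : Point d) (w : ℕ) →
            Dec (predict {k} {m} c (lits T t) w ≢ predict {k} {m} c (lits T′ t) w)
disagree? {k = k} {m} c T T′ t w = ¬? (predict {k} {m} c (lits T t) w Bool.≟ predict {k} {m} c (lits T′ t) w)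

-- Here `v t` stands for the weight of the query outside the block `R`, and `r` for its bits on `R`.
disagreements : ∀ {d k} m L → Core k m → (T T′ : Vec (Literal d) k) → (Point d → ℕ) → ℕ
disagreements {d} m L c T T′ v =
  ∑ (points d) (λ t → ∑ (points L) (λ r → 𝟙 (disagree? {m = m} c T T′ t (v t + ∣ r ∣))))

-- The multigraph has one edge for each `(t , r)` with different literal vectors, joining the two
-- cells consulted; there are no loops because the first components of these cells differ. By
-- `∑-lits-differ` at least half of the 2^(d+L) = 2^(4+e+μ) pairs are edges, and by `∑-cell` every
-- degree is at most 2 * 2^(d+L) / 2^(k+ζ) = 2^μ. Every cut edge is a disagreement.
core-concentration : ∀ {d k} m L ζ e μ → L ≤ℕ m → Anticoncentrated L ζ → k + ζ ≡ 5 + e → d + L ≡ 4 + e + μ → 2 ≤ℕ μ →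
                     (T T′ : Vec (Literal d) k) → Unique (variables T) → Unique (variables T′) → T ≢ T′ → ∀ v →
                     Rare (2 ^ (2 ^ e)) (points (2 ^ k * suc m)) (λ c → 𝟙 (20 * disagreements m L c T T′ v <? 2 ^ (d + L)))
core-concentration {d} {k} m L ζ e μ L≤m anti k+ζ≡ d+L≡ 2≤μ T T′ T! T′! T≢T′ v =
  rare-mono {d = 2 ^ (2 ^ e)} (points (2 ^ k * suc m)) few (cut-concentration es a (2 ^ e) H loopless deg 12≤a size)
  where
  open ℕ.≤-Reasoning
  open +-*-Solver
  Ω = cartesianProduct (points d) (points L)
  lits-differ? : (u : Point d × Point L) → Dec (lits T (proj₁ u) ≢ lits T′ (proj₁ u))
  lits-differ? (t , r) = ¬? (lits T t ≟ᵖ lits T′ t)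
  edge : Point d × Point L → Edge (2 ^ k * suc m)
  edge (t , r) = cell m (lits T t) (v t + ∣ r ∣) , cell m (lits T′ t) (v t + ∣ r ∣)
  es = map edge (filter lits-differ? Ω)
  -- Makes `4 + a` equal to 4 * 2^μ, four times the degree bound; `2 ≤ μ` yields `12 ≤ a`.
  a = 4 * 2 ^ μ ∸ 4
  -- Half of the guaranteed 2^(3+e+μ) edges. The other half is exactly 2^e * (4 + a), which buys the
  -- probability 2^(-2^e).
  H = 2 ^ (2 + e + μ)
  4≤2^μ : 4 ≤ℕ 2 ^ μ
  4≤2^μ = ℕ.^-monoʳ-≤ 2 2≤μ
  4+a≡ : 4 + a ≡ 4 * 2 ^ μ
  4+a≡ = ℕ.m+[n∸m]≡n (ℕ.≤-trans 4≤2^μ (ℕ.m≤n*m (2 ^ μ) 4))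
  12≤a : 12 ≤ℕ a
  12≤a = ℕ.∸-monoˡ-≤ 4 (ℕ.*-monoʳ-≤ 4 4≤2^μ)
  loopless : Loopless es
  loopless e∈ with (t , r) , u∈ , refl ← ∈-map⁻ edge e∈ = λ eq →
    proj₂ (∈-filter⁻ lits-differ? {xs = Ω} u∈) (index-injective _ _ (Fin.combine-injectiveˡ {2 ^ k} {suc m} _ _ _ _ eq))
  deg : ∀ i → 4 * degree es i ≤ℕ 4 + a
  deg i = subst (4 * degree es i ≤ℕ_) (sym 4+a≡) (ℕ.*-monoʳ-≤ 4 (ℕ.*-cancelˡ-≤ (2 ^ (k + ζ)) {{ℕ.m^n≢0 2 (k + ζ)}} (begin
    2 ^ (k + ζ) * degree es i                  ≡⟨ cong (2 ^ (k + ζ) *_) (∑-map _ edge (filter lits-differ? Ω)) ⟩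
    2 ^ (k + ζ) * ∑ (filter lits-differ? Ω) (λ u → A u + B u)
                                               ≤⟨ ℕ.*-monoʳ-≤ (2 ^ (k + ζ)) (∑-filter≤ lits-differ? _ Ω) ⟩
    2 ^ (k + ζ) * ∑ Ω (λ u → A u + B u)        ≡⟨ cong (2 ^ (k + ζ) *_) (∑-+ A B Ω) ⟩
    2 ^ (k + ζ) * (∑ Ω A + ∑ Ω B)              ≡⟨ ℕ.*-distribˡ-+ (2 ^ (k + ζ)) (∑ Ω A) (∑ Ω B) ⟩
    2 ^ (k + ζ) * ∑ Ω A + 2 ^ (k + ζ) * ∑ Ω B  ≡⟨ cong₂ (λ x y → 2 ^ (k + ζ) * x + 2 ^ (k + ζ) * y)
                                                    (∑-product _,_ A (points d) (points L)) (∑-product _,_ B (points d) (points L)) ⟩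
    2 ^ (k + ζ) * ∑ (points d) (λ t → ∑ (points L) (λ r → A (t , r))) + 2 ^ (k + ζ) * ∑ (points d) (λ t → ∑ (points L) (λ r → B (t , r)))
                                               ≤⟨ ℕ.+-mono-≤ (∑-cell m L ζ L≤m anti T T! v i) (∑-cell m L ζ L≤m anti T′ T′! v i) ⟩
    2 ^ (d + L) + 2 ^ (d + L)                  ≡⟨ cong (λ x → 2 ^ x + 2 ^ x) d+L≡ ⟩
    2 ^ (4 + e + μ) + 2 ^ (4 + e + μ)          ≡⟨ cong (λ x → x + x) (ℕ.^-distribˡ-+-* 2 (4 + e) μ) ⟩
    2 ^ (4 + e) * 2 ^ μ + 2 ^ (4 + e) * 2 ^ μ  ≡⟨ solve 2 (λ x y → x :* y :+ x :* y := con 2 :* x :* y) refl (2 ^ (4 + e)) (2 ^ μ) ⟩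
    2 ^ (5 + e) * 2 ^ μ                        ≡⟨ cong (λ x → 2 ^ x * 2 ^ μ) k+ζ≡ ⟨
    2 ^ (k + ζ) * 2 ^ μ                        ∎)))
    where
    A B : Point d × Point L → ℕ
    A (t , r) = 𝟙 (cell m (lits T t) (v t + ∣ r ∣) Fin.≟ i)
    B (t , r) = 𝟙 (cell m (lits T′ t) (v t + ∣ r ∣) Fin.≟ i)
  length-es : length es ≡ ∑ (points d) (λ t → 𝟙 (¬? (lits T t ≟ᵖ lits T′ t))) * 2 ^ L
  length-es = trans (length-map edge (filter lits-differ? Ω)) (trans (length-filter lits-differ? Ω)
    (trans (∑-product _,_ (λ u → 𝟙 (lits-differ? u)) (points d) (points L)) (trans (∑-cong (points d)
      (λ t → trans (∑-const (points L) _) (trans (ℕ.*-comm (length (points L)) _) (cong (𝟙 (¬? (lits T t ≟ᵖ lits T′ t)) *_) (length-points L)))))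
      (∑-*ʳ (λ t → 𝟙 (¬? (lits T t ≟ᵖ lits T′ t))) (2 ^ L) (points d)))))
  size : H + 2 ^ e * (4 + a) ≤ℕ length es
  size = ℕ.*-cancelˡ-≤ 2 (begin
    2 * (H + 2 ^ e * (4 + a))               ≡⟨ cong (λ x → 2 * (H + 2 ^ e * x)) 4+a≡ ⟩
    2 * (H + 2 ^ e * (4 * 2 ^ μ))           ≡⟨ cong (λ x → 2 * (x + 2 ^ e * (4 * 2 ^ μ))) (ℕ.^-distribˡ-+-* 2 (2 + e) μ) ⟩
    2 * (2 * (2 * 2 ^ e) * 2 ^ μ + 2 ^ e * (4 * 2 ^ μ))
                                            ≡⟨ solve 2 (λ x y → con 2 :* (con 2 :* (con 2 :* x) :* y :+ x :* (con 4 :* y)) := con 2 :* (con 2 :* (con 2 :* (con 2 :* x))) :* y) refl (2 ^ e) (2 ^ μ) ⟩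
    2 ^ (4 + e) * 2 ^ μ                     ≡⟨ ℕ.^-distribˡ-+-* 2 (4 + e) μ ⟨
    2 ^ (4 + e + μ)                         ≡⟨ trans (cong (2 ^_) (sym d+L≡)) (ℕ.^-distribˡ-+-* 2 d L) ⟩
    2 ^ d * 2 ^ L                           ≤⟨ ℕ.*-monoˡ-≤ (2 ^ L) (∑-lits-differ T T′ T≢T′) ⟩
    2 * ∑ (points d) (λ t → 𝟙 (¬? (lits T t ≟ᵖ lits T′ t))) * 2 ^ L
                                            ≡⟨ ℕ.*-assoc 2 (∑ (points d) (λ t → 𝟙 (¬? (lits T t ≟ᵖ lits T′ t)))) (2 ^ L) ⟩
    2 * (∑ (points d) (λ t → 𝟙 (¬? (lits T t ≟ᵖ lits T′ t))) * 2 ^ L)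
                                            ≡⟨ cong (2 *_) length-es ⟨
    2 * length es                           ∎)
  cut≤disagreements : ∀ c → cutSize es c ≤ℕ disagreements m L c T T′ v
  cut≤disagreements c = begin
    ∑ es (λ u → 𝟙 (cut? c u))                             ≡⟨ ∑-map _ edge (filter lits-differ? Ω) ⟩
    ∑ (filter lits-differ? Ω) (λ u → 𝟙 (cut? c (edge u))) ≤⟨ ∑-filter≤ lits-differ? _ Ω ⟩
    ∑ Ω (λ u → 𝟙 (cut? c (edge u)))                       ≡⟨ ∑-product _,_ _ (points d) (points L) ⟩
    disagreements m L c T T′ v                            ∎
  -- 20 = 4 * 5, since `H` is a quarter of 2^(d+L).
  few : ∀ c → 𝟙 (20 * disagreements m L c T T′ v <? 2 ^ (d + L)) ≤ℕ 𝟙 (5 * cutSize es c ≤? H)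
  few c = 𝟙-mono (20 * disagreements m L c T T′ v <? 2 ^ (d + L)) (5 * cutSize es c ≤? H) λ lt → ℕ.*-cancelˡ-≤ 4 (begin
    4 * (5 * cutSize es c)               ≡⟨ ℕ.*-assoc 4 5 (cutSize es c) ⟨
    20 * cutSize es c                    ≤⟨ ℕ.*-monoʳ-≤ 20 (cut≤disagreements c) ⟩
    20 * disagreements m L c T T′ v      ≤⟨ ℕ.<⇒≤ lt ⟩
    2 ^ (d + L)                          ≡⟨ cong (2 ^_) d+L≡ ⟩
    2 ^ (4 + e + μ)                      ≡⟨ solve 1 (λ x → con 2 :* (con 2 :* x) := con 4 :* x) refl H ⟩
    4 * H                                ∎)

load : ∀ {d} → Vec (ℕ × ℕ) d → Point d → ℕ
load []             []      = 0
load ((a , b) ∷ κ) (u ∷ t) = (if u then a else b) + load κ t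

literals : ∀ d → List (Literal d)
literals d = cartesianProduct (allFin d) (false ∷ true ∷ [])

-- All that a small disagreement depends on apart from the core: the two candidates, and for each
-- label its two possible contributions to the weight outside `R`. Both contributions are at most
-- `n`, so the finite list `params` suffices.
Params : ℕ → ℕ → Set
Params d k = (Vec (Literal d) k × Vec (Literal d) k) × Vec (ℕ × ℕ) d

params : ℕ → ∀ d k → List (Params d k)
params n d k = cartesianProduct (cartesianProduct (words (literals d) k) (words (literals d) k))
                                (words (cartesianProduct (upTo (suc n)) (upTo (suc n))) d)

Separable : ∀ {d k} → Params d k → Set
Separable ((T , T′) , _) = Unique (variables T) × Unique (variables T′) × T ≢ T′

Bad : ∀ {d k} m L → Core k m → Params d k → Set
Bad {d} m L c p@((T , T′) , κ) = Separable p × 20 * disagreements m L c T T′ (load κ) <ℕ 2 ^ (d + L)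

unique? : ∀ {d k} (T : Vec (Literal d) k) → Dec (Unique (variables T))
unique? T = allPairs? (λ l l′ → ¬? (l Fin.≟ l′)) (variables T)

_≟ᵀ_ : ∀ {d k} (T T′ : Vec (Literal d) k) → Dec (T ≡ T′)
_≟ᵀ_ = Vec.≡-dec (≡-dec Fin._≟_ Bool._≟_)

separable? : ∀ {d k} (p : Params d k) → Dec (Separable p)
separable? ((T , T′) , _) = unique? T ×-dec unique? T′ ×-dec ¬? (T ≟ᵀ T′)

bad? : ∀ {d k} m L (c : Core k m) (p : Params d k) → Dec (Bad m L c p)
bad? {d} m L c p@((T , T′) , κ) = separable? p ×-dec (20 * disagreements m L c T T′ (load κ) <? 2 ^ (d + L))

exceptional? : ∀ {k} n d m L (c : Core k m) → Dec (Any (Bad m L c) (params n d k))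
exceptional? {k} n d m L c = any? (bad? m L c) (params n d k)

𝟙-any≤∑ : {A : Set} {P : A → Set} (P? : ∀ x → Dec (P x)) (xs : List A) → 𝟙 (any? P? xs) ≤ℕ ∑ xs (λ x → 𝟙 (P? x))
𝟙-any≤∑ {P = P} P? xs = 𝟙≤ (any? P? xs) positive
  where
  positive : ∀ {xs} → Any P xs → 1 ≤ℕ ∑ xs (λ x → 𝟙 (P? x))
  positive {x ∷ xs} (here px)  = ℕ.≤-trans (ℕ.≤-reflexive (sym (𝟙-yes (P? x) px))) (ℕ.m≤m+n _ _)
  positive {x ∷ xs} (there pxs) = ℕ.≤-trans (positive pxs) (ℕ.m≤n+m _ (𝟙 (P? x)))

length-literals : ∀ d → length (literals d) ≡ d * 2
length-literals d = trans (length-product _,_ (allFin d) (false ∷ true ∷ [])) (cong (_* 2) (length-tabulate {n = d} id))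

length-params : ∀ n d k → length (params n d k) ≡ (d * 2) ^ k * (d * 2) ^ k * (suc n * suc n) ^ d
length-params n d k =
  trans (length-product _,_ (cartesianProduct (words (literals d) k) (words (literals d) k)) (words κs d))
        (cong₂ _*_ (trans (length-product _,_ (words (literals d) k) (words (literals d) k)) (cong₂ _*_ T-count T-count))
                   (trans (length-words κs d) (cong (_^ d) (trans (length-product _,_ (upTo (suc n)) (upTo (suc n)))
                     (cong₂ _*_ (length-upTo (suc n)) (length-upTo (suc n)))))))
  where
  κs = cartesianProduct (upTo (suc n)) (upTo (suc n))
  T-count : length (words (literals d) k) ≡ (d * 2) ^ k
  T-count = trans (length-words (literals d) k) (cong (_^ k) (length-literals d))

exceptional-rare : ∀ {k} n d m L ζ e μ D → L ≤ℕ m → Anticoncentrated L ζ → k + ζ ≡ 5 + e → d + L ≡ 4 + e + μ → 2 ≤ℕ μ →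
                   D * length (params n d k) ≤ℕ 2 ^ (2 ^ e) →
                   Rare D (points (2 ^ k * suc m)) (λ c → 𝟙 (exceptional? {k} n d m L c))
exceptional-rare {k} n d m L ζ e μ D L≤m anti k+ζ≡ d+L≡ 2≤μ fits =
  rare-mono {d = D} cores (λ c → 𝟙-any≤∑ (bad? m L c) (params n d k))
    (union-bound {d = D} (params n d k) cores fits (λ p → single p (separable? p)))
  where
  cores = points (2 ^ k * suc m)
  single : ∀ p → Dec (Separable p) → Rare (2 ^ (2 ^ e)) cores (λ c → 𝟙 (bad? m L c p))
  single p@((T , T′) , κ) (yes (T! , T′! , T≢T′)) = rare-mono {d = 2 ^ (2 ^ e)} cores
    (λ c → 𝟙-mono (bad? m L c p) (20 * disagreements m L c T T′ (load κ) <? 2 ^ (d + L)) proj₂)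
    (core-concentration m L ζ e μ L≤m anti k+ζ≡ d+L≡ 2≤μ T T′ T! T′! T≢T′ (load κ))
  single p (no ¬sep) = ℕ.≤-trans (ℕ.≤-reflexive (trans (cong (2 ^ (2 ^ e) *_) 
    (∑-zero cores (λ c → 𝟙-no (bad? m L c p) (¬sep ∘ proj₁))))
    (ℕ.*-zeroʳ (2 ^ (2 ^ e))))) z≤n

-- Rare events

tally : {A : Set} {q : ℕ} → (A → ℕ) → Vec A q → ℕ
tally f []       = 0
tally f (u ∷ us) = f u + tally f us

tally-mono : {A : Set} {q : ℕ} {f g : A → ℕ} (us : Vec A q) → (∀ u → f u ≤ℕ g u) → tally f us ≤ℕ tally g us
tally-mono []       f≤g = z≤n
tally-mono (u ∷ us) f≤g = ℕ.+-mono-≤ (f≤g u) (tally-mono us f≤g)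

tally-+ : {A : Set} {q : ℕ} (f g : A → ℕ) (us : Vec A q) → tally (λ u → f u + g u) us ≡ tally f us + tally g us
tally-+ f g []       = refl
tally-+ f g (u ∷ us) = trans (cong (f u + g u +_) (tally-+ f g us))
  (solve 4 (λ a b x y → a :+ b :+ (x :+ y) := a :+ x :+ (b :+ y)) refl (f u) (g u) (tally f us) (tally g us))
  where open +-*-Solver

∏ : {A : Set} {q : ℕ} → (A → ℕ) → Vec A q → ℕ
∏ φ []       = 1
∏ φ (u ∷ us) = φ u * ∏ φ us

∑-∏ : {A : Set} (xs : List A) (φ : A → ℕ) (q : ℕ) → ∑ (words xs q) (∏ φ) ≡ ∑ xs φ ^ q
∑-∏ xs φ zero    = refl
∑-∏ xs φ (suc q) = begin
  ∑ (words xs (suc q)) (∏ φ)                        ≡⟨ ∑-product _∷_ (∏ φ) xs (words xs q) ⟩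
  ∑ xs (λ x → ∑ (words xs q) (λ us → φ x * ∏ φ us)) ≡⟨ ∑-cong xs (λ x → ∑-*ˡ (φ x) (∏ φ) (words xs q)) ⟩
  ∑ xs (λ x → φ x * ∑ (words xs q) (∏ φ))           ≡⟨ ∑-*ʳ φ (∑ (words xs q) (∏ φ)) xs ⟩
  ∑ xs φ * ∑ (words xs q) (∏ φ)                     ≡⟨ cong (∑ xs φ *_) (∑-∏ xs φ q) ⟩
  ∑ xs φ * ∑ xs φ ^ q                               ∎
  where open ≡-Reasoning

-- That is (39/40)^120 ≤ 1/16, which fixes 120 as the number of queries per unit of `Q`.
16*39^120≤40^120 : 16 * 39 ^ 120 ≤ℕ 40 ^ 120
16*39^120≤40^120 = ℕ.≤ᵇ⇒≤ (16 * 39 ^ 120) (40 ^ 120) _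

-- An exponential moment with base 1/2. An event of probability at least 1/20 makes the mean of
-- 2^(-indicator) at most 1 - 1/40 = 39/40; over `120 * Q` independent samples this becomes at most
-- 16^(-Q), and Markov's inequality at tally `3 * Q` costs a factor 2^(3Q).
chernoff : {A : Set} {P : A → Set} (P? : ∀ x → Dec (P x)) (xs : List A) (Q : ℕ) →
           length xs ≤ℕ 20 * ∑ xs (λ x → 𝟙 (P? x)) →
           Rare (2 ^ Q) (words xs (120 * Q)) (λ us → 𝟙 (tally (λ x → 𝟙 (P? x)) us ≤? 3 * Q))
chernoff P? xs Q frequent = subst (2 ^ Q * count ≤ℕ_) (sym (length-words xs q))
  (ℕ.*-cancelʳ-≤ _ _ (2 ^ (3 * Q) * 39 ^ q) {{ℕ.m*n≢0 (2 ^ (3 * Q)) (39 ^ q) {{ℕ.m^n≢0 2 (3 * Q)}} {{ℕ.m^n≢0 39 q}}}} (begin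
    2 ^ Q * count * (2 ^ (3 * Q) * 39 ^ q)
      ≡⟨ solve 4 (λ a c b n → a :* c :* (b :* n) := a :* b :* n :* c) refl (2 ^ Q) count (2 ^ (3 * Q)) (39 ^ q) ⟩
    2 ^ Q * 2 ^ (3 * Q) * 39 ^ q * count
      ≤⟨ ℕ.*-monoˡ-≤ count gain ⟩
    40 ^ q * count
      ≡⟨ trans (cong (_* count) (^-distribʳ-* 20 2 q)) (ℕ.*-assoc (20 ^ q) (2 ^ q) count) ⟩
    20 ^ q * (2 ^ q * count)
      ≤⟨ ℕ.*-monoʳ-≤ (20 ^ q) moment ⟩
    20 ^ q * (2 ^ (3 * Q) * ∑ xs φ ^ q)
      ≡⟨ solve 3 (λ a b c → a :* (b :* c) := b :* (a :* c)) refl (20 ^ q) (2 ^ (3 * Q)) (∑ xs φ ^ q) ⟩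
    2 ^ (3 * Q) * (20 ^ q * ∑ xs φ ^ q)
      ≡⟨ cong (2 ^ (3 * Q) *_) (^-distribʳ-* 20 (∑ xs φ) q) ⟨
    2 ^ (3 * Q) * (20 * ∑ xs φ) ^ q
      ≤⟨ ℕ.*-monoʳ-≤ (2 ^ (3 * Q)) (ℕ.^-monoˡ-≤ q 20φ≤39) ⟩
    2 ^ (3 * Q) * (39 * length xs) ^ q
      ≡⟨ cong (2 ^ (3 * Q) *_) (^-distribʳ-* 39 (length xs) q) ⟩
    2 ^ (3 * Q) * (39 ^ q * length xs ^ q)
      ≡⟨ solve 3 (λ a b c → a :* (b :* c) := c :* (a :* b)) refl (2 ^ (3 * Q)) (39 ^ q) (length xs ^ q) ⟩
    length xs ^ q * (2 ^ (3 * Q) * 39 ^ q) ∎))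
  where
  open ℕ.≤-Reasoning
  open +-*-Solver
  q = 120 * Q
  f = λ x → 𝟙 (P? x)
  rare? : ∀ us → Dec (tally f us ≤ℕ 3 * Q)
  rare? us = tally f us ≤? 3 * Q
  count = ∑ (words xs q) (λ us → 𝟙 (rare? us))
  -- The integer 2 * 2^(-f x); the base 40 is 20 times this leading 2.
  φ = λ x → if does (P? x) then 1 else 2
  φ+f≡2 : ∀ x → φ x + f x ≡ 2
  φ+f≡2 x with does (P? x)
  ... | true  = refl
  ... | false = refl
  φ*2^f≡2 : ∀ x → φ x * 2 ^ f x ≡ 2
  φ*2^f≡2 x with does (P? x)
  ... | true  = refl
  ... | false = refl
  ∏*2^tally : ∀ {q} (us : Vec _ q) → ∏ φ us * 2 ^ tally f us ≡ 2 ^ q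
  ∏*2^tally []       = refl
  ∏*2^tally (u ∷ us) = trans (cong (φ u * ∏ φ us *_) (ℕ.^-distribˡ-+-* 2 (f u) (tally f us)))
    (trans (solve 4 (λ a b c d → a :* b :* (c :* d) := a :* c :* (b :* d)) refl (φ u) (∏ φ us) (2 ^ f u) (2 ^ tally f us))
           (cong₂ _*_ (φ*2^f≡2 u) (∏*2^tally us)))
  gain : 2 ^ Q * 2 ^ (3 * Q) * 39 ^ q ≤ℕ 40 ^ q
  gain = begin
    2 ^ Q * 2 ^ (3 * Q) * 39 ^ q            ≡⟨ cong₂ _*_ (trans (sym (ℕ.^-distribˡ-+-* 2 Q (3 * Q))) (sym (ℕ.^-*-assoc 2 4 Q))) (sym (ℕ.^-*-assoc 39 120 Q)) ⟩
    16 ^ Q * (39 ^ 120) ^ Q                 ≡⟨ ^-distribʳ-* 16 (39 ^ 120) Q ⟨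
    (16 * 39 ^ 120) ^ Q                     ≤⟨ ℕ.^-monoˡ-≤ Q 16*39^120≤40^120 ⟩
    (40 ^ 120) ^ Q                          ≡⟨ ℕ.^-*-assoc 40 120 Q ⟩
    40 ^ q                                  ∎
  pointwise : ∀ us → (d : Dec (tally f us ≤ℕ 3 * Q)) → 2 ^ q * 𝟙 d ≤ℕ 2 ^ (3 * Q) * ∏ φ us
  pointwise us (no _)  = ℕ.≤-trans (ℕ.≤-reflexive (ℕ.*-zeroʳ (2 ^ q))) z≤n
  pointwise us (yes p) = begin
    2 ^ q * 1                      ≡⟨ ℕ.*-identityʳ (2 ^ q) ⟩
    2 ^ q                          ≡⟨ ∏*2^tally us ⟨
    ∏ φ us * 2 ^ tally f us        ≤⟨ ℕ.*-monoʳ-≤ (∏ φ us) (ℕ.^-monoʳ-≤ 2 p) ⟩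
    ∏ φ us * 2 ^ (3 * Q)           ≡⟨ ℕ.*-comm (∏ φ us) _ ⟩
    2 ^ (3 * Q) * ∏ φ us           ∎
  moment : 2 ^ q * count ≤ℕ 2 ^ (3 * Q) * ∑ xs φ ^ q
  moment = begin
    2 ^ q * count                                            ≡⟨ ∑-*ˡ (2 ^ q) _ (words xs q) ⟨
    ∑ (words xs q) (λ us → 2 ^ q * 𝟙 (rare? us))             ≤⟨ ∑-mono (words xs q) (λ us → pointwise us (rare? us)) ⟩
    ∑ (words xs q) (λ us → 2 ^ (3 * Q) * ∏ φ us)             ≡⟨ ∑-*ˡ (2 ^ (3 * Q)) _ (words xs q) ⟩
    2 ^ (3 * Q) * ∑ (words xs q) (∏ φ)                       ≡⟨ cong (2 ^ (3 * Q) *_) (∑-∏ xs φ q) ⟩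
    2 ^ (3 * Q) * ∑ xs φ ^ q                                 ∎
  20φ≤39 : 20 * ∑ xs φ ≤ℕ 39 * length xs
  20φ≤39 = ℕ.+-cancelʳ-≤ (length xs) _ _ (begin
    20 * ∑ xs φ + length xs             ≤⟨ ℕ.+-monoʳ-≤ (20 * ∑ xs φ) frequent ⟩
    20 * ∑ xs φ + 20 * ∑ xs f           ≡⟨ ℕ.*-distribˡ-+ 20 (∑ xs φ) (∑ xs f) ⟨
    20 * (∑ xs φ + ∑ xs f)              ≡⟨ cong (20 *_) (trans (sym (∑-+ φ f xs)) (trans (∑-cong xs φ+f≡2) (∑-const xs 2))) ⟩
    20 * (length xs * 2)                ≡⟨ solve 1 (λ x → con 20 :* (x :* con 2) := con 39 :* x :+ x) refl (length xs) ⟩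
    39 * length xs + length xs          ∎)

-- For a fixed mask the query is uniform in `z`, and linearity of expectation asks for no
-- independence. The mean noise is at most 40 Q / 1000, so Markov's inequality at Q / 2 gives 80 /
-- 1000 ≤ 1 / 12. The later application has `3 * Q` in place of `Q`.
noise-rare : ∀ {n q} (Q : ℕ) .{{_ : NonZero Q}} → q ≤ℕ 40 * Q → (err : Point n → ℕ) →
             1000 * ∑ (points n) err ≤ℕ 2 ^ n → (ms : Vec (Point n) q) →
             Rare 12 (points n) (λ z → 𝟙 (Q <? 2 * tally (λ m → err (z ⊕ m)) ms))
noise-rare {n} {q} Q q≤40Q err sparse ms = begin
  12 * fail                 ≤⟨ ℕ.*-monoʳ-≤ 12 fail≤80E ⟩
  12 * (80 * E)             ≡⟨ ℕ.*-assoc 12 80 E ⟨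
  960 * E                   ≤⟨ ℕ.*-monoˡ-≤ E (ℕ.m≤m+n 960 40) ⟩
  1000 * E                  ≤⟨ sparse ⟩
  2 ^ n                     ≡⟨ length-points n ⟨
  length (points n)         ∎
  where
  open ℕ.≤-Reasoning
  open +-*-Solver
  E = ∑ (points n) err
  noise : ∀ {q} → Vec (Point n) q → Point n → ℕ
  noise ms z = tally (λ m → err (z ⊕ m)) ms
  fail = ∑ (points n) (λ z → 𝟙 (Q <? 2 * noise ms z))
  ∑-noise : ∀ {q} (ms : Vec (Point n) q) → ∑ (points n) (noise ms) ≡ q * E
  ∑-noise []       = ∑-zero (points n) (λ _ → refl)
  ∑-noise (m ∷ ms) = trans (∑-+ (λ z → err (z ⊕ m)) (noise ms) (points n)) (cong₂ _+_ (∑-⊕ err m) (∑-noise ms))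
  pointwise : ∀ z → (d : Dec (Q <ℕ 2 * noise ms z)) → Q * 𝟙 d ≤ℕ 2 * noise ms z
  pointwise z (yes p) = ℕ.≤-trans (ℕ.≤-reflexive (ℕ.*-identityʳ Q)) (ℕ.<⇒≤ p)
  pointwise z (no _)  = ℕ.≤-trans (ℕ.≤-reflexive (ℕ.*-zeroʳ Q)) z≤n
  fail≤80E : fail ≤ℕ 80 * E
  fail≤80E = ℕ.*-cancelˡ-≤ Q (begin
    Q * fail                                             ≡⟨ ∑-*ˡ Q _ (points n) ⟨
    ∑ (points n) (λ z → Q * 𝟙 (Q <? 2 * noise ms z))     ≤⟨ ∑-mono (points n) (λ z → pointwise z (Q <? 2 * noise ms z)) ⟩
    ∑ (points n) (λ z → 2 * noise ms z)                  ≡⟨ ∑-*ˡ 2 (noise ms) (points n) ⟩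
    2 * ∑ (points n) (noise ms)                          ≡⟨ cong (2 *_) (∑-noise ms) ⟩
    2 * (q * E)                                          ≤⟨ ℕ.*-monoʳ-≤ 2 (ℕ.*-monoˡ-≤ E q≤40Q) ⟩
    2 * (40 * Q * E)                                     ≡⟨ solve 2 (λ a b → con 2 :* (con 40 :* a :* b) := a :* (con 80 :* b)) refl Q E ⟩
    Q * (80 * E)                                         ∎)

∑-allFin : ∀ s (g : Fin (suc s) → ℕ) → ∑ (allFin (suc s)) g ≡ g zero + ∑ (allFin s) (g ∘ suc)
∑-allFin s g = cong (g zero +_) (trans (cong (λ xs → ∑ xs g) (sym (map-tabulate id suc))) (∑-map g suc (allFin s)))

∑-≟ : ∀ {s} (y : Fin s) → ∑ (allFin s) (λ x → 𝟙 (x Fin.≟ y)) ≡ 1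
∑-≟ {suc s} zero    = trans (∑-allFin s (λ x → 𝟙 (x Fin.≟ zero))) (cong suc (∑-zero (allFin s) (λ _ → refl)))
∑-≟ {suc s} (suc y) = trans (∑-allFin s (λ x → 𝟙 (x Fin.≟ suc y))) (∑-≟ y)

length-allFin : ∀ s → length (allFin s) ≡ s
length-allFin s = length-tabulate {n = s} id

collision-rare : ∀ {s n} (j j′ : Fin n) → j ≢ j′ →
                 Rare s (words (allFin s) n) (λ h → 𝟙 (lookup h j Fin.≟ lookup h j′))
collision-rare zero    zero     ne = contradiction refl ne
collision-rare {s} {suc n} zero (suc j′) ne = ℕ.≤-reflexive (begin
  s * ∑ (words (allFin s) (suc n)) (λ h → 𝟙 (lookup h zero Fin.≟ lookup h (suc j′)))
    ≡⟨ cong (s *_) (trans (∑-product _∷_ _ (allFin s) H) (∑-swap _ (allFin s) H)) ⟩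
  s * ∑ H (λ h → ∑ (allFin s) (λ x → 𝟙 (x Fin.≟ lookup h j′)))
    ≡⟨ cong (s *_) (trans (∑-cong H (λ h → ∑-≟ (lookup h j′))) (sym (length≡∑1 H))) ⟩
  s * length H
    ≡⟨ cong (_* length H) (length-allFin s) ⟨
  length (allFin s) * length H
    ≡⟨ length-product _∷_ (allFin s) H ⟨
  length (words (allFin s) (suc n)) ∎)
  where open ≡-Reasoning
        H = words (allFin s) n
collision-rare {s} {suc n} (suc j) zero ne = ℕ.≤-trans (ℕ.*-monoʳ-≤ s (∑-mono (words (allFin s) (suc n))
    (λ h → 𝟙-mono (lookup h (suc j) Fin.≟ lookup h zero) (lookup h zero Fin.≟ lookup h (suc j)) sym)))
  (collision-rare {s} {suc n} zero (suc j) (ne ∘ sym))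
collision-rare {s} {suc n} (suc j) (suc j′) ne = begin
  s * ∑ (words (allFin s) (suc n)) (λ h → 𝟙 (lookup h (suc j) Fin.≟ lookup h (suc j′)))
    ≡⟨ cong (s *_) (∑-product _∷_ _ (allFin s) H) ⟩
  s * ∑ (allFin s) (λ _ → S)
    ≡⟨ cong (s *_) (trans (∑-const (allFin s) S) (cong (_* S) (length-allFin s))) ⟩
  s * (s * S)
    ≤⟨ ℕ.*-monoʳ-≤ s (collision-rare {s} j j′ (ne ∘ cong suc)) ⟩
  s * length H
    ≡⟨ cong (_* length H) (length-allFin s) ⟨
  length (allFin s) * length H
    ≡⟨ length-product _∷_ (allFin s) H ⟨
  length (words (allFin s) (suc n)) ∎
  where
  open ℕ.≤-Reasoning
  H = words (allFin s) n
  S = ∑ H (λ h → 𝟙 (lookup h j Fin.≟ lookup h j′))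

-- Disjoint intervals, so that a random one contains a given place with probability at most 1/G.
block : ∀ G L → Fin G → Subset (G * L)
block (suc G) L zero    = replicate L inside Vec.++ replicate (G * L) outside
block (suc G) L (suc ρ) = replicate L outside Vec.++ block G L ρ

∣++∣ : ∀ {m n} (p : Subset m) (q : Subset n) → ∣ p Vec.++ q ∣ ≡ ∣ p ∣ + ∣ q ∣
∣++∣ []            q = refl
∣++∣ (inside ∷ p)  q = cong suc (∣++∣ p q)
∣++∣ (outside ∷ p) q = ∣++∣ p q

∣block∣ : ∀ G L ρ → ∣ block G L ρ ∣ ≡ L
∣block∣ (suc G) L zero    = trans (∣++∣ (replicate L inside) (replicate (G * L) outside))
  (trans (cong₂ _+_ (∣⊤∣≡n L) (∣⊥∣≡0 (G * L))) (ℕ.+-identityʳ L))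
∣block∣ (suc G) L (suc ρ) = trans (∣++∣ (replicate L outside) (block G L ρ)) (cong₂ _+_ (∣⊥∣≡0 L) (∣block∣ G L ρ))

blocks-disjoint : ∀ G L j → ∑ (allFin G) (λ ρ → 𝟙 (T? (lookup (block G L ρ) j))) ≤ℕ 1
blocks-disjoint zero    L j = z≤n
blocks-disjoint (suc G) L j with splitAt L j in eq
... | inj₁ i = ℕ.≤-trans (ℕ.≤-reflexive (∑-allFin G _)) (ℕ.+-mono-≤ (𝟙≤1 (T? (lookup (block (suc G) L zero) j)))
  (ℕ.≤-reflexive (∑-zero (allFin G) (λ ρ → cong (λ b → 𝟙 (T? b)) (trans (Vec.lookup-splitAt L (replicate L outside) (block G L ρ) j)
    (trans (cong Data.Sum.[ lookup (replicate L outside) , lookup (block G L ρ) ] eq) (Vec.lookup-replicate i outside)))))))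
... | inj₂ i = ℕ.≤-trans (ℕ.≤-reflexive (trans (∑-allFin G _) (cong₂ _+_
    (cong (λ b → 𝟙 (T? b)) (trans (Vec.lookup-splitAt L (replicate L inside) (replicate (G * L) outside) j)
      (trans (cong Data.Sum.[ lookup (replicate L inside) , lookup (replicate (G * L) outside) ] eq) (Vec.lookup-replicate i outside))))
    (∑-cong (allFin G) (λ ρ → cong (λ b → 𝟙 (T? b)) (trans (Vec.lookup-splitAt L (replicate L outside) (block G L ρ) j)
      (cong Data.Sum.[ lookup (replicate L outside) , lookup (block G L ρ) ] eq)))))))
  (blocks-disjoint G L i)

region : ∀ {n} G L rest → G * L + rest ≡ n → Fin G → Subset n
region G L rest refl ρ = block G L ρ Vec.++ replicate rest outside

∣region∣ : ∀ {n} G L rest (n≡ : G * L + rest ≡ n) ρ → ∣ region G L rest n≡ ρ ∣ ≡ L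
∣region∣ G L rest refl ρ = trans (∣++∣ (block G L ρ) (replicate rest outside))
  (trans (cong₂ _+_ (∣block∣ G L ρ) (∣⊥∣≡0 rest)) (ℕ.+-identityʳ L))

regions-disjoint : ∀ {n} G L rest (n≡ : G * L + rest ≡ n) j → ∑ (allFin G) (λ ρ → 𝟙 (T? (lookup (region G L rest n≡ ρ) j))) ≤ℕ 1
regions-disjoint G L rest refl j with splitAt (G * L) j in eq
... | inj₁ i = ℕ.≤-trans (ℕ.≤-reflexive (∑-cong (allFin G) (λ ρ → cong (λ b → 𝟙 (T? b)) (trans (Vec.lookup-splitAt (G * L) (block G L ρ) (replicate rest outside) j)
      (cong Data.Sum.[ lookup (block G L ρ) , lookup (replicate rest outside) ] eq))))) (blocks-disjoint G L i)
... | inj₂ i = ℕ.≤-trans (ℕ.≤-reflexive (∑-zero (allFin G) (λ ρ → cong (λ b → 𝟙 (T? b)) (trans (Vec.lookup-splitAt (G * L) (block G L ρ) (replicate rest outside) j)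
      (trans (cong Data.Sum.[ lookup (block G L ρ) , lookup (replicate rest outside) ] eq) (Vec.lookup-replicate i outside)))))) z≤n

-- Queries

embed : ∀ {n} (J : Subset n) → Fin ∣ J ∣ → Fin n
embed (inside ∷ J)  zero    = zero
embed (inside ∷ J)  (suc i) = suc (embed J i)
embed (outside ∷ J) i       = suc (embed J i)

embed-injective : ∀ {n} (J : Subset n) {i j} → embed J i ≡ embed J j → i ≡ j
embed-injective (inside ∷ J)  {zero}  {zero}  eq = refl
embed-injective (inside ∷ J)  {suc i} {suc j} eq = cong suc (embed-injective J (Fin.suc-injective eq))
embed-injective (outside ∷ J)                 eq = embed-injective J (Fin.suc-injective eq)

restrict-embed : ∀ {n} (J : Subset n) (y : Point n) → restrict J y ≡ tabulate (λ i → lookup y (embed J i))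
restrict-embed []            []      = refl
restrict-embed (inside ∷ J)  (b ∷ y) = cong (b ∷_) (restrict-embed J y)
restrict-embed (outside ∷ J) (b ∷ y) = restrict-embed J y

weight-split : ∀ {n} (R : Subset n) (y : Point n) → ∣ y ∣ ≡ ∣ restrict (∁ R) y ∣ + ∣ restrict R y ∣
weight-split []            []          = refl
weight-split (inside ∷ R)  (true ∷ y)  = trans (cong suc (weight-split R y)) (sym (ℕ.+-suc _ _))
weight-split (inside ∷ R)  (false ∷ y) = weight-split R y
weight-split (outside ∷ R) (true ∷ y)  = cong suc (weight-split R y)
weight-split (outside ∷ R) (false ∷ y) = weight-split R y

∑-restrict : ∀ {n} (R : Subset n) (f : Point ∣ R ∣ → ℕ) →
             ∑ (points n) (λ y → f (restrict R y)) ≡ 2 ^ ∣ ∁ R ∣ * ∑ (points ∣ R ∣) f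
∑-restrict []            f = sym (ℕ.*-identityˡ _)
∑-restrict {suc n} (inside ∷ R) f = begin
  ∑ (points (suc n)) (λ y → f (restrict (inside ∷ R) y))
    ≡⟨ ∑-points n _ ⟩
  ∑ (points n) (λ y → f (false ∷ restrict R y)) + ∑ (points n) (λ y → f (true ∷ restrict R y))
    ≡⟨ cong₂ _+_ (∑-restrict R (f ∘ (false ∷_))) (∑-restrict R (f ∘ (true ∷_))) ⟩
  2 ^ ∣ ∁ R ∣ * ∑ (points ∣ R ∣) (f ∘ (false ∷_)) + 2 ^ ∣ ∁ R ∣ * ∑ (points ∣ R ∣) (f ∘ (true ∷_))
    ≡⟨ ℕ.*-distribˡ-+ (2 ^ ∣ ∁ R ∣) _ _ ⟨
  2 ^ ∣ ∁ R ∣ * (∑ (points ∣ R ∣) (f ∘ (false ∷_)) + ∑ (points ∣ R ∣) (f ∘ (true ∷_)))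
    ≡⟨ cong (2 ^ ∣ ∁ R ∣ *_) (∑-points ∣ R ∣ f) ⟨
  2 ^ ∣ ∁ R ∣ * ∑ (points (suc ∣ R ∣)) f ∎
  where open ≡-Reasoning
∑-restrict {suc n} (outside ∷ R) f = begin
  ∑ (points (suc n)) (λ y → f (restrict (outside ∷ R) y))
    ≡⟨ ∑-points n _ ⟩
  ∑ (points n) (λ y → f (restrict R y)) + ∑ (points n) (λ y → f (restrict R y))
    ≡⟨ cong (λ x → x + x) (∑-restrict R f) ⟩
  2 ^ ∣ ∁ R ∣ * ∑ (points ∣ R ∣) f + 2 ^ ∣ ∁ R ∣ * ∑ (points ∣ R ∣) f
    ≡⟨ solve 2 (λ p x → p :* x :+ p :* x := con 2 :* p :* x) refl (2 ^ ∣ ∁ R ∣) (∑ (points ∣ R ∣) f) ⟩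
  2 ^ suc ∣ ∁ R ∣ * ∑ (points ∣ R ∣) f ∎
  where open ≡-Reasoning
        open +-*-Solver

bit : Bool → ℕ
bit b = if b then 1 else 0

∣tabulate∣ : ∀ {n} (f : Fin n → Bool) → ∣ tabulate f ∣ ≡ sum (bit ∘ f)
∣tabulate∣ {zero}  f = refl
∣tabulate∣ {suc n} f with f zero
... | true  = cong suc (∣tabulate∣ (f ∘ suc))
... | false = ∣tabulate∣ (f ∘ suc)

∣permuted∣ : ∀ {n} (σ : Permutation′ n) (z : Point n) → ∣ tabulate (λ i → lookup z (σ ⟨$⟩ʳ i)) ∣ ≡ ∣ z ∣
∣permuted∣ σ z = begin
  ∣ tabulate (λ i → lookup z (σ ⟨$⟩ʳ i)) ∣     ≡⟨ ∣tabulate∣ (λ i → lookup z (σ ⟨$⟩ʳ i)) ⟩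
  sum (λ i → bit (lookup z (σ ⟨$⟩ʳ i)))        ≡⟨ sum-permute (λ i → bit (lookup z i)) σ ⟨
  sum (λ i → bit (lookup z i))                 ≡⟨ ∣tabulate∣ (lookup z) ⟨
  ∣ tabulate (lookup z) ∣                      ≡⟨ cong ∣_∣ (Vec.tabulate∘lookup z) ⟩
  ∣ z ∣                                        ∎
  where open ≡-Reasoning

place : ∀ {n} → Permutation′ n → (J : Subset n) → Fin ∣ J ∣ → Fin n
place σ J i = σ ⟨$⟩ʳ embed J i

place-injective : ∀ {n} (σ : Permutation′ n) (J : Subset n) {i j} → place σ J i ≡ place σ J j → i ≡ j
place-injective σ J eq = embed-injective J (trans (sym (inverseˡ σ)) (trans (cong (σ ⟨$⟩ˡ_) eq) (inverseˡ σ)))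

values : ∀ {n k} → (Fin k → Fin n) → Point n → Point k
values a z = tabulate (λ i → lookup z (a i))

-- A permutation keeps the weight, so the isomorphic function depends on the bits at the k places
-- and on ∣ z ∣, which can be read off a query point without knowing `σ`. The reduction modulo m + 1
-- in `cell` is exact here, because the true remaining weight is at most m.
isomorph-predict : ∀ {n} (σ : Permutation′ n) (J : Subset n) (c : Core ∣ J ∣ ∣ ∁ J ∣) (z : Point n) →
                   isomorph σ (symmetricFun J c) z ≡ predict {∣ J ∣} {∣ ∁ J ∣} c (values (place σ J) z) ∣ z ∣
isomorph-predict σ J c z = cong (lookup c) (cong₂ combine (cong index restrict≡) (Fin.toℕ-injective (begin
  toℕ (hammingWeight (restrict (∁ J) y))        ≡⟨ Fin.toℕ-fromℕ< (s≤s (∣p∣≤n w)) ⟩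
  ∣ w ∣                                         ≡⟨ m≤n⇒m%n≡m (∣p∣≤n w) ⟨
  ∣ w ∣ %ℕ suc m                                ≡⟨ [m+kn]%n≡m%n ∣ w ∣ ∣ v ∣ (suc m) ⟨
  (∣ w ∣ + ∣ v ∣ * suc m) %ℕ suc m              ≡⟨ cong (_%ℕ suc m) (solve 3 (λ a b μ → a :+ b :* (con 1 :+ μ) := a :+ b :+ μ :* b) refl ∣ w ∣ ∣ v ∣ m) ⟩
  (∣ w ∣ + ∣ v ∣ + m * ∣ v ∣) %ℕ suc m          ≡⟨ cong₂ (λ x u → (x + m * ∣ u ∣) %ℕ suc m) (trans (sym (weight-split J y)) (∣permuted∣ σ z)) restrict≡ ⟩
  (∣ z ∣ + m * ∣ values (place σ J) z ∣) %ℕ suc m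
                                                ≡⟨ Fin.toℕ-fromℕ< (m%n<n (∣ z ∣ + m * ∣ values (place σ J) z ∣) (suc m)) ⟨
  toℕ ((∣ z ∣ + m * ∣ values (place σ J) z ∣) mod suc m) ∎)))
  where
  open ≡-Reasoning
  open +-*-Solver
  m = ∣ ∁ J ∣
  y = tabulate (λ i → lookup z (σ ⟨$⟩ʳ i))
  v = restrict J y
  w = restrict (∁ J) y
  restrict≡ : v ≡ values (place σ J) z
  restrict≡ = trans (restrict-embed J y) (Vec.tabulate-cong (λ i → Vec.lookup∘tabulate _ (embed J i)))

mask : ∀ {n d} → Vec (Fin d) n → Subset n → Point d → Point n → Point n
mask []       []      t []      = []
mask (l ∷ ls) (b ∷ R) t (u ∷ r) = (if b then u else lookup t l) ∷ mask ls R t r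

lookup-mask : ∀ {n d} (ls : Vec (Fin d) n) (R : Subset n) (t : Point d) (r : Point n) j → ¬ T (lookup R j) →
              lookup (mask ls R t r) j ≡ lookup t (lookup ls j)
lookup-mask (l ∷ ls) (outside ∷ R) t (u ∷ r) zero    j∉R = refl
lookup-mask (l ∷ ls) (inside ∷ R)  t (u ∷ r) zero    j∉R = contradiction _ j∉R
lookup-mask (l ∷ ls) (b ∷ R)       t (u ∷ r) (suc j) j∉R = lookup-mask ls R t r j j∉R

-- The order `r ⊕ z` lets `∑-⊕` absorb `z` when averaging over `r`.
restrict-mask : ∀ {n d} (ls : Vec (Fin d) n) (R : Subset n) (t : Point d) (r z : Point n) →
                restrict R (z ⊕ mask ls R t r) ≡ restrict R (r ⊕ z)
restrict-mask []       []            t []      []      = refl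
restrict-mask (l ∷ ls) (inside ∷ R)  t (u ∷ r) (b ∷ z) = cong₂ _∷_ (xor-comm b u) (restrict-mask ls R t r z)
restrict-mask (l ∷ ls) (outside ∷ R) t (u ∷ r) (b ∷ z) = restrict-mask ls R t r z

bump : Bool → ℕ × ℕ → ℕ × ℕ
bump true  (x , y) = x , suc y
bump false (x , y) = suc x , y

-- The number of ones a variable contributes outside R when it is true, and when it is false.
signature : ∀ {n d} → Vec (Fin d) n → Subset n → Point n → Vec (ℕ × ℕ) d
signature {d = d} []       []            []      = replicate d (0 , 0)
signature         (l ∷ ls) (inside ∷ R)  (b ∷ z) = signature ls R z
signature         (l ∷ ls) (outside ∷ R) (b ∷ z) = updateAt (signature ls R z) l (bump b)

load-zero : ∀ {d} (t : Point d) → load (replicate d (0 , 0)) t ≡ 0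
load-zero []          = refl
load-zero (true ∷ t)  = load-zero t
load-zero (false ∷ t) = load-zero t

load-updateAt : ∀ {d} (κ : Vec (ℕ × ℕ) d) (t : Point d) l (g : ℕ × ℕ → ℕ × ℕ) i →
                (∀ p → (if lookup t l then proj₁ (g p) else proj₂ (g p)) ≡ i + (if lookup t l then proj₁ p else proj₂ p)) →
                load (updateAt κ l g) t ≡ i + load κ t
load-updateAt (p ∷ κ) (u ∷ t) zero    g i g≡ = trans (cong (_+ load κ t) (g≡ p)) (ℕ.+-assoc i _ (load κ t))
load-updateAt (p ∷ κ) (u ∷ t) (suc l) g i g≡ = trans (cong (x +_) (load-updateAt κ t l g i g≡))
  (solve 3 (λ a b e → a :+ (b :+ e) := b :+ (a :+ e)) refl x i (load κ t))
  where
  open +-*-Solver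
  x = if u then proj₁ p else proj₂ p

load-signature : ∀ {n d} (ls : Vec (Fin d) n) (R : Subset n) (t : Point d) (r z : Point n) →
                 load (signature ls R z) t ≡ ∣ restrict (∁ R) (z ⊕ mask ls R t r) ∣
load-signature []       []            t []      []      = load-zero t
load-signature (l ∷ ls) (inside ∷ R)  t (u ∷ r) (b ∷ z) = load-signature ls R t r z
load-signature (l ∷ ls) (outside ∷ R) t (u ∷ r) (b ∷ z) =
  trans (load-updateAt (signature ls R z) t l (bump b) (bit (b xor lookup t l)) (bump-load b (lookup t l)))
        (trans (cong (bit (b xor lookup t l) +_) (load-signature ls R t r z)) (sym (weight-∷ (b xor lookup t l) (restrict (∁ R) (z ⊕ mask ls R t r)))))
  where
  bump-load : ∀ b u p → (if u then proj₁ (bump b p) else proj₂ (bump b p)) ≡ bit (b xor u) + (if u then proj₁ p else proj₂ p)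
  bump-load true  true  p = refl
  bump-load true  false p = refl
  bump-load false true  p = refl
  bump-load false false p = refl
  weight-∷ : ∀ {m} b (y : Point m) → ∣ b ∷ y ∣ ≡ bit b + ∣ y ∣
  weight-∷ true  y = refl
  weight-∷ false y = refl

signature-bound : ∀ {n d} (ls : Vec (Fin d) n) (R : Subset n) (z : Point n) l →
                  proj₁ (lookup (signature ls R z) l) ≤ℕ n × proj₂ (lookup (signature ls R z) l) ≤ℕ n
signature-bound []        []            []      l =
  ℕ.≤-reflexive (cong proj₁ (Vec.lookup-replicate l (0 , 0))) , ℕ.≤-reflexive (cong proj₂ (Vec.lookup-replicate l (0 , 0)))
signature-bound (l′ ∷ ls) (inside ∷ R)  (b ∷ z) l with x≤ , y≤ ← signature-bound ls R z l = ℕ.m≤n⇒m≤1+n x≤ , ℕ.m≤n⇒m≤1+n y≤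
signature-bound (l′ ∷ ls) (outside ∷ R) (b ∷ z) l with l Fin.≟ l′
... | yes refl rewrite Vec.lookup∘updateAt l {bump b} (signature ls R z) = bump-bound b (signature-bound ls R z l)
  where
  bump-bound : ∀ b {p n} → proj₁ p ≤ℕ n × proj₂ p ≤ℕ n → proj₁ (bump b p) ≤ℕ suc n × proj₂ (bump b p) ≤ℕ suc n
  bump-bound true  (x≤ , y≤) = ℕ.m≤n⇒m≤1+n x≤ , s≤s y≤
  bump-bound false (x≤ , y≤) = s≤s x≤ , ℕ.m≤n⇒m≤1+n y≤
... | no l≢l′ rewrite Vec.lookup∘updateAt′ l l′ {bump b} l≢l′ (signature ls R z)
  with x≤ , y≤ ← signature-bound ls R z l = ℕ.m≤n⇒m≤1+n x≤ , ℕ.m≤n⇒m≤1+n y≤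

weight-query : ∀ {n d} (ls : Vec (Fin d) n) (R : Subset n) (t : Point d) (r z : Point n) →
               ∣ z ⊕ mask ls R t r ∣ ≡ load (signature ls R z) t + ∣ restrict R (r ⊕ z) ∣
weight-query ls R t r z = trans (weight-split R _)
  (cong₂ _+_ (sym (load-signature ls R t r z)) (cong ∣_∣ (restrict-mask ls R t r z)))

-- Averaging over the fresh bits, only their number inside R matters.
∑-disagree : ∀ {n d k m} (c : Core k m) (T T′ : Vec (Literal d) k) (ls : Vec (Fin d) n) (R : Subset n) (z : Point n) →
             ∑ (cartesianProduct (points d) (points n)) (λ u → 𝟙 (disagree? {m = m} c T T′ (proj₁ u) ∣ z ⊕ mask ls R (proj₁ u) (proj₂ u) ∣))
             ≡ 2 ^ ∣ ∁ R ∣ * disagreements m ∣ R ∣ c T T′ (load (signature ls R z))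
∑-disagree {n} {d} {k} {m} c T T′ ls R z = begin
  ∑ (cartesianProduct (points d) (points n)) (λ u → 𝟙 (disagree? {m = m} c T T′ (proj₁ u) ∣ z ⊕ mask ls R (proj₁ u) (proj₂ u) ∣))
    ≡⟨ ∑-product _,_ _ (points d) (points n) ⟩
  ∑ (points d) (λ t → ∑ (points n) (λ r → 𝟙 (disagree? {m = m} c T T′ t ∣ z ⊕ mask ls R t r ∣)))
    ≡⟨ ∑-cong (points d) row ⟩
  ∑ (points d) (λ t → 2 ^ ∣ ∁ R ∣ * ∑ (points ∣ R ∣) (F t))
    ≡⟨ ∑-*ˡ (2 ^ ∣ ∁ R ∣) _ (points d) ⟩
  2 ^ ∣ ∁ R ∣ * disagreements m ∣ R ∣ c T T′ (load (signature ls R z)) ∎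
  where
  open ≡-Reasoning
  F : Point d → Point ∣ R ∣ → ℕ
  F t y = 𝟙 (disagree? {m = m} c T T′ t (load (signature ls R z) t + ∣ y ∣))
  row : ∀ t → ∑ (points n) (λ r → 𝟙 (disagree? {m = m} c T T′ t ∣ z ⊕ mask ls R t r ∣)) ≡ 2 ^ ∣ ∁ R ∣ * ∑ (points ∣ R ∣) (F t)
  row t = begin
    ∑ (points n) (λ r → 𝟙 (disagree? {m = m} c T T′ t ∣ z ⊕ mask ls R t r ∣))
      ≡⟨ ∑-cong (points n) (λ r → cong (λ w → 𝟙 (disagree? {m = m} c T T′ t w)) (weight-query ls R t r z)) ⟩
    ∑ (points n) (λ r → F t (restrict R (r ⊕ z)))
      ≡⟨ ∑-⊕ (λ r → F t (restrict R r)) z ⟩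
    ∑ (points n) (λ r → F t (restrict R r))
      ≡⟨ ∑-restrict R (F t) ⟩
    2 ^ ∣ ∁ R ∣ * ∑ (points ∣ R ∣) (F t) ∎

2^∁*2^ : ∀ {n} (R : Subset n) → 2 ^ ∣ ∁ R ∣ * 2 ^ ∣ R ∣ ≡ 2 ^ n
2^∁*2^ {n} R = begin
  2 ^ ∣ ∁ R ∣ * 2 ^ ∣ R ∣                           ≡⟨ cong (2 ^ ∣ ∁ R ∣ *_) (trans (sym (length-points ∣ R ∣)) (length≡∑1 (points ∣ R ∣))) ⟩
  2 ^ ∣ ∁ R ∣ * ∑ (points ∣ R ∣) (λ _ → 1)          ≡⟨ ∑-restrict R (λ _ → 1) ⟨
  ∑ (points n) (λ _ → 1)                            ≡⟨ trans (sym (length≡∑1 (points n))) (length-points n) ⟩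
  2 ^ n                                             ∎
  where open ≡-Reasoning

-- The corrector

mismatches : {A : Set} {q : ℕ} → (A → Bool) → Vec A q → Vec Bool q → ℕ
mismatches p []       []       = 0
mismatches p (u ∷ us) (b ∷ bs) = 𝟙 (¬? (p u Bool.≟ b)) + mismatches p us bs

mismatches-map : {A : Set} {q : ℕ} (p b : A → Bool) (us : Vec A q) →
                 mismatches p us (Vec.map b us) ≡ tally (λ u → 𝟙 (¬? (p u Bool.≟ b u))) us
mismatches-map p b []       = refl
mismatches-map p b (u ∷ us) = cong (𝟙 (¬? (p u Bool.≟ b u)) +_) (mismatches-map p b us)

tally-map : {A B : Set} {q : ℕ} (f : B → ℕ) (h : A → B) (us : Vec A q) → tally f (Vec.map h us) ≡ tally (f ∘ h) us
tally-map f h []       = refl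
tally-map f h (u ∷ us) = cong (f (h u) +_) (tally-map f h us)

≢-triangle : ∀ x y z → 𝟙 (¬? (x Bool.≟ y)) ≤ℕ 𝟙 (¬? (x Bool.≟ z)) + 𝟙 (¬? (y Bool.≟ z))
≢-triangle false false z     = z≤n
≢-triangle true  true  z     = z≤n
≢-triangle false true  false = s≤s z≤n
≢-triangle false true  true  = s≤s z≤n
≢-triangle true  false false = s≤s z≤n
≢-triangle true  false true  = s≤s z≤n

∈-literals : ∀ {d} (ℓ : Literal d) → ℓ ∈ literals d
∈-literals (l , false) = ∈-cartesianProduct⁺ (∈-allFin l) (here refl)
∈-literals (l , true)  = ∈-cartesianProduct⁺ (∈-allFin l) (there (here refl))

module _ {s : ℕ} where

  label : Fin s → Bool → Fin (s * 2)
  label h b = combine h (if b then suc zero else zero)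

  isOne : Fin 2 → Bool
  isOne zero    = false
  isOne (suc _) = true

  labelBit : Fin (s * 2) → Bool
  labelBit l = isOne (proj₂ (remQuot {s} 2 l))

  labelBit-label : ∀ h b → labelBit (label h b) ≡ b
  labelBit-label h false = cong (isOne ∘ proj₂) (Fin.remQuot-combine {s} {2} h zero)
  labelBit-label h true  = cong (isOne ∘ proj₂) (Fin.remQuot-combine {s} {2} h (suc zero))

module Corrector {n : ℕ} (J : Subset n) (c : Core ∣ J ∣ ∣ ∁ J ∣) (s G L rest Q : ℕ) (n≡ : G * L + rest ≡ n) where

  k m d q : ℕ
  k = ∣ J ∣
  m = ∣ ∁ J ∣
  d = s * 2
  q = 120 * Q

  Ω : List (Point d × Point n)
  Ω = cartesianProduct (points d) (points n)

  -- In this order: the block, the hash of the coordinates, the fresh pair (t, r) of each query, and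
  -- the common shift `z`.
  Seed : Set
  Seed = Fin G × Vec (Fin s) n × Vec (Point d × Point n) q × Point n

  seeds : List Seed
  seeds = cartesianProduct (allFin G) (cartesianProduct (words (allFin s) n) (cartesianProduct (words Ω q) (points n)))

  R : Fin G → Subset n
  R = region G L rest n≡

  candidates : List (Vec (Literal d) k)
  candidates = words (literals d) k

  module _ (ρ : Fin G) (h : Vec (Fin s) n) (z : Point n) (x : Point n) where

    labels : Vec (Fin d) n
    labels = zipWith label h x

    query : Point d × Point n → Point n
    query (t , r) = z ⊕ mask labels (R ρ) t r

    prediction : Vec (Literal d) k → Point d × Point n → Bool
    prediction T (t , r) = predict {k} {m} c (lits T t) ∣ query (t , r) ∣

    -- The acceptance radius is `3 * Q / 2`, doubled to stay in ℕ: half of the distance `3 * Q` in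
    -- `Confusable`.
    Passes : Vec (Point d × Point n) q → Vec Bool q → Vec (Literal d) k → Set
    Passes us answers T = Unique (variables T) × 2 * mismatches (prediction T) us answers ≤ℕ 3 * Q

    passes? : ∀ us answers T → Dec (Passes us answers T)
    passes? us answers T = unique? T ×-dec (2 * mismatches (prediction T) us answers ≤? 3 * Q)

    inputBits : Vec (Literal d) k → Point k
    inputBits = Vec.map (labelBit {s} ∘ proj₁)

    choose : ∀ us answers → Dec (Any (Passes us answers) candidates) → Bool
    choose us answers (yes found) = predict {k} {m} c (inputBits (proj₁ (Any.satisfied found))) ∣ x ∣
    -- An arbitrary value: outside the four failure events `correct` shows that some candidate
    -- passes.
    choose us answers (no _)      = false

    decode : Vec (Point d × Point n) q → Vec Bool q → Bool
    decode us answers = choose us answers (any? (passes? us answers) candidates)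

    truth : (Fin k → Fin n) → Vec (Literal d) k
    truth a = tabulate (λ i → lookup labels (a i) , lookup z (a i))

    lits-truth : ∀ a → (∀ i → ¬ T (lookup (R ρ) (a i))) → ∀ t r → lits (truth a) t ≡ values a (query (t , r))
    lits-truth a a∉R t r = trans (sym (Vec.tabulate-∘ _ _)) (Vec.tabulate-cong (λ i → sym
      (trans (Vec.lookup-zipWith _xor_ (a i) z (mask labels (R ρ) t r)) (cong (lookup z (a i) xor_) (lookup-mask labels (R ρ) t r (a i) (a∉R i))))))

    inputBits-truth : ∀ a → inputBits (truth a) ≡ values a x
    inputBits-truth a = trans (sym (Vec.tabulate-∘ _ _)) (Vec.tabulate-cong (λ i →
      trans (cong (labelBit {s}) (Vec.lookup-zipWith label (a i) h x)) (labelBit-label (lookup h (a i)) (lookup x (a i)))))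

    unique-truth : ∀ a → (∀ {i j} → lookup h (a i) ≡ lookup h (a j) → i ≡ j) → Unique (variables (truth a))
    unique-truth a inj = subst Unique (Vec.tabulate-∘ _ _) (tabulate⁺ λ {i} {j} eq → inj
      (Fin.combine-injectiveˡ {s} {2} _ _ _ _ (trans (sym (Vec.lookup-zipWith label (a i) h x)) (trans eq (Vec.lookup-zipWith label (a j) h x)))))

    κ : Vec (ℕ × ℕ) d
    κ = signature labels (R ρ) z

    κ∈ : κ ∈ words (cartesianProduct (upTo (suc n)) (upTo (suc n))) d
    κ∈ = ∈-words κ (λ l → ∈-cartesianProduct⁺ (∈-upTo⁺ (s≤s (proj₁ (signature-bound labels (R ρ) z l))))
                                              (∈-upTo⁺ (s≤s (proj₂ (signature-bound labels (R ρ) z l)))))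

    differ? : ∀ T T′ u → Dec (prediction T u ≢ prediction T′ u)
    differ? T T′ (t , r) = disagree? {m = m} c T T′ t ∣ query (t , r) ∣

    Confusable : Vec (Literal d) k → Vec (Point d × Point n) q → Vec (Literal d) k → Set
    Confusable T us T′ = Separable ((T , T′) , κ) × tally (λ u → 𝟙 (differ? T T′ u)) us ≤ℕ 3 * Q

    confusable? : ∀ T us T′ → Dec (Confusable T us T′)
    confusable? T us T′ = separable? ((T , T′) , κ) ×-dec (tally (λ u → 𝟙 (differ? T T′ u)) us ≤? 3 * Q)

    -- The table `κ` is one of those in `params`, so a core that is not exceptional is good for it
    -- in particular. The factor 2 ^ ∣ ∁ (R ρ) ∣ accounts for the bits of `r` outside `R`, which do
    -- not enter the query.
    predictions-differ-often : ¬ Any (Bad m L c) (params n d k) → ∀ T T′ → Separable ((T , T′) , κ) →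
                               length Ω ≤ℕ 20 * ∑ Ω (λ u → 𝟙 (differ? T T′ u))
    predictions-differ-often good T T′ sep = begin
      length Ω                                  ≡⟨ trans (length-product _,_ (points d) (points n)) (cong₂ _*_ (length-points d) (length-points n)) ⟩
      2 ^ d * 2 ^ n                             ≡⟨ cong (2 ^ d *_) (2^∁*2^ (R ρ)) ⟨
      2 ^ d * (2 ^ l′ * 2 ^ l)                  ≡⟨ solve 3 (λ a b e → a :* (b :* e) := b :* (a :* e)) refl (2 ^ d) (2 ^ l′) (2 ^ l) ⟩
      2 ^ l′ * (2 ^ d * 2 ^ l)                  ≡⟨ cong (2 ^ l′ *_) (ℕ.^-distribˡ-+-* 2 d l) ⟨
      2 ^ l′ * 2 ^ (d + l)                      ≤⟨ ℕ.*-monoʳ-≤ (2 ^ l′) (subst (λ l → 2 ^ (d + l) ≤ℕ 20 * disagreements m l c T T′ (load κ)) (sym (∣region∣ G L rest n≡ ρ)) often) ⟩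
      2 ^ l′ * (20 * D)                         ≡⟨ solve 2 (λ a b → a :* (con 20 :* b) := con 20 :* (a :* b)) refl (2 ^ l′) D ⟩
      20 * (2 ^ l′ * D)                         ≡⟨ cong (20 *_) (∑-disagree {m = m} c T T′ labels (R ρ) z) ⟨
      20 * ∑ Ω (λ u → 𝟙 (differ? T T′ u))       ∎
      where
      open ℕ.≤-Reasoning
      open +-*-Solver
      l = ∣ R ρ ∣
      l′ = ∣ ∁ (R ρ) ∣
      D = disagreements m l c T T′ (load κ)
      often : 2 ^ (d + L) ≤ℕ 20 * disagreements m L c T T′ (load κ)
      often = ℕ.≮⇒≥ (λ lt → good (lose {P = Bad m L c} (∈-cartesianProduct⁺ (∈-cartesianProduct⁺ (∈-words T (λ i → ∈-literals _)) (∈-words T′ (λ i → ∈-literals _))) κ∈) (sep , lt)))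

    confusion-rare : ¬ Any (Bad m L c) (params n d k) → 12 * length candidates ≤ℕ 2 ^ Q → ∀ T →
                     Rare 12 (words Ω q) (λ us → 𝟙 (any? (confusable? T us) candidates))
    confusion-rare good few T = rare-mono {d = 12} (words Ω q) (λ us → 𝟙-any≤∑ (confusable? T us) candidates)
      (union-bound {d = 12} candidates (words Ω q) few (λ T′ → single T′ (separable? ((T , T′) , κ))))
      where
      single : ∀ T′ → Dec (Separable ((T , T′) , κ)) → Rare (2 ^ Q) (words Ω q) (λ us → 𝟙 (confusable? T us T′))
      single T′ (yes sep) = rare-mono {d = 2 ^ Q} (words Ω q)
        (λ us → 𝟙-mono (confusable? T us T′) (tally (λ u → 𝟙 (differ? T T′ u)) us ≤? 3 * Q) proj₂)
        (chernoff (differ? T T′) Ω Q (predictions-differ-often good T T′ sep))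
      single T′ (no ¬sep) = ℕ.≤-trans (ℕ.≤-reflexive (trans (cong (2 ^ Q *_)
        (∑-zero (words Ω q) (λ us → 𝟙-no (confusable? T us T′) (¬sep ∘ proj₁)))) (ℕ.*-zeroʳ (2 ^ Q)))) z≤n

  algorithm : Seed → NonAdaptiveAlgorithm n q
  algorithm (ρ , h , us , z) = record
    { numQueries   = λ _ → q
    ; numQueries≤q = λ _ → ℕ.≤-refl
    ; queries      = λ x → Vec.map (query ρ h z x) us
    ; output       = λ x → decode ρ h z x us
    }

  module _ (σ : Permutation′ n) (g : BoolFun n) (x : Point n) where

    f : BoolFun n
    f = isomorph σ (symmetricFun J c)

    a : Fin k → Fin n
    a = place σ J

    err : Point n → ℕ
    err y = 𝟙 (¬? (g y Bool.≟ f y))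

    Hit : Fin G → Set
    Hit ρ = Any (λ i → T (lookup (R ρ) (a i))) (allFin k)

    hit? : ∀ ρ → Dec (Hit ρ)
    hit? ρ = any? (λ i → T? (lookup (R ρ) (a i))) (allFin k)

    Collides : Vec (Fin s) n → Fin k × Fin k → Set
    Collides h (i , j) = i ≢ j × lookup h (a i) ≡ lookup h (a j)

    collides? : ∀ h ij → Dec (Collides h ij)
    collides? h (i , j) = ¬? (i Fin.≟ j) ×-dec (lookup h (a i) Fin.≟ lookup h (a j))

    Collision : Vec (Fin s) n → Set
    Collision h = Any (Collides h) (cartesianProduct (allFin k) (allFin k))

    collision? : ∀ h → Dec (Collision h)
    collision? h = any? (collides? h) (cartesianProduct (allFin k) (allFin k))

    Noisy : Fin G → Vec (Fin s) n → Vec (Point d × Point n) q → Point n → Set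
    Noisy ρ h us z = 3 * Q <ℕ 2 * tally (λ u → err (query ρ h z x u)) us

    noisy? : ∀ ρ h us z → Dec (Noisy ρ h us z)
    noisy? ρ h us z = 3 * Q <? 2 * tally (λ u → err (query ρ h z x u)) us

    Confused : Fin G → Vec (Fin s) n → Vec (Point d × Point n) q → Point n → Set
    Confused ρ h us z = Any (Confusable ρ h z x (truth ρ h z x a) us) candidates

    confused? : ∀ ρ h us z → Dec (Confused ρ h us z)
    confused? ρ h us z = any? (confusable? ρ h z x (truth ρ h z x a) us) candidates

    -- The true candidate `T₀` misses only corrupted queries, at most 3Q/2 of them. Another passing
    -- candidate would be as close to the answers, hence differ from `T₀` on at most 3Q queries by
    -- the triangle inequality, which `¬ Confused` forbids. So whichever candidate the search finds
    -- is `T₀`.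
    correct : ∀ ρ h us z → ¬ Hit ρ → ¬ Collision h → ¬ Noisy ρ h us z → ¬ Confused ρ h us z →
              NonAdaptiveAlgorithm.run (algorithm (ρ , h , us , z)) g x ≡ f x
    correct ρ h us z ¬hit ¬coll ¬noisy ¬conf = chosen (any? (passes? ρ h z x us answers) candidates)
      where
      open ℕ.≤-Reasoning
      T₀ : Vec (Literal d) k
      T₀ = truth ρ h z x a
      answers : Vec Bool q
      answers = Vec.map g (Vec.map (query ρ h z x) us)
      miss : Vec (Literal d) k → Point d × Point n → ℕ
      miss T u = 𝟙 (¬? (prediction ρ h z x T u Bool.≟ g (query ρ h z x u)))
      mismatches≡ : ∀ T → mismatches (prediction ρ h z x T) us answers ≡ tally (miss T) us
      mismatches≡ T = trans (cong (mismatches (prediction ρ h z x T) us) (sym (Vec.map-∘ g (query ρ h z x) us)))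
                            (mismatches-map (prediction ρ h z x T) (g ∘ query ρ h z x) us)
      a∉R : ∀ i → ¬ T (lookup (R ρ) (a i))
      a∉R i i∈R = ¬hit (lose (∈-allFin i) i∈R)
      h∘a-injective : ∀ {i j} → lookup h (a i) ≡ lookup h (a j) → i ≡ j
      h∘a-injective {i} {j} eq = decidable-stable (i Fin.≟ j)
        (λ i≢j → ¬coll (lose {P = Collides h} (∈-cartesianProduct⁺ (∈-allFin i) (∈-allFin j)) (i≢j , eq)))
      T₀! : Unique (variables T₀)
      T₀! = unique-truth ρ h z x a h∘a-injective
      prediction≡f : ∀ u → prediction ρ h z x T₀ u ≡ f (query ρ h z x u)
      prediction≡f (t , r) = trans (cong (λ y → predict {k} {m} c y ∣ query ρ h z x (t , r) ∣) (lits-truth ρ h z x a a∉R t r))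
                                   (sym (isomorph-predict σ J c (query ρ h z x (t , r))))
      T₀-passes : Passes ρ h z x us answers T₀
      T₀-passes = T₀! , (begin
        2 * mismatches (prediction ρ h z x T₀) us answers   ≡⟨ cong (2 *_) (mismatches≡ T₀) ⟩
        2 * tally (miss T₀) us                              ≤⟨ ℕ.*-monoʳ-≤ 2 (tally-mono us (λ u → 𝟙-mono (¬? (prediction ρ h z x T₀ u Bool.≟ g (query ρ h z x u)))
                                                                 (¬? (g (query ρ h z x u) Bool.≟ f (query ρ h z x u))) (λ ne eq → ne (trans (prediction≡f u) (sym eq))))) ⟩
        2 * tally (λ u → err (query ρ h z x u)) us          ≤⟨ ℕ.≮⇒≥ ¬noisy ⟩
        3 * Q                                               ∎)
      decoded : ∀ T → Passes ρ h z x us answers T → T ≡ T₀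
      decoded T′ (T′! , few) = sym (decidable-stable (T₀ ≟ᵀ T′) (λ T₀≢T′ → ¬conf
        (lose {P = Confusable ρ h z x T₀ us} (∈-words T′ (λ i → ∈-literals _)) ((T₀! , T′! , T₀≢T′) , ℕ.*-cancelˡ-≤ 2 (begin
          2 * tally (λ u → 𝟙 (differ? ρ h z x T₀ T′ u)) us
            ≤⟨ ℕ.*-monoʳ-≤ 2 (tally-mono us (λ u → ≢-triangle (prediction ρ h z x T₀ u) (prediction ρ h z x T′ u) (g (query ρ h z x u)))) ⟩
          2 * tally (λ u → miss T₀ u + miss T′ u) us
            ≡⟨ trans (cong (2 *_) (tally-+ (miss T₀) (miss T′) us)) (ℕ.*-distribˡ-+ 2 (tally (miss T₀) us) (tally (miss T′) us)) ⟩
          2 * tally (miss T₀) us + 2 * tally (miss T′) us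
            ≡⟨ cong₂ (λ v w → 2 * v + 2 * w) (mismatches≡ T₀) (mismatches≡ T′) ⟨
          2 * mismatches (prediction ρ h z x T₀) us answers + 2 * mismatches (prediction ρ h z x T′) us answers
            ≤⟨ ℕ.+-mono-≤ (proj₂ T₀-passes) few ⟩
          3 * Q + 3 * Q
            ≡⟨ cong (3 * Q +_) (ℕ.+-identityʳ (3 * Q)) ⟨
          2 * (3 * Q) ∎)))))
      chosen : ∀ dec → choose ρ h z x us answers dec ≡ f x
      chosen (yes found) = trans (cong (λ y → predict {k} {m} c y ∣ x ∣)
        (trans (cong (inputBits ρ h z x) (decoded _ (proj₂ (Any.satisfied found)))) (inputBits-truth ρ h z x a)))
        (sym (isomorph-predict σ J c x))
      chosen (no ¬found) = contradiction (lose {P = Passes ρ h z x us answers} (∈-words T₀ (λ i → ∈-literals _)) T₀-passes) ¬found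

    failure : Seed → ℕ
    failure (ρ , h , us , z) = (𝟙 (hit? ρ) + 𝟙 (collision? h)) + (𝟙 (noisy? ρ h us z) + 𝟙 (confused? ρ h us z))

    success? : ∀ seed → Dec (NonAdaptiveAlgorithm.run (algorithm seed) g x ≡ f x)
    success? seed = NonAdaptiveAlgorithm.run (algorithm seed) g x Bool.≟ f x

    success+failure : ∀ seed → 1 ≤ℕ 𝟙 (success? seed) + failure seed
    success+failure seed@(ρ , h , us , z) = cases (hit? ρ) (collision? h) (noisy? ρ h us z) (confused? ρ h us z)
      where
      S = 𝟙 (success? seed)
      cases : (d₁ : Dec (Hit ρ)) (d₂ : Dec (Collision h)) (d₃ : Dec (Noisy ρ h us z)) (d₄ : Dec (Confused ρ h us z)) →
              1 ≤ℕ S + ((𝟙 d₁ + 𝟙 d₂) + (𝟙 d₃ + 𝟙 d₄))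
      cases (yes _)  _        _        _        = ℕ.≤-trans (s≤s z≤n) (ℕ.m≤n+m _ S)
      cases (no _)   (yes _)  _        _        = ℕ.≤-trans (s≤s z≤n) (ℕ.m≤n+m _ S)
      cases (no _)   (no _)   (yes _)  _        = ℕ.≤-trans (s≤s z≤n) (ℕ.m≤n+m _ S)
      cases (no _)   (no _)   (no _)   (yes _)  = ℕ.m≤n+m 1 S
      cases (no ¬p₁) (no ¬p₂) (no ¬p₃) (no ¬p₄) =
        ℕ.≤-trans (ℕ.≤-reflexive (sym (𝟙-yes (success? seed) (correct ρ h us z ¬p₁ ¬p₂ ¬p₃ ¬p₄)))) (ℕ.m≤m+n S 0)

    hit-rare : 12 * k ≤ℕ G → Rare 12 (allFin G) (λ ρ → 𝟙 (hit? ρ))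
    hit-rare 12k≤G = rare-mono {d = 12} (allFin G) (λ ρ → 𝟙-any≤∑ (λ i → T? (lookup (R ρ) (a i))) (allFin k))
      (union-bound {d = 12} (allFin k) (allFin G) (subst (λ v → 12 * v ≤ℕ G) (sym (length-allFin k)) 12k≤G) (λ i →
        ℕ.≤-trans (ℕ.*-monoʳ-≤ G (regions-disjoint G L rest n≡ (a i))) (ℕ.≤-reflexive (trans (ℕ.*-identityʳ G) (sym (length-allFin G))))))

    collisions-rare : 12 * (k * k) ≤ℕ s → Rare 12 (words (allFin s) n) (λ h → 𝟙 (collision? h))
    collisions-rare 12k²≤s = rare-mono {d = 12} hs (λ h → 𝟙-any≤∑ (collides? h) pairs)
      (union-bound {d = 12} pairs hs
        (subst (λ v → 12 * v ≤ℕ s) (sym (trans (length-product _,_ (allFin k) (allFin k)) (cong₂ _*_ (length-allFin k) (length-allFin k)))) 12k²≤s)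
        (λ ij → single ij (proj₁ ij Fin.≟ proj₂ ij)))
      where
      hs = words (allFin s) n
      pairs = cartesianProduct (allFin k) (allFin k)
      single : ∀ ij → Dec (proj₁ ij ≡ proj₂ ij) → Rare s hs (λ h → 𝟙 (collides? h ij))
      single ij@(i , j) (yes i≡j) = ℕ.≤-trans (ℕ.≤-reflexive (trans (cong (s *_)
        (∑-zero hs (λ h → 𝟙-no (collides? h ij) (λ coll → proj₁ coll i≡j)))) (ℕ.*-zeroʳ s))) z≤n
      single ij@(i , j) (no i≢j) = rare-mono {d = s} hs
        (λ h → 𝟙-mono (collides? h ij) (lookup h (a i) Fin.≟ lookup h (a j)) proj₂)
        (collision-rare {s} (a i) (a j) (i≢j ∘ place-injective σ J))

    noisy-rare : .{{_ : NonZero Q}} → 1000 * ∑ (points n) err ≤ℕ 2 ^ n → ∀ ρ h us → Rare 12 (points n) (λ z → 𝟙 (noisy? ρ h us z))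
    noisy-rare sparse ρ h us = rare-mono {d = 12} (points n) (λ z → ℕ.≤-reflexive
        (cong (λ w → 𝟙 (3 * Q <? 2 * w)) (sym (tally-map (λ m → err (z ⊕ m)) masked us))))
      (noise-rare (3 * Q) {{ℕ.m*n≢0 3 Q}} (ℕ.≤-reflexive (ℕ.*-assoc 40 3 Q)) err sparse (Vec.map masked us))
      where
      masked : Point d × Point n → Point n
      masked (t , r) = mask (zipWith label h x) (R ρ) t r

    failure-rare : .{{_ : NonZero Q}} → ¬ Any (Bad m L c) (params n d k) → 12 * k ≤ℕ G → 12 * (k * k) ≤ℕ s →
                   12 * length candidates ≤ℕ 2 ^ Q → 1000 * ∑ (points n) err ≤ℕ 2 ^ n → 3 * ∑ seeds failure ≤ℕ length seeds
    failure-rare good 12k≤G 12k²≤s few sparse = ℕ.*-cancelˡ-≤ 4 (begin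
      4 * (3 * ∑ seeds failure)                              ≡⟨ ℕ.*-assoc 4 3 (∑ seeds failure) ⟨
      12 * ∑ seeds failure                                   ≡⟨ cong (12 *_) (trans (∑-+ (λ w → A w + B w) (λ w → C w + D w) seeds) (cong₂ _+_ (∑-+ A B seeds) (∑-+ C D seeds))) ⟩
      12 * (∑ seeds A + ∑ seeds B + (∑ seeds C + ∑ seeds D)) ≡⟨ solve 4 (λ v w y z → con 12 :* (v :+ w :+ (y :+ z)) := con 12 :* v :+ (con 12 :* w :+ (con 12 :* y :+ con 12 :* z))) refl (∑ seeds A) (∑ seeds B) (∑ seeds C) (∑ seeds D) ⟩
      12 * ∑ seeds A + (12 * ∑ seeds B + (12 * ∑ seeds C + 12 * ∑ seeds D))
                                                             ≤⟨ ℕ.+-mono-≤ rareA (ℕ.+-mono-≤ rareB (ℕ.+-mono-≤ rareC rareD)) ⟩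
      S + (S + (S + S))                                      ≡⟨ solve 1 (λ v → v :+ (v :+ (v :+ v)) := con 4 :* v) refl S ⟩
      4 * S                                                  ∎)
      where
      open ℕ.≤-Reasoning
      open +-*-Solver
      S = length seeds
      hs = words (allFin s) n
      uss = words Ω q
      A B C D : Seed → ℕ
      A (ρ , h , us , z) = 𝟙 (hit? ρ)
      B (ρ , h , us , z) = 𝟙 (collision? h)
      C (ρ , h , us , z) = 𝟙 (noisy? ρ h us z)
      D (ρ , h , us , z) = 𝟙 (confused? ρ h us z)
      rareA : Rare 12 seeds A
      rareA = rare-×ˡ {d = 12} (allFin G) _ (λ _ → hit-rare 12k≤G)
      rareB : Rare 12 seeds B
      rareB = rare-×ʳ {d = 12} (allFin G) _ (λ _ → rare-×ˡ {d = 12} hs _ (λ _ → collisions-rare 12k²≤s))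
      -- The masks do not depend on `z`, so `z` can be averaged with everything else fixed.
      rareC : Rare 12 seeds C
      rareC = rare-×ʳ {d = 12} (allFin G) _ (λ ρ → rare-×ʳ {d = 12} hs _ (λ h → rare-×ʳ {d = 12} uss _ (λ us → noisy-rare sparse ρ h us)))
      -- The true candidate and `κ` do not depend on the samples `us`, so here `us` is averaged with
      -- `z` fixed.
      rareD : Rare 12 seeds D
      rareD = rare-×ʳ {d = 12} (allFin G) _ (λ ρ → rare-×ʳ {d = 12} hs _ (λ h → rare-×ˡ {d = 12} uss _
        (λ z → confusion-rare ρ h z x good few (truth ρ h z x a))))

    success-likely : .{{_ : NonZero Q}} → ¬ Any (Bad m L c) (params n d k) → 12 * k ≤ℕ G → 12 * (k * k) ≤ℕ s →
                     12 * length candidates ≤ℕ 2 ^ Q → 1000 * ∑ (points n) err ≤ℕ 2 ^ n →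
                     2 * length seeds ≤ℕ 3 * ∑ seeds (λ seed → 𝟙 (success? seed))
    success-likely good 12k≤G 12k²≤s few sparse = ℕ.+-cancelʳ-≤ (length seeds) _ _ (begin
      2 * length seeds + length seeds                     ≡⟨ solve 1 (λ v → con 2 :* v :+ v := con 3 :* v) refl (length seeds) ⟩
      3 * length seeds                                    ≡⟨ cong (3 *_) (length≡∑1 seeds) ⟩
      3 * ∑ seeds (λ _ → 1)                               ≤⟨ ℕ.*-monoʳ-≤ 3 (∑-mono seeds success+failure) ⟩
      3 * ∑ seeds (λ seed → 𝟙 (success? seed) + failure seed)
                                                          ≡⟨ cong (3 *_) (∑-+ (λ seed → 𝟙 (success? seed)) failure seeds) ⟩
      3 * (W + ∑ seeds failure)                           ≡⟨ ℕ.*-distribˡ-+ 3 W (∑ seeds failure) ⟩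
      3 * W + 3 * ∑ seeds failure                         ≤⟨ ℕ.+-monoʳ-≤ (3 * W) (failure-rare good 12k≤G 12k²≤s few sparse) ⟩
      3 * W + length seeds                                ∎)
      where
      open ℕ.≤-Reasoning
      open +-*-Solver
      W = ∑ seeds (λ seed → 𝟙 (success? seed))

-- Choice of parameters

log-bounds : ∀ b → 2 ≤ℕ b → ∀ N → ∃[ l ] (b ^ l ≤ℕ suc N × suc N <ℕ b ^ suc l)
log-bounds b 2≤b zero    = 0 , ℕ.≤-refl , subst (2 ≤ℕ_) (sym (ℕ.*-identityʳ b)) 2≤b
log-bounds b 2≤b (suc N) with log-bounds b 2≤b N
... | l , b^l≤ , <b^ with suc (suc N) <? b ^ suc l
...   | yes lt = l , ℕ.m≤n⇒m≤1+n b^l≤ , lt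
...   | no ≮ = suc l , ℕ.≮⇒≥ ≮ , ℕ.≤-<-trans <b^ (ℕ.^-monoʳ-< b 2≤b (ℕ.n<1+n (suc l)))

n<2^n : ∀ n → n <ℕ 2 ^ n
n<2^n zero    = s≤s z≤n
n<2^n (suc n) = ℕ.≤-trans (s≤s (n<2^n n)) (ℕ.≤-trans (ℕ.+-monoˡ-≤ (2 ^ n) (ℕ.m^n>0 2 n)) (ℕ.≤-reflexive (cong (2 ^ n +_) (sym (ℕ.+-identityʳ (2 ^ n))))))

2^-cancel-≤ : ∀ a b → 2 ^ a ≤ℕ 2 ^ b → a ≤ℕ b
2^-cancel-≤ a b le with a ≤? b
... | yes a≤b = a≤b
... | no a≰b = contradiction (ℕ.^-monoʳ-< 2 (s≤s (s≤s z≤n)) (ℕ.≰⇒> a≰b)) (ℕ.≤⇒≯ le)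

2^-cancel-< : ∀ a b → 2 ^ a <ℕ 2 ^ b → a <ℕ b
2^-cancel-< a b lt = ℕ.≰⇒> (λ b≤a → ℕ.<⇒≱ lt (ℕ.^-monoʳ-≤ 2 b≤a))

^4-cancel-≤ : ∀ a b → a ^ 4 ≤ℕ b ^ 4 → a ≤ℕ b
^4-cancel-≤ a b le with a ≤? b
... | yes a≤b = a≤b
... | no a≰b = contradiction (ℕ.^-monoˡ-< 4 (ℕ.≰⇒> a≰b)) (ℕ.≤⇒≯ le)

-- (1 + 1/k)^9 ≤ (4/3)^9 ≤ 16 for k ≥ 3.
k^9≤8*16^k : ∀ k → k ^ 9 ≤ℕ 8 * 16 ^ k
k^9≤8*16^k 0 = z≤n
k^9≤8*16^k 1 = ℕ.≤ᵇ⇒≤ 1 128 _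
k^9≤8*16^k 2 = ℕ.≤ᵇ⇒≤ (2 ^ 9) (8 * 16 ^ 2) _
k^9≤8*16^k 3 = ℕ.≤ᵇ⇒≤ (3 ^ 9) (8 * 16 ^ 3) _
k^9≤8*16^k (suc k@(suc (suc (suc _)))) = begin
  suc k ^ 9            ≤⟨ ℕ.*-cancelˡ-≤ (3 ^ 9) ratio ⟩
  16 * k ^ 9           ≤⟨ ℕ.*-monoʳ-≤ 16 (k^9≤8*16^k k) ⟩
  16 * (8 * 16 ^ k)    ≡⟨ solve 1 (λ x → con 16 :* (con 8 :* x) := con 8 :* (con 16 :* x)) refl (16 ^ k) ⟩
  8 * 16 ^ suc k       ∎
  where
  open ℕ.≤-Reasoning
  open +-*-Solver
  3[k+1]≤4k : 3 * suc k ≤ℕ 4 * k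
  3[k+1]≤4k = begin
    3 * suc k   ≡⟨ ℕ.*-suc 3 k ⟩
    3 + 3 * k   ≤⟨ ℕ.+-monoˡ-≤ (3 * k) (s≤s (s≤s (s≤s z≤n))) ⟩
    4 * k       ∎
  ratio : 3 ^ 9 * suc k ^ 9 ≤ℕ 3 ^ 9 * (16 * k ^ 9)
  ratio = begin
    3 ^ 9 * suc k ^ 9        ≡⟨ ^-distribʳ-* 3 (suc k) 9 ⟨
    (3 * suc k) ^ 9          ≤⟨ ℕ.^-monoˡ-≤ 9 3[k+1]≤4k ⟩
    (4 * k) ^ 9              ≡⟨ ^-distribʳ-* 4 k 9 ⟩
    4 ^ 9 * k ^ 9            ≤⟨ ℕ.*-monoˡ-≤ (k ^ 9) (ℕ.≤ᵇ⇒≤ (4 ^ 9) (3 ^ 9 * 16) _) ⟩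
    3 ^ 9 * 16 * k ^ 9       ≡⟨ ℕ.*-assoc (3 ^ 9) 16 (k ^ 9) ⟩
    3 ^ 9 * (16 * k ^ 9)     ∎

-- (1 + 1/(Λ+1))^4 ≤ (7/6)^4 ≤ 2 for Λ ≥ 5.
quartic≤exponential : ∀ c B o → 5 ≤ℕ B → c * suc B ^ 4 ≤ℕ 2 ^ B → c * suc (B + o) ^ 4 ≤ℕ 2 ^ (B + o)
quartic≤exponential c B zero    5≤B base rewrite ℕ.+-identityʳ B = base
quartic≤exponential c B (suc o) 5≤B base rewrite ℕ.+-suc B o = begin
  c * suc (suc Λ) ^ 4        ≤⟨ ℕ.*-monoʳ-≤ c (ℕ.*-cancelˡ-≤ (6 ^ 4) ratio) ⟩
  c * (2 * suc Λ ^ 4)        ≡⟨ solve 2 (λ x y → x :* (con 2 :* y) := con 2 :* (x :* y)) refl c (suc Λ ^ 4) ⟩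
  2 * (c * suc Λ ^ 4)        ≤⟨ ℕ.*-monoʳ-≤ 2 (quartic≤exponential c B o 5≤B base) ⟩
  2 ^ suc Λ                  ∎
  where
  open ℕ.≤-Reasoning
  open +-*-Solver
  Λ = B + o
  6[Λ+2]≤7[Λ+1] : 6 * suc (suc Λ) ≤ℕ 7 * suc Λ
  6[Λ+2]≤7[Λ+1] = begin
    6 * suc (suc Λ)       ≡⟨ ℕ.*-suc 6 (suc Λ) ⟩
    6 + 6 * suc Λ         ≤⟨ ℕ.+-monoˡ-≤ (6 * suc Λ) (s≤s (ℕ.≤-trans 5≤B (ℕ.m≤m+n B o))) ⟩
    7 * suc Λ             ∎
  ratio : 6 ^ 4 * suc (suc Λ) ^ 4 ≤ℕ 6 ^ 4 * (2 * suc Λ ^ 4)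
  ratio = begin
    6 ^ 4 * suc (suc Λ) ^ 4     ≡⟨ ^-distribʳ-* 6 (suc (suc Λ)) 4 ⟨
    (6 * suc (suc Λ)) ^ 4       ≤⟨ ℕ.^-monoˡ-≤ 4 6[Λ+2]≤7[Λ+1] ⟩
    (7 * suc Λ) ^ 4             ≡⟨ ^-distribʳ-* 7 (suc Λ) 4 ⟩
    7 ^ 4 * suc Λ ^ 4           ≤⟨ ℕ.*-monoˡ-≤ (suc Λ ^ 4) (ℕ.≤ᵇ⇒≤ (7 ^ 4) (6 ^ 4 * 2) _) ⟩
    6 ^ 4 * 2 * suc Λ ^ 4       ≡⟨ ℕ.*-assoc (6 ^ 4) 2 (suc Λ ^ 4) ⟩
    6 ^ 4 * (2 * suc Λ ^ 4)     ∎

-- Fourth powers are compared because ζ enters through 16^ζ ≥ n / (256 k). The k in this quotient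
-- turns k⁸ into k⁹, whence `k^9≤8*16^k` and the factors 256 and 8 in the hypothesis on `n`.
polynomial≤exponential : ∀ c k ℓ ζ n → 1 ≤ℕ k → c ^ 4 * 256 * 8 * ℓ ^ 4 ≤ℕ n → n ≤ℕ 256 * k * 16 ^ ζ →
                         c * (k * k * ℓ) ≤ℕ 2 ^ (k + ζ)
polynomial≤exponential c k ℓ ζ n 1≤k large n≤ = ^4-cancel-≤ _ _ (ℕ.*-cancelʳ-≤ _ _ (256 * k) {{nz}} (begin
  (c * (k * k * ℓ)) ^ 4 * (256 * k)
    ≡⟨ solve 4 (λ x κ λ' y → (x :* (κ :* κ :* λ')) :^ 4 :* (y :* κ) := x :^ 4 :* y :* λ' :^ 4 :* κ :^ 9) refl c k ℓ 256 ⟩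
  c ^ 4 * 256 * ℓ ^ 4 * k ^ 9
    ≤⟨ ℕ.*-monoʳ-≤ (c ^ 4 * 256 * ℓ ^ 4) (k^9≤8*16^k k) ⟩
  c ^ 4 * 256 * ℓ ^ 4 * (8 * 16 ^ k)
    ≡⟨ solve 4 (λ x y z w → x :* y :* (z :* w) := x :* z :* y :* w) refl (c ^ 4 * 256) (ℓ ^ 4) 8 (16 ^ k) ⟩
  c ^ 4 * 256 * 8 * ℓ ^ 4 * 16 ^ k
    ≤⟨ ℕ.*-monoˡ-≤ (16 ^ k) (ℕ.≤-trans large n≤) ⟩
  256 * k * 16 ^ ζ * 16 ^ k
    ≡⟨ solve 3 (λ x y z → x :* y :* z := z :* y :* x) refl (256 * k) (16 ^ ζ) (16 ^ k) ⟩
  16 ^ k * 16 ^ ζ * (256 * k)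
    ≡⟨ cong (_* (256 * k)) (trans (sym (ℕ.^-distribˡ-+-* 16 k ζ)) (trans (ℕ.^-*-assoc 2 4 (k + ζ)) (trans (cong (2 ^_) (ℕ.*-comm 4 (k + ζ))) (sym (ℕ.^-*-assoc 2 (k + ζ) 4))))) ⟩
  (2 ^ (k + ζ)) ^ 4 * (256 * k) ∎))
  where
  open ℕ.≤-Reasoning
  open +-*-Solver
  nz : NonZero (256 * k)
  nz = >-nonZero (ℕ.*-mono-≤ {1} {256} (s≤s z≤n) 1≤k)

-- Here `l` is the integer part of log₂ k, and `K` is the power of two with k < K ≤ 2k, so that 2d =
-- 2^w and the number of candidates is a power of two as well. The factor 16 makes `G` and `s` at
-- least 12k and 12k², as the failure probabilities 1/12 require, and the 4 in `Q` covers the factor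
-- 12 in `few-candidates`.
module Parameters (n k l : ℕ) (1≤k : 1 ≤ℕ k) (2^l≤k : 2 ^ l ≤ℕ k) (k<2^[1+l] : k <ℕ 2 ^ suc l) where

  K G s d w Q : ℕ
  K = 2 ^ suc l
  G = 16 * K
  s = 16 * (K * K)
  d = s * 2
  w = 8 + (l + l)
  Q = 4 + w * k

  instance
    G≢0 : NonZero G
    G≢0 = ℕ.m*n≢0 16 K {{_}} {{ℕ.m^n≢0 2 (suc l)}}

    s≢0 : NonZero s
    s≢0 = ℕ.m*n≢0 16 (K * K) {{_}} {{ℕ.m*n≢0 K K {{ℕ.m^n≢0 2 (suc l)}} {{ℕ.m^n≢0 2 (suc l)}}}}

  L rest : ℕ
  L = n /ℕ G
  rest = n %ℕ G

  open ℕ.≤-Reasoning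
  open +-*-Solver

  k≤K : k ≤ℕ K
  k≤K = ℕ.<⇒≤ k<2^[1+l]

  K≤2k : K ≤ℕ 2 * k
  K≤2k = ℕ.*-monoʳ-≤ 2 2^l≤k

  n≡ : G * L + rest ≡ n
  n≡ = trans (ℕ.+-comm (G * L) rest) (trans (cong (rest +_) (ℕ.*-comm G L)) (sym (m≡m%n+[m/n]*n n G)))

  12k≤G : 12 * k ≤ℕ G
  12k≤G = ℕ.*-mono-≤ (ℕ.m≤m+n 12 4) k≤K

  12k²≤s : 12 * (k * k) ≤ℕ s
  12k²≤s = ℕ.*-mono-≤ (ℕ.m≤m+n 12 4) (ℕ.*-mono-≤ k≤K k≤K)

  2d≡2^w : d * 2 ≡ 2 ^ w
  2d≡2^w = begin-equality
    16 * (2 * 2 ^ l * (2 * 2 ^ l)) * 2 * 2   ≡⟨ solve 1 (λ x → con 16 :* (con 2 :* x :* (con 2 :* x)) :* con 2 :* con 2 := con 256 :* (x :* x)) refl (2 ^ l) ⟩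
    256 * (2 ^ l * 2 ^ l)                    ≡⟨ cong (256 *_) (ℕ.^-distribˡ-+-* 2 l l) ⟨
    2 ^ 8 * 2 ^ (l + l)                      ≡⟨ ℕ.^-distribˡ-+-* 2 8 (l + l) ⟨
    2 ^ w                                    ∎

  [2d]^k≡2^wk : (d * 2) ^ k ≡ 2 ^ (w * k)
  [2d]^k≡2^wk = trans (cong (_^ k) 2d≡2^w) (ℕ.^-*-assoc 2 w k)

  few-candidates : 12 * length (words (literals d) k) ≤ℕ 2 ^ Q
  few-candidates = begin
    12 * length (words (literals d) k)   ≡⟨ cong (12 *_) (trans (length-words (literals d) k) (trans (cong (_^ k) (length-literals d)) [2d]^k≡2^wk)) ⟩
    12 * 2 ^ (w * k)                     ≤⟨ ℕ.*-monoˡ-≤ (2 ^ (w * k)) (ℕ.m≤m+n 12 4) ⟩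
    2 ^ 4 * 2 ^ (w * k)                  ≡⟨ ℕ.^-distribˡ-+-* 2 4 (w * k) ⟨
    2 ^ Q                                ∎

  d≤128k² : d ≤ℕ 128 * (k * k)
  d≤128k² = begin
    16 * (K * K) * 2                 ≤⟨ ℕ.*-monoˡ-≤ 2 (ℕ.*-monoʳ-≤ 16 (ℕ.*-mono-≤ K≤2k K≤2k)) ⟩
    16 * (2 * k * (2 * k)) * 2       ≡⟨ solve 1 (λ x → con 16 :* (con 2 :* x :* (con 2 :* x)) :* con 2 := con 128 :* (x :* x)) refl k ⟩
    128 * (k * k)                    ∎

  l≤k : l ≤ℕ k
  l≤k = ℕ.≤-trans (ℕ.<⇒≤ (n<2^n l)) 2^l≤k

  k≤k² : k ≤ℕ k * k
  k≤k² = subst (_≤ℕ k * k) (ℕ.*-identityʳ k) (ℕ.*-monoʳ-≤ k 1≤k)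

  k<d : suc k ≤ℕ d
  k<d = begin
    suc k             ≤⟨ k<2^[1+l] ⟩
    K                 ≤⟨ ℕ.m≤m*n K K {{ℕ.m^n≢0 2 (suc l)}} ⟩
    K * K             ≤⟨ ℕ.m≤n*m (K * K) 16 ⟩
    s                 ≤⟨ ℕ.m≤m*n s 2 ⟩
    d                 ∎

  -- Meant for the largest ζ with 16^ζ ≤ 2L + 1: its maximality becomes a lower bound for 16^ζ in
  -- terms of n / k.
  n≤256k16^ζ : ∀ ζ → suc (L + L) <ℕ 16 ^ suc ζ → n ≤ℕ 256 * k * 16 ^ ζ
  n≤256k16^ζ ζ 2L+1< = begin
    n                                ≡⟨ n≡ ⟨
    G * L + rest                     ≤⟨ ℕ.+-monoʳ-≤ (G * L) (ℕ.<⇒≤ (m%n<n n G)) ⟩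
    16 * K * L + 16 * K              ≡⟨ solve 2 (λ κ x → con 16 :* κ :* x :+ con 16 :* κ := con 8 :* κ :* (con 2 :+ (x :+ x))) refl K L ⟩
    8 * K * suc (suc (L + L))        ≤⟨ ℕ.*-mono-≤ (ℕ.*-monoʳ-≤ 8 K≤2k) 2L+1< ⟩
    8 * (2 * k) * 16 ^ suc ζ         ≡⟨ solve 2 (λ κ x → con 8 :* (con 2 :* κ) :* (con 16 :* x) := con 256 :* κ :* x) refl k (16 ^ ζ) ⟩
    256 * k * 16 ^ ζ                 ∎

  L≤n∸k : L ≤ℕ n ∸ k
  L≤n∸k with L ≟ℕ 0
  ... | yes L≡0 = subst (_≤ℕ n ∸ k) (sym L≡0) z≤n
  ... | no L≢0 = ℕ.m+n≤o⇒m≤o∸n L (begin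
    L + k                        ≤⟨ ℕ.+-mono-≤ (ℕ.m≤n*m L k {{>-nonZero 1≤k}}) (ℕ.m≤m*n k L {{≢-nonZero L≢0}}) ⟩
    k * L + k * L                ≤⟨ ℕ.+-mono-≤ (ℕ.*-monoˡ-≤ L k≤K) (ℕ.*-monoˡ-≤ L k≤K) ⟩
    K * L + K * L                ≤⟨ ℕ.m≤m+n _ (14 * (K * L)) ⟩
    K * L + K * L + 14 * (K * L) ≡⟨ solve 2 (λ κ x → κ :* x :+ κ :* x :+ con 14 :* (κ :* x) := con 16 :* κ :* x) refl K L ⟩
    G * L                        ≤⟨ ℕ.m≤m+n (G * L) rest ⟩
    G * L + rest                 ≡⟨ n≡ ⟩
    n                            ∎)

  -- In units of X = k² ℓ the exponent on the left is at most 1 for `suc n`, 10 for each of the two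
  -- candidates and 256 for the table, in total 277. The 32 is the 2^5 from `k + ζ ≡ 5 + e`. The
  -- factor `suc n` is what makes the exceptional fraction at most 1/(n+1).
  params-fit : ∀ c ζ e ℓ → 32 * 277 ≤ℕ c → 1 ≤ℕ ℓ → k + ζ ≡ 5 + e → suc n ≤ℕ 2 ^ ℓ → c * (k * k * ℓ) ≤ℕ 2 ^ (k + ζ) →
               suc n * length (params n d k) ≤ℕ 2 ^ (2 ^ e)
  params-fit c ζ e ℓ c-large 1≤ℓ k+ζ≡ n<2^ℓ small = begin
    suc n * length (params n d k)
      ≡⟨ cong (suc n *_) (length-params n d k) ⟩
    suc n * ((d * 2) ^ k * (d * 2) ^ k * (suc n * suc n) ^ d)
      ≤⟨ ℕ.*-mono-≤ n<2^ℓ (ℕ.*-monoʳ-≤ ((d * 2) ^ k * (d * 2) ^ k) (ℕ.^-monoˡ-≤ d (ℕ.*-mono-≤ n<2^ℓ n<2^ℓ))) ⟩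
    2 ^ ℓ * ((d * 2) ^ k * (d * 2) ^ k * (2 ^ ℓ * 2 ^ ℓ) ^ d)
      ≡⟨ cong₂ (λ x y → 2 ^ ℓ * (x * x * y)) [2d]^k≡2^wk (trans (cong (_^ d) (sym (ℕ.^-distribˡ-+-* 2 ℓ ℓ))) (ℕ.^-*-assoc 2 (ℓ + ℓ) d)) ⟩
    2 ^ ℓ * (2 ^ (w * k) * 2 ^ (w * k) * 2 ^ ((ℓ + ℓ) * d))
      ≡⟨ cong (λ x → 2 ^ ℓ * (x * 2 ^ ((ℓ + ℓ) * d))) (ℕ.^-distribˡ-+-* 2 (w * k) (w * k)) ⟨
    2 ^ ℓ * (2 ^ (w * k + w * k) * 2 ^ ((ℓ + ℓ) * d))
      ≡⟨ cong (2 ^ ℓ *_) (ℕ.^-distribˡ-+-* 2 (w * k + w * k) ((ℓ + ℓ) * d)) ⟨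
    2 ^ ℓ * 2 ^ (w * k + w * k + (ℓ + ℓ) * d)
      ≡⟨ ℕ.^-distribˡ-+-* 2 ℓ _ ⟨
    2 ^ (ℓ + (w * k + w * k + (ℓ + ℓ) * d))
      ≤⟨ ℕ.^-monoʳ-≤ 2 {ℓ + (w * k + w * k + (ℓ + ℓ) * d)} {2 ^ e} (ℕ.*-cancelˡ-≤ 32 exponent) ⟩
    2 ^ (2 ^ e) ∎
    where
    X = k * k * ℓ
    k²≤X : k * k ≤ℕ X
    k²≤X = ℕ.m≤m*n (k * k) ℓ {{>-nonZero 1≤ℓ}}
    wk≤ : w * k ≤ℕ 10 * X
    wk≤ = begin
      (8 + (l + l)) * k              ≤⟨ ℕ.*-monoˡ-≤ k (ℕ.+-monoʳ-≤ 8 (ℕ.+-mono-≤ l≤k l≤k)) ⟩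
      (8 + (k + k)) * k              ≡⟨ solve 1 (λ x → (con 8 :+ (x :+ x)) :* x := con 8 :* x :+ con 2 :* (x :* x)) refl k ⟩
      8 * k + 2 * (k * k)            ≤⟨ ℕ.+-monoˡ-≤ (2 * (k * k)) (ℕ.*-monoʳ-≤ 8 k≤k²) ⟩
      8 * (k * k) + 2 * (k * k)      ≡⟨ solve 1 (λ x → con 8 :* x :+ con 2 :* x := con 10 :* x) refl (k * k) ⟩
      10 * (k * k)                   ≤⟨ ℕ.*-monoʳ-≤ 10 k²≤X ⟩
      10 * X                         ∎
    2ℓd≤ : (ℓ + ℓ) * d ≤ℕ 256 * X
    2ℓd≤ = begin
      (ℓ + ℓ) * d                    ≤⟨ ℕ.*-monoʳ-≤ (ℓ + ℓ) d≤128k² ⟩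
      (ℓ + ℓ) * (128 * (k * k))      ≡⟨ solve 2 (λ x y → (x :+ x) :* (con 128 :* y) := con 256 :* (y :* x)) refl ℓ (k * k) ⟩
      256 * X                        ∎
    ℓ≤ : ℓ ≤ℕ 1 * X
    ℓ≤ = subst (ℓ ≤ℕ_) (sym (ℕ.*-identityˡ X)) (ℕ.m≤n*m ℓ (k * k) {{ℕ.m*n≢0 k k {{>-nonZero 1≤k}} {{>-nonZero 1≤k}}}})
    exponent : 32 * (ℓ + (w * k + w * k + (ℓ + ℓ) * d)) ≤ℕ 32 * 2 ^ e
    exponent = begin
      32 * (ℓ + (w * k + w * k + (ℓ + ℓ) * d))        ≤⟨ ℕ.*-monoʳ-≤ 32 (ℕ.+-mono-≤ ℓ≤ (ℕ.+-mono-≤ (ℕ.+-mono-≤ wk≤ wk≤) 2ℓd≤)) ⟩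
      32 * (1 * X + (10 * X + 10 * X + 256 * X))      ≡⟨ cong (32 *_) (solve 1 (λ x → con 1 :* x :+ (con 10 :* x :+ con 10 :* x :+ con 256 :* x) := con 277 :* x) refl X) ⟩
      32 * (277 * X)                                  ≡⟨ ℕ.*-assoc 32 277 X ⟨
      32 * 277 * X                                    ≤⟨ ℕ.*-monoˡ-≤ X c-large ⟩
      c * X                                           ≤⟨ small ⟩
      2 ^ (k + ζ)                                     ≡⟨ cong (2 ^_) k+ζ≡ ⟩
      2 ^ (5 + e)                                     ≡⟨ ℕ.^-distribˡ-+-* 2 5 e ⟩
      32 * 2 ^ e                                      ∎

  queries≤ : 1 ≤ℕ l → 120 * Q ≤ℕ 1680 * (k * l)
  queries≤ 1≤l = begin
    120 * (4 + (8 + (l + l)) * k)         ≡⟨ cong (120 *_) (solve 2 (λ x y → con 4 :+ (con 8 :+ (x :+ x)) :* y := con 4 :+ con 8 :* y :+ con 2 :* (y :* x)) refl l k) ⟩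
    120 * (4 + 8 * k + 2 * (k * l))       ≤⟨ ℕ.*-monoʳ-≤ 120 (ℕ.+-monoˡ-≤ (2 * (k * l)) (ℕ.+-mono-≤ (ℕ.*-monoʳ-≤ 4 (ℕ.*-mono-≤ 1≤k 1≤l)) (ℕ.*-monoʳ-≤ 8 (ℕ.m≤m*n k l {{>-nonZero 1≤l}})))) ⟩
    120 * (4 * (k * l) + 8 * (k * l) + 2 * (k * l))
                                          ≡⟨ cong (120 *_) (solve 1 (λ x → con 4 :* x :+ con 8 :* x :+ con 2 :* x := con 14 :* x) refl (k * l)) ⟩
    120 * (14 * (k * l))                  ≡⟨ ℕ.*-assoc 120 14 (k * l) ⟨
    1680 * (k * l)                        ∎

suc-2ζ≤16^ζ : ∀ ζ → suc (ζ + ζ) ≤ℕ 16 ^ ζ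
suc-2ζ≤16^ζ zero    = ℕ.≤-refl
suc-2ζ≤16^ζ (suc ζ) = begin
  suc (suc ζ + suc ζ)          ≡⟨ cong (2 +_) (ℕ.+-suc ζ ζ) ⟩
  2 + suc (ζ + ζ)              ≤⟨ ℕ.+-mono-≤ (ℕ.*-monoʳ-≤ 2 (ℕ.m^n>0 16 ζ)) (suc-2ζ≤16^ζ ζ) ⟩
  2 * 16 ^ ζ + 16 ^ ζ          ≡⟨ solve 1 (λ x → con 2 :* x :+ x := con 3 :* x) refl (16 ^ ζ) ⟩
  3 * 16 ^ ζ                   ≤⟨ ℕ.*-monoˡ-≤ (16 ^ ζ) (ℕ.m≤m+n 3 13) ⟩
  16 ^ suc ζ                   ∎
  where open ℕ.≤-Reasoning
        open +-*-Solver

quartic≤linear : ∀ B N₁ Λ n → 1 ≤ℕ B → 5 ≤ℕ N₁ → 2 * B * suc N₁ ^ 4 ≤ℕ 2 ^ N₁ → N₁ ≤ℕ Λ → 2 ^ Λ ≤ℕ suc n → B * suc Λ ^ 4 ≤ℕ n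
quartic≤linear B N₁ Λ n 1≤B 5≤N₁ base N₁≤Λ 2^Λ≤ with o , refl ← ℕ.m≤n⇒∃[o]m+o≡n N₁≤Λ = ℕ.≤-pred (begin
  1 + B * suc Λ ^ 4                    ≤⟨ ℕ.+-monoˡ-≤ (B * suc Λ ^ 4) (ℕ.*-mono-≤ {1} {B} 1≤B (ℕ.m^n>0 (suc Λ) 4)) ⟩
  B * suc Λ ^ 4 + B * suc Λ ^ 4        ≡⟨ solve 2 (λ b x → b :* x :+ b :* x := con 2 :* b :* x) refl B (suc Λ ^ 4) ⟩
  2 * B * suc Λ ^ 4                    ≤⟨ quartic≤exponential (2 * B) N₁ o 5≤N₁ base ⟩
  2 ^ Λ                                ≤⟨ 2^Λ≤ ⟩
  suc n                                ∎)
  where open ℕ.≤-Reasoning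
        open +-*-Solver

-- With these inequalities c k² log₂ n ≤ 2^(k+ζ) for all n ≥ 2^N₁, which pays for the union bound.
Threshold : ℕ → ℕ → Set
Threshold c N₁ = 32 * 277 ≤ℕ c × 5 ≤ℕ N₁ × 2 * (c ^ 4 * 256 * 8) * suc N₁ ^ 4 ≤ℕ 2 ^ N₁

-- 2^14 is the least power of two above 32 * 277 = 8864. The last condition then reads 2^68 * 101^4
-- ≤ 2^100, where 101^4 < 2^27.
threshold : ∃[ c ] ∃[ N₁ ] Threshold c N₁
threshold = 2 ^ 14 , 100 , ℕ.≤ᵇ⇒≤ (32 * 277) (2 ^ 14) _ , ℕ.≤ᵇ⇒≤ 5 100 _ , ℕ.≤ᵇ⇒≤ (2 * ((2 ^ 14) ^ 4 * 256 * 8) * 101 ^ 4) (2 ^ 100) _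

-- Here Λ is the integer part of log₂ (n+1), and ζ the largest exponent with 16^ζ ≤ 2L + 1. The
-- inequality c k² (Λ+1) ≤ 2^(k+ζ) holds for all k at once: large k is paid for by 2^k and small k
-- by (n/k)^(1/4).
exceptional-rare-large : ∀ c N₁ → Threshold c N₁ → ∀ n k l → 2 ^ N₁ ≤ℕ n →
                         (1≤k : 1 ≤ℕ k) (2^l≤k : 2 ^ l ≤ℕ k) (k<2^[1+l] : k <ℕ 2 ^ suc l) →
                         let open Parameters n k l 1≤k 2^l≤k k<2^[1+l] in ∀ m → L ≤ℕ m →
                         Rare (suc n) (points (2 ^ k * suc m)) (λ c → 𝟙 (exceptional? {k} n d m L c))
exceptional-rare-large c N₁ (c-large , 5≤N₁ , base) n k l n-large 1≤k 2^l≤k k<2^[1+l] m L≤m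
  with Λ , 2^Λ≤ , <2^ ← log-bounds 2 (s≤s (s≤s z≤n)) n
     | ζ , 16^ζ≤ , <16^ ← log-bounds 16 (s≤s (s≤s z≤n)) (Parameters.L n k l 1≤k 2^l≤k k<2^[1+l] + Parameters.L n k l 1≤k 2^l≤k k<2^[1+l]) =
  exceptional-rare {k} n d m L ζ e μ (suc n) L≤m
    (λ j → binomial-anticoncentration L ζ j (subst (_≤ℕ suc (L + L)) 16^ζ≡ 16^ζ≤))
    k+ζ≡ d+L≡ 2≤μ (params-fit c ζ e (suc Λ) c-large (s≤s z≤n) k+ζ≡ (ℕ.<⇒≤ <2^) small)
  where
  open Parameters n k l 1≤k 2^l≤k k<2^[1+l]
  open ℕ.≤-Reasoning
  16^ζ≡ : 16 ^ ζ ≡ (2 ^ ζ) ^ 4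
  16^ζ≡ = trans (ℕ.^-*-assoc 2 4 ζ) (trans (cong (2 ^_) (ℕ.*-comm 4 ζ)) (sym (ℕ.^-*-assoc 2 ζ 4)))
  32≤c : 2 ^ 5 ≤ℕ c
  32≤c = ℕ.≤-trans (ℕ.m≤m*n 32 277) c-large
  instance
    c≢0 : NonZero c
    c≢0 = >-nonZero (ℕ.≤-trans (s≤s z≤n) 32≤c)
    k²Λ≢0 : NonZero (k * k * suc Λ)
    k²Λ≢0 = ℕ.m*n≢0 (k * k) (suc Λ) {{ℕ.m*n≢0 k k {{>-nonZero 1≤k}} {{>-nonZero 1≤k}}}}
  1≤B : 1 ≤ℕ c ^ 4 * 256 * 8
  1≤B = ℕ.*-mono-≤ {1} {c ^ 4 * 256} {1} {8} (ℕ.*-mono-≤ {1} {c ^ 4} {1} {256} (ℕ.m^n>0 c 4) (s≤s z≤n)) (s≤s z≤n)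
  N₁≤Λ : N₁ ≤ℕ Λ
  N₁≤Λ = ℕ.≤-pred (2^-cancel-< N₁ (suc Λ) (ℕ.≤-<-trans n-large (ℕ.<-trans (ℕ.n<1+n n) <2^)))
  small : c * (k * k * suc Λ) ≤ℕ 2 ^ (k + ζ)
  small = polynomial≤exponential c k (suc Λ) ζ n 1≤k (quartic≤linear (c ^ 4 * 256 * 8) N₁ Λ n 1≤B 5≤N₁ base N₁≤Λ 2^Λ≤) (n≤256k16^ζ ζ <16^)
  5≤k+ζ : 5 ≤ℕ k + ζ
  5≤k+ζ = 2^-cancel-≤ 5 (k + ζ) (ℕ.≤-trans 32≤c (ℕ.≤-trans (ℕ.m≤m*n c (k * k * suc Λ)) small))
  e : ℕ
  e = k + ζ ∸ 5
  k+ζ≡ : k + ζ ≡ 5 + e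
  k+ζ≡ = sym (ℕ.m+[n∸m]≡n 5≤k+ζ)
  ζ≤L : ζ ≤ℕ L
  ζ≤L = ℕ.≮⇒≥ (λ L<ζ → ℕ.<⇒≱ (ℕ.+-mono-< L<ζ L<ζ) (ℕ.≤-pred (ℕ.≤-trans (suc-2ζ≤16^ζ ζ) 16^ζ≤)))
  μ : ℕ
  μ = d + L ∸ (4 + e)
  -- From d > k and L ≥ ζ follows d + L ≥ k + ζ + 1 = 6 + e, which is the slack behind `2 ≤ μ`.
  2+4+e≤d+L : 2 + (4 + e) ≤ℕ d + L
  2+4+e≤d+L = begin
    suc (5 + e)   ≡⟨ cong suc k+ζ≡ ⟨
    suc (k + ζ)   ≤⟨ ℕ.+-mono-≤ k<d ζ≤L ⟩
    d + L         ∎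
  d+L≡ : d + L ≡ 4 + e + μ
  d+L≡ = sym (ℕ.m+[n∸m]≡n (ℕ.≤-trans (ℕ.m≤n+m (4 + e) 2) 2+4+e≤d+L))
  2≤μ : 2 ≤ℕ μ
  2≤μ = subst (_≤ℕ μ) (ℕ.m+n∸n≡m 2 (4 + e)) (ℕ.∸-monoˡ-≤ (4 + e) 2+4+e≤d+L)

-- Rational probabilities and assembly of the theorem

/-≤ : ∀ a b c d .{{_ : NonZero b}} .{{_ : NonZero d}} → a * d ≤ℕ c * b → (ℤ.+ a /ℚ b) ≤ℚ (ℤ.+ c /ℚ d)
/-≤ a (suc b) c (suc d) le = *≤* (subst₂ ℤ._≤_ (ℤ.pos-* a (suc d)) (ℤ.pos-* c (suc b)) (ℤ.+≤+ le))

/-≤⁻¹ : ∀ a b c d .{{_ : NonZero b}} .{{_ : NonZero d}} → (ℤ.+ a /ℚ b) ≤ℚ (ℤ.+ c /ℚ d) → a * d ≤ℕ c * b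
/-≤⁻¹ a (suc b) c (suc d) (*≤* le) = ℤ.drop‿+≤+ (subst₂ ℤ._≤_ (sym (ℤ.pos-* a (suc d))) (sym (ℤ.pos-* c (suc b))) le)

Pr-≤ : {A : Set} {P : A → Set} (xs : List⁺ A) (P? : ∀ x → Dec (P x)) (a b : ℕ) .{{_ : NonZero b}} →
       b * ∑ (toList xs) (λ x → 𝟙 (P? x)) ≤ℕ a * length (toList xs) → Pr xs P? ≤ℚ (ℤ.+ a /ℚ b)
Pr-≤ xs P? a b le = /-≤ (length (filter P? (toList xs))) (List⁺.length xs) a b
  (subst (_≤ℕ a * List⁺.length xs) (trans (ℕ.*-comm b _) (cong (_* b) (sym (length-filter P? (toList xs))))) le)

Pr-≤⁻¹ : {A : Set} {P : A → Set} (xs : List⁺ A) (P? : ∀ x → Dec (P x)) (a b : ℕ) .{{_ : NonZero b}} →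
         Pr xs P? ≤ℚ (ℤ.+ a /ℚ b) → b * ∑ (toList xs) (λ x → 𝟙 (P? x)) ≤ℕ a * length (toList xs)
Pr-≤⁻¹ xs P? a b le = subst (_≤ℕ a * length (toList xs)) (trans (ℕ.*-comm _ b) (cong (b *_) (length-filter P? (toList xs))))
  (/-≤⁻¹ (length (filter P? (toList xs))) (List⁺.length xs) a b le)

≤-Pr : {A : Set} {P : A → Set} (xs : List⁺ A) (P? : ∀ x → Dec (P x)) (a b : ℕ) .{{_ : NonZero b}} →
       a * length (toList xs) ≤ℕ b * ∑ (toList xs) (λ x → 𝟙 (P? x)) → (ℤ.+ a /ℚ b) ≤ℚ Pr xs P?
≤-Pr xs P? a b le = /-≤ a b (length (filter P? (toList xs))) (List⁺.length xs)
  (subst (a * List⁺.length xs ≤ℕ_) (trans (ℕ.*-comm b _) (cong (_* b) (sym (length-filter P? (toList xs))))) le)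

nonempty : {A : Set} (xs : List A) → length xs ≢ 0 → Σ[ ys ∈ List⁺ A ] toList ys ≡ xs
nonempty []       len≢0 = contradiction refl len≢0
nonempty (x ∷ xs) _     = (x ∷ xs) , refl

module _ {n : ℕ} (J : Subset n) (c : Core ∣ J ∣ ∣ ∁ J ∣) (s G L rest Q : ℕ) (n≡ : G * L + rest ≡ n)
         .{{_ : NonZero s}} .{{_ : NonZero G}} .{{_ : NonZero Q}} where

  open Corrector J c s G L rest Q n≡

  seeds≢[] : length seeds ≢ 0
  seeds≢[] = ≢-nonZero⁻¹ (length seeds) {{subst NonZero (sym length-seeds) nz}}
    where
    instance
      2^n≢0 : NonZero (2 ^ n)
      2^n≢0 = ℕ.m^n≢0 2 n
      hashes≢0 : NonZero (s ^ n)
      hashes≢0 = ℕ.m^n≢0 s n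
      Ω≢0 : NonZero (2 ^ d * 2 ^ n)
      Ω≢0 = ℕ.m*n≢0 (2 ^ d) (2 ^ n) {{ℕ.m^n≢0 2 d}}
      Ω^q≢0 : NonZero ((2 ^ d * 2 ^ n) ^ q)
      Ω^q≢0 = ℕ.m^n≢0 (2 ^ d * 2 ^ n) q
      Ω^q*2^n≢0 : NonZero ((2 ^ d * 2 ^ n) ^ q * 2 ^ n)
      Ω^q*2^n≢0 = ℕ.m*n≢0 ((2 ^ d * 2 ^ n) ^ q) (2 ^ n)
      tail≢0 : NonZero (s ^ n * ((2 ^ d * 2 ^ n) ^ q * 2 ^ n))
      tail≢0 = ℕ.m*n≢0 (s ^ n) ((2 ^ d * 2 ^ n) ^ q * 2 ^ n)
    length-seeds : length seeds ≡ G * (s ^ n * ((2 ^ d * 2 ^ n) ^ q * 2 ^ n))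
    length-seeds = trans (length-product _,_ (allFin G) _) (cong₂ _*_ (length-allFin G)
      (trans (length-product _,_ (words (allFin s) n) _) (cong₂ _*_ (trans (length-words (allFin s) n) (cong (_^ n) (length-allFin s)))
      (trans (length-product _,_ (words Ω q) (points n)) (cong₂ _*_ (trans (length-words Ω q) (cong (_^ q)
        (trans (length-product _,_ (points d) (points n)) (cong₂ _*_ (length-points d) (length-points n))))) (length-points n))))))
    nz : NonZero (G * (s ^ n * ((2 ^ d * 2 ^ n) ^ q * 2 ^ n)))
    nz = ℕ.m*n≢0 G (s ^ n * ((2 ^ d * 2 ^ n) ^ q * 2 ^ n))

  correctable : ¬ Any (Bad m L c) (params n d k) → 12 * k ≤ℕ G → 12 * (k * k) ≤ℕ s → 12 * length candidates ≤ℕ 2 ^ Q →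
                NonAdaptivelyLocallyCorrectable (120 * Q) (ℤ.+ 1 /ℚ 1000) (symmetricFun J c)
  correctable good 12k≤G 12k²≤s few with seeds⁺ , seeds⁺≡ ← nonempty seeds seeds≢[] = List⁺.map algorithm seeds⁺ , λ σ g close x →
    ≤-Pr (List⁺.map algorithm seeds⁺) (correct? σ g x) 2 3
      (subst₂ _≤ℕ_ (cong (2 *_) (sym (trans (length-map algorithm (toList seeds⁺)) (cong length seeds⁺≡))))
                   (cong (3 *_) (sym (trans (∑-map (λ alg → 𝟙 (correct? σ g x alg)) algorithm (toList seeds⁺))
                                            (cong (λ xs → ∑ xs (λ seed → 𝟙 (success? σ g x seed))) seeds⁺≡))))
        (success-likely σ g x good 12k≤G 12k²≤s few (sparse σ g x close)))
    where
    correct? : ∀ σ g x (alg : NonAdaptiveAlgorithm n q) → Dec (NonAdaptiveAlgorithm.run alg g x ≡ isomorph σ (symmetricFun J c) x)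
    correct? σ g x alg = NonAdaptiveAlgorithm.run alg g x Bool.≟ isomorph σ (symmetricFun J c) x
    sparse : ∀ σ g x → Close (ℤ.+ 1 /ℚ 1000) g (isomorph σ (symmetricFun J c)) → 1000 * ∑ (points n) (err σ g x) ≤ℕ 2 ^ n
    sparse σ g x close = subst₂ _≤ℕ_ (cong (λ xs → 1000 * ∑ xs (err σ g x)) (toList-allPoints n))
      (trans (ℕ.*-identityˡ _) (trans (cong length (toList-allPoints n)) (length-points n)))
      (Pr-≤⁻¹ (allPoints n) (λ y → ¬? (g y Bool.≟ isomorph σ (symmetricFun J c) y)) 1 1000 close)

-- Since 2^l ≤ k, every a/b above log₂ k is also above l: 2^(lb) ≤ k^b ≤ 2^a. The bound in `k * l`
-- is weakened to one in `k * (l * l)` on the way.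
atMost : ∀ k l q → 2 ^ l ≤ℕ k → 1 ≤ℕ l → q ≤ℕ 1680 * (k * l) → AtMostCklog²k (ℤ.+ 1680 /ℚ 1) k q
atMost k l q 2^l≤k 1≤l q≤ a (suc b) k^b≤2^a = *≤* (subst₂ ℤ._≤_ lhs rhs (ℤ.+≤+ (begin
  q * (1 * (B * B))                      ≡⟨ cong (q *_) (ℕ.*-identityˡ (B * B)) ⟩
  q * (B * B)                            ≤⟨ ℕ.*-monoˡ-≤ (B * B) q≤ ⟩
  1680 * (k * l) * (B * B)               ≤⟨ ℕ.*-monoˡ-≤ (B * B) (ℕ.*-monoʳ-≤ 1680 (ℕ.*-monoʳ-≤ k (ℕ.m≤m*n l l {{>-nonZero 1≤l}}))) ⟩
  1680 * (k * (l * l)) * (B * B)         ≡⟨ solve 4 (λ c x y z → c :* (x :* (y :* y)) :* (z :* z) := c :* x :* ((y :* z) :* (y :* z))) refl 1680 k l B ⟩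
  1680 * k * ((l * B) * (l * B))         ≤⟨ ℕ.*-monoʳ-≤ (1680 * k) (ℕ.*-mono-≤ lB≤a lB≤a) ⟩
  1680 * k * (a * a)                     ≡⟨ ℕ.*-identityʳ _ ⟨
  1680 * k * (a * a) * 1                 ∎)))
  where
  open ℕ.≤-Reasoning
  open +-*-Solver
  B = suc b
  lB≤a : l * B ≤ℕ a
  lB≤a = 2^-cancel-≤ (l * B) a (ℕ.≤-trans (ℕ.≤-reflexive (sym (ℕ.^-*-assoc 2 l B))) (ℕ.≤-trans (ℕ.^-monoˡ-≤ B 2^l≤k) k^b≤2^a))
  lhs : ℤ.+ (q * (1 * (B * B))) ≡ ℤ.+ q ℤ.* ℤ.+ (1 * (B * B))
  lhs = ℤ.pos-* q (1 * (B * B))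
  rhs : ℤ.+ (1680 * k * (a * a) * 1) ≡ ℤ.+ 1680 ℤ.* ℤ.+ k ℤ.* (ℤ.+ a ℤ.* ℤ.+ a) ℤ.* ℤ.+ 1
  rhs = trans (ℤ.pos-* (1680 * k * (a * a)) 1) (cong (ℤ._* ℤ.+ 1) (trans (ℤ.pos-* (1680 * k) (a * a)) (cong₂ ℤ._*_ (ℤ.pos-* 1680 k) (ℤ.pos-* a a))))

does-false : {P : Set} (P? : Dec P) → does P? ≡ false → ¬ P
does-false (no ¬p) _ = ¬p

module _ (c₀ N₁ : ℕ) (large : Threshold c₀ N₁) where

  -- Below 2^N₁ the fraction is 1 and every core is declared exceptional; from there on it is the
  -- 1/(n+1) supplied by `exceptional-rare-large`.
  δ-cases : ∀ n → Dec (2 ^ N₁ ≤ℕ n) → ℚᵘ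
  δ-cases n (yes _) = ℤ.+ 1 /ℚ suc n
  δ-cases n (no _)  = ℤ.+ 1 /ℚ 1

  δ : ℕ → ℚᵘ
  δ n = δ-cases n (2 ^ N₁ ≤? n)

  δ→0 : TendsToZero δ
  δ→0 (mkℚᵘ (ℤ.+ 0) q) (*<* (ℤ.+<+ ()))
  δ→0 (mkℚᵘ (ℤ.-[1+ _ ]) q) (*<* ())
  δ→0 η@(mkℚᵘ (ℤ.+ suc p) q) _ = 2 ^ N₁ ⊔ suc q , λ n N≤n →
    small n (2 ^ N₁ ≤? n) (ℕ.m⊔n≤o⇒m≤o (2 ^ N₁) (suc q) N≤n) (ℕ.m⊔n≤o⇒n≤o (2 ^ N₁) (suc q) N≤n)
    where
    small : ∀ n (dec : Dec (2 ^ N₁ ≤ℕ n)) → 2 ^ N₁ ≤ℕ n → suc q ≤ℕ n → ∣ δ-cases n dec ∣ℚ <ℚ η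
    small n (no ¬p) N₁≤n _   = contradiction N₁≤n ¬p
    small n (yes _) _    q<n = *<* (subst₂ ℤ._<_ (ℤ.pos-* 1 (suc q)) (ℤ.pos-* (suc p) (suc n)) (ℤ.+<+ (begin-strict
      1 * suc q        ≡⟨ ℕ.*-identityˡ (suc q) ⟩
      suc q            ≤⟨ q<n ⟩
      n                <⟨ ℕ.n<1+n n ⟩
      suc n            ≤⟨ ℕ.m≤n*m (suc n) (suc p) ⟩
      suc p * suc n    ∎)))
      where open ℕ.≤-Reasoning

  almost-all-correctable : ∀ n (J : Subset n) → 2 ≤ℕ ∣ J ∣ →
    AllButFraction ∣ J ∣ ∣ ∁ J ∣ (δ n) (λ c → Σ[ q ∈ ℕ ]
      (AtMostCklog²k (ℤ.+ 1680 /ℚ 1) ∣ J ∣ q × NonAdaptivelyLocallyCorrectable q (ℤ.+ 1 /ℚ 1000) (symmetricFun J c)))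
  almost-all-correctable n J 2≤k = cases (2 ^ N₁ ≤? n)
    where
    k = ∣ J ∣
    m = ∣ ∁ J ∣
    cases : (dec : Dec (2 ^ N₁ ≤ℕ n)) → AllButFraction k m (δ-cases n dec) (λ c → Σ[ q ∈ ℕ ]
      (AtMostCklog²k (ℤ.+ 1680 /ℚ 1) k q × NonAdaptivelyLocallyCorrectable q (ℤ.+ 1 /ℚ 1000) (symmetricFun J c)))
    cases (no _) = (λ _ → true) , Pr-≤ (allCores k m) (λ _ → T? true) 1 1
      (ℕ.*-monoʳ-≤ 1 (ℕ.≤-reflexive (sym (length≡∑1 (toList (allCores k m)))))) , λ _ ()
    -- `log-bounds` speaks of a successor, hence `k ∸ 1`. It makes `l` the integer part of log₂ k,
    -- and k ≥ 2 gives `1 ≤ l`.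
    cases (yes n-large) with l , 2^l≤ , <2^ ← log-bounds 2 (s≤s (s≤s z≤n)) (k ∸ 1) =
      exceptional , rare , λ c c-good → 120 * Q , atMost k l (120 * Q) 2^l≤k 1≤l (queries≤ 1≤l) ,
        correctable J c s G L rest Q n≡ (does-false (exceptional? {k} n d m L c) c-good) 12k≤G 12k²≤s few-candidates
      where
      k≡ : suc (k ∸ 1) ≡ k
      k≡ = ℕ.m+[n∸m]≡n (ℕ.<⇒≤ 2≤k)
      2^l≤k : 2 ^ l ≤ℕ k
      2^l≤k = subst (2 ^ l ≤ℕ_) k≡ 2^l≤
      k<2^[1+l] : k <ℕ 2 ^ suc l
      k<2^[1+l] = subst (_<ℕ 2 ^ suc l) k≡ <2^
      1≤l : 1 ≤ℕ l
      1≤l = ℕ.≤-pred (2^-cancel-< 1 (suc l) (ℕ.≤-<-trans 2≤k k<2^[1+l]))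
      open Parameters n k l (ℕ.<⇒≤ 2≤k) 2^l≤k k<2^[1+l]
      exceptional : Core k m → Bool
      exceptional c = does (exceptional? {k} n d m L c)
      rare : Pr (allCores k m) (λ c → T? (exceptional c)) ≤ℚ (ℤ.+ 1 /ℚ suc n)
      rare = Pr-≤ (allCores k m) (λ c → T? (exceptional c)) 1 (suc n)
        (subst (λ xs → suc n * ∑ xs (λ c → 𝟙 (exceptional? {k} n d m L c)) ≤ℕ 1 * length xs) (sym (toList-allPoints (2 ^ k * suc m)))
          (ℕ.≤-trans (exceptional-rare-large c₀ N₁ large n k l n-large (ℕ.<⇒≤ 2≤k) 2^l≤k k<2^[1+l] m
              (subst (L ≤ℕ_) (sym (∣∁p∣≡n∸∣p∣ J)) L≤n∸k))
            (ℕ.≤-reflexive (sym (ℕ.*-identityˡ _)))))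

open import Data.Integer using (+_)
open import Data.Rational.Unnormalised using (_/_; _<_)

theorem1p2 : Σ[ C ∈ ℚᵘ ] Σ[ δ ∈ (ℕ → ℚᵘ) ]
    (0ℚᵘ < C ×
    TendsToZero δ ×
    (∀ (n k : ℕ) → 2 ≤ℕ k → k <ℕ n →
    ∀ (J : Subset n) → ∣ J ∣ ≡ k →
    AllButFraction ∣ J ∣ ∣ ∁ J ∣ (δ n) (λ c →
    Σ[ q ∈ ℕ ]
    (AtMostCklog²k C k q ×
    NonAdaptivelyLocallyCorrectable q (+ 1 / 1000) (symmetricFun J c)))))
theorem1p2 = from threshold
  where
  from : ∃[ c₀ ] ∃[ N₁ ] Threshold c₀ N₁ → _
  from (c₀ , N₁ , large) = + 1680 / 1 , δ c₀ N₁ large , *<* (ℤ.+<+ (s≤s z≤n)) , δ→0 c₀ N₁ large ,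
    λ { n .(∣ J ∣) 2≤k _ J refl → almost-all-correctable c₀ N₁ large n J 2≤k }
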